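{- Out of all rooted ordered binary trees $T$ of size $k$, the trees for which $\mathbb{P}(\mathrm{DTCS}(k)=T)$ is minimal are the orderings of $\mathrm{Cat}(k)$, with $$\mathbb{P}(\mathrm{DTCS}(k)=\mathrm{Cat}(k))=k\,2^{ -k+1}\prod_{i=2}^k\frac{1}{h_{i-1}}=\exp\big(-(1+o(1))\,k\log\log k\big),$$ where the last equality is as $k\to\infty$.
   Context: Binary trees are rooted full binary trees: every internal vertex has exactly two children. The size of a tree is its number of leaves. Ordered trees (plane trees) are trees in which the left and right subtrees of each internal vertex are distinguished; $T=T'$ means identical as rooted ordered trees, and $T\cong T'$ means identical as rooted unordered trees. An ordering of a rooted binary tree $T$ is any rooted ordered tree $T'$ with $T'\cong T$. For $m\ge 2$ let $h_{m-1}=\sum_{j=1}^{m-1}1/j$ and let $q_m$ be the probability distribution on $\{1,\dots,m-1\}$ given by $$q_m(i)=\frac{m}{2h_{m-1}}\,\frac{1}{i(m-i)}.$$ The discrete-time critical beta-splitting tree $\mathrm{DTCS}(n)$ is the random rooted ordered binary tree with $n$ leaves built as follows: split $[n]=\{1,\dots,n\}$ into a left subtree on $\{1,\dots,L_n\}$ and a right subtree on $\{L_n+1,\dots,n\}$, where $L_n$ has distribution $q_n$; then recursively and independently split each interval of size $m\ge2$ into left and right parts according to $q_m$, stopping at intervals of size $m=1$ (the leaves). Leaf labels are disregarded when comparing shapes. $\mathrm{Cat}(k)$ (the caterpillar tree) is the rooted ordered binary tree of size $k$ in which all splits are of size $1$: each internal vertex has a leaf as its left child, and its right subtree is the caterpillar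 on the remaining leaves ($\mathrm{Cat}(1)$ is a single leaf). $\log$ is the natural logarithm. -}

module Defs where

open import Data.Bool.Base using (if_then_else_)
open import Data.Fin.Base using (Fin; toℕ)
open import Data.Fin.Properties using (toℕ<n)
open import Data.Integer.Base as ℤ using (+_)
import Data.Integer.Properties as ℤP
open import Data.List.Base using (List; []; _∷_; map; concatMap; foldr; filter; allFin; upTo)
open import Data.Nat.Base as ℕ using (ℕ; zero; suc; s≤s; z≤n)
open import Data.Nat.Induction using (Acc; acc; <-wellFounded)
import Data.Nat.Properties as ℕP
open import Data.Product.Base using (∃; _×_; _,_; proj₁; proj₂)
open import Data.Rational.Base
open import Data.Rational.Properties
open import Data.Rational.Solver using (module +-*-Solver)
open import Data.Sum.Base using (_⊎_; inj₁; inj₂; [_,_]′)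
open import Relation.Binary.Definitions using (DecidableEquality)
open import Relation.Binary.PropositionalEquality
  using (_≡_; refl; sym; trans; cong; cong₂; subst)
open import Relation.Nullary using (¬_; yes; no; does)
open import Relation.Unary using (Decidable)

import Data.Rational.Unnormalised.Base as ℚᵘ
import Data.Rational.Unnormalised.Properties as ℚᵘP

open +-*-Solver using (solve; _:=_; _:+_; _:*_; _:-_; :-_; con)

fromℕ : ℕ → ℚ
fromℕ n = + n / 1

data Tree : Set where
  leaf : Tree
  node : (l r : Tree) → Tree

size : Tree → ℕ
size leaf       = 1
size (node l r) = size l ℕ.+ size r

_≟ᵀ_ : DecidableEquality Tree
leaf     ≟ᵀ leaf       = yes refl
leaf     ≟ᵀ node _ _   = no λ ()
node _ _ ≟ᵀ leaf       = no λ ()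
node l r ≟ᵀ node l′ r′ with l ≟ᵀ l′ | r ≟ᵀ r′
... | yes refl | yes refl = yes refl
... | no l≢l′  | _        = no λ { refl → l≢l′ refl }
... | _        | no r≢r′  = no λ { refl → r≢r′ refl }

infix 4 _≅_

-- T′ ≅ T: equality as unordered trees, i.e. T′ is an ordering of T.
data _≅_ : Tree → Tree → Set where
  leaf : leaf ≅ leaf
  node : ∀ {l r l′ r′} → l ≅ l′ → r ≅ r′ → node l r ≅ node l′ r′
  swap : ∀ {l r l′ r′} → l ≅ r′ → r ≅ l′ → node l r ≅ node l′ r′

Cat : (k : ℕ) → .{{_ : ℕ.NonZero k}} → Tree
Cat (suc zero)    = leaf
Cat (suc (suc k)) = node leaf (Cat (suc k))

-- Finite distributions are lists of weighted outcomes.  An outcome may be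
-- listed several times; its probability is its total weight.
Dist : Set → Set
Dist A = List (A × ℚ)

pure : ∀ {A} → A → Dist A
pure a = (a , 1ℚ) ∷ []

infixl 1 _>>=_

_>>=_ : ∀ {A B} → Dist A → (A → Dist B) → Dist B
d >>= f = concatMap (λ (a , p) → map (λ (b , p′) → b , p * p′) (f a)) d

sumℚ productℚ : List ℚ → ℚ
sumℚ     = foldr _+_ 0ℚ
productℚ = foldr _*_ 1ℚ

prob : Dist Tree → Tree → ℚ
prob d T = sumℚ (map proj₂ (filter (λ (T′ , _) → T′ ≟ᵀ T) d))

h : ℕ → ℚ
h zero    = 0ℚ
h (suc n) = h n + + 1 / suc n

h-pos : ∀ n → Positive (h (suc n))
h-nonNeg : ∀ n → NonNegative (h n)

h-nonNeg zero    = _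
h-nonNeg (suc n) = pos⇒nonNeg (h (suc n)) {{h-pos n}}

h-pos n = nonNeg+pos⇒pos (h n) {{h-nonNeg n}} (+ 1 / suc n) {{normalize-pos 1 (suc n)}}

1/h : (n : ℕ) → .{{_ : ℕ.NonZero n}} → ℚ
1/h (suc n) = (1/ h (suc n)) {{pos⇒nonZero (h (suc n)) {{h-pos n}}}}

-- An interval of size m = r + 2 is split into i = toℕ j + 1 and m - i
-- elements, where j ranges over Fin (m - 1); q r j is q_m(i).  The labels of
-- the leaves are determined by the shape and are not recorded.
leftSize rightSize : ∀ r → Fin (suc r) → ℕ
leftSize  r j = suc (toℕ j)
rightSize r j = suc (r ℕ.∸ toℕ j)

q : ∀ r → Fin (suc r) → ℚ
q r j = + (2 ℕ.+ r) / 2 * 1/h (suc r) * (+ 1 / (leftSize r j ℕ.* rightSize r j))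

splitDist : ∀ r → Dist (Fin (suc r))
splitDist r = map (λ j → j , q r j) (allFin (suc r))

dtcs : (n : ℕ) → .{{_ : ℕ.NonZero n}} → Acc ℕ._<_ n → Dist Tree
dtcs (suc zero)    _        = pure leaf
dtcs (suc (suc r)) (acc rs) =
  splitDist r                                   >>= λ j →
  dtcs (leftSize r j)  (rs (s≤s (toℕ<n j)))      >>= λ L →
  dtcs (rightSize r j) (rs (s≤s (s≤s (ℕP.m∸n≤m r (toℕ j))))) >>= λ R →
  pure (node L R)

DTCS : (n : ℕ) → .{{_ : ℕ.NonZero n}} → Dist Tree
DTCS n = dtcs n (<-wellFounded n)

-- T attains the minimum of ℙ(DTCS(k) = ·) over the ordered trees of size k.
IsMinimiser : (k : ℕ) → .{{_ : ℕ.NonZero k}} → Tree → Set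
IsMinimiser k T =
  size T ≡ k × (∀ T′ → size T′ ≡ k → prob (DTCS k) T ≤ prob (DTCS k) T′)

module Facts where
  private variable
    a b c d p ε : ℚ

  pos* : 0ℚ < a → 0ℚ < b → 0ℚ < a * b
  pos* {a} {b} 0<a 0<b =
    positive⁻¹ (a * b) {{pos*pos⇒pos a {{positive 0<a}} b {{positive 0<b}}}}

  pos+ : 0ℚ < a → 0ℚ ≤ b → 0ℚ < a + b
  pos+ 0<a 0≤b = +-mono-<-≤ 0<a 0≤b

  nonNeg* : 0ℚ ≤ a → 0ℚ ≤ b → 0ℚ ≤ a * b
  nonNeg* {a} {b} 0≤a 0≤b = nonNegative⁻¹ (a * b)
    {{nonNeg*nonNeg⇒nonNeg a {{nonNegative 0≤a}} b {{nonNegative 0≤b}}}}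

  nonNeg+ : 0ℚ ≤ a → 0ℚ ≤ b → 0ℚ ≤ a + b
  nonNeg+ 0≤a 0≤b = +-mono-≤ 0≤a 0≤b

  *-mono-≤ : 0ℚ ≤ a → 0ℚ ≤ d → a ≤ b → c ≤ d → a * c ≤ b * d
  *-mono-≤ {a} {d} {b} {c} 0≤a 0≤d a≤b c≤d = ≤-trans
    (*-monoˡ-≤-nonNeg a {{nonNegative 0≤a}} c≤d)
    (*-monoʳ-≤-nonNeg d {{nonNegative 0≤d}} a≤b)

  -- a ≤ b can be proved from any equation b = a + c with 0 ≤ c.
  ≤-from : ∀ a c → 0ℚ ≤ c → a + c ≡ b → a ≤ b
  ≤-from a c 0≤c eq =
    subst (a ≤_) eq (subst (_≤ a + c) (+-identityʳ a) (+-monoʳ-≤ a 0≤c))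

  0≤- : a ≤ b → 0ℚ ≤ b - a
  0≤- {a} {b} a≤b = subst (_≤ b - a) (+-inverseʳ a) (+-monoˡ-≤ (- a) a≤b)

  ∣∣-intro : a ≤ ε → - a ≤ ε → ∣ a ∣ ≤ ε
  ∣∣-intro {a} a≤ε -a≤ε with ∣p∣≡p∨∣p∣≡-p a
  ... | inj₁ eq = subst (_≤ _) (sym eq) a≤ε
  ... | inj₂ eq = subst (_≤ _) (sym eq) -a≤ε

  ≤∣∣ : ∀ a → a ≤ ∣ a ∣
  ≤∣∣ a with ≤-total 0ℚ a
  ... | inj₁ 0≤a = ≤-reflexive (sym (0≤p⇒∣p∣≡p 0≤a))
  ... | inj₂ a≤0 = ≤-trans a≤0 (0≤∣p∣ a)

  ∣∣-elim : ∣ a ∣ ≤ ε → a ≤ ε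
  ∣∣-elim = ≤-trans (≤∣∣ _)

  ∣∣-sym : ∀ a b → ∣ a - b ∣ ≡ ∣ b - a ∣
  ∣∣-sym a b = trans (sym (∣-p∣≡∣p∣ (a - b)))
    (cong ∣_∣ (solve 2 (λ a b → :- (a :- b) := b :- a) refl a b))

  ∣∣-resp : a ≡ b → ∣ a ∣ ≤ c → ∣ b ∣ ≤ c
  ∣∣-resp refl a≤c = a≤c

  ∣∣-+ : ∀ a b → ∣ a ∣ ≤ c → ∣ b ∣ ≤ d → ∣ a + b ∣ ≤ c + d
  ∣∣-+ a b a≤c b≤d = ≤-trans (∣p+q∣≤∣p∣+∣q∣ a b) (+-mono-≤ a≤c b≤d)

  ∣∣-* : ∀ a b → ∣ a ∣ ≤ c → ∣ b ∣ ≤ d → ∣ a * b ∣ ≤ c * d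
  ∣∣-* {c} {d} a b a≤c b≤d = subst (_≤ c * d) (sym (∣p*q∣≡∣p∣*∣q∣ a b))
    (*-mono-≤ (0≤∣p∣ a) (≤-trans (0≤∣p∣ b) b≤d) a≤c b≤d)

  ∣∣-∣∣ : ∀ a b → ∣ ∣ a ∣ - ∣ b ∣ ∣ ≤ ∣ a - b ∣
  ∣∣-∣∣ a b = ∣∣-intro (half a b)
    (subst (_≤ ∣ a - b ∣) (solve 2 (λ a b → b :- a := :- (a :- b)) refl ∣ a ∣ ∣ b ∣)
      (subst (∣ b ∣ - ∣ a ∣ ≤_) (∣∣-sym b a) (half b a)))
    where
    half : ∀ a b → ∣ a ∣ - ∣ b ∣ ≤ ∣ a - b ∣
    half a b = subst (∣ a ∣ - ∣ b ∣ ≤_)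
      (solve 2 (λ x y → x :+ y :- y := x) refl ∣ a - b ∣ ∣ b ∣)
      (+-monoˡ-≤ (- ∣ b ∣) (subst (λ x → ∣ x ∣ ≤ ∣ a - b ∣ + ∣ b ∣)
        (solve 2 (λ a b → a :- b :+ b := a) refl a b) (∣p+q∣≤∣p∣+∣q∣ (a - b) b)))

  triangle : ∀ a b c → ∣ a - b ∣ ≤ p → ∣ b - c ∣ ≤ d → ∣ a - c ∣ ≤ p + d
  triangle a b c ab bc = ∣∣-resp
    (solve 3 (λ a b c → (a :- b) :+ (b :- c) := a :- c) refl a b c) (∣∣-+ (a - b) (b - c) ab bc)

  fromℕ-mono : ∀ {m n} → m ℕ.≤ n → fromℕ m ≤ fromℕ n
  fromℕ-mono {m} {n} m≤n = toℚᵘ-cancel-≤ (ℚᵘP.≤-respˡ-≃ (ℚᵘP.≃-sym (toℚᵘ-fromℚᵘ (ℚᵘ.mkℚᵘ (+ m) 0)))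
    (ℚᵘP.≤-respʳ-≃ (ℚᵘP.≃-sym (toℚᵘ-fromℚᵘ (ℚᵘ.mkℚᵘ (+ n) 0)))
      (ℚᵘ.*≤* (ℤP.*-monoʳ-≤-nonNeg (+ 1) (ℤ.+≤+ m≤n)))))

  0≤fromℕ : ∀ n → 0ℚ ≤ fromℕ n
  0≤fromℕ n = fromℕ-mono {0} {n} z≤n

  1/suc : ℕ → ℚ
  1/suc n = + 1 / suc n

  0<1/suc : ∀ n → 0ℚ < 1/suc n
  0<1/suc n = positive⁻¹ (1/suc n) {{normalize-pos 1 (suc n)}}

  0≤1/suc : ∀ n → 0ℚ ≤ 1/suc n
  0≤1/suc n = <⇒≤ (0<1/suc n)

  suc*1/suc : ∀ n → fromℕ (suc n) * 1/suc n ≡ 1ℚ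
  suc*1/suc n = toℚᵘ-injective (ℚᵘP.≃-trans (toℚᵘ-homo-* (fromℕ (suc n)) (1/suc n))
    (ℚᵘP.≃-trans (ℚᵘP.*-cong (toℚᵘ-fromℚᵘ (ℚᵘ.mkℚᵘ (+ suc n) 0)) (toℚᵘ-fromℚᵘ (ℚᵘ.mkℚᵘ (+ 1) n)))
      (ℚᵘ.*≡* (cong +_ (trans (ℕP.*-identityʳ _) (trans (ℕP.*-identityʳ (suc n)) (sym (trans (ℕP.+-identityʳ _) (ℕP.+-identityʳ _)))))))))

  fromℕ-suc : ∀ n → fromℕ (suc n) ≡ 1ℚ + fromℕ n
  fromℕ-suc n = toℚᵘ-injective (ℚᵘP.≃-trans (toℚᵘ-fromℚᵘ (ℚᵘ.mkℚᵘ (+ suc n) 0))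
    (ℚᵘP.≃-sym (ℚᵘP.≃-trans (toℚᵘ-homo-+ 1ℚ (fromℕ n))
    (ℚᵘP.≃-trans (ℚᵘP.+-cong (ℚᵘP.≃-refl {ℚᵘ.1ℚᵘ}) (toℚᵘ-fromℚᵘ (ℚᵘ.mkℚᵘ (+ n) 0)))
      (ℚᵘ.*≡* (cong (ℤ._* (+ 1)) (cong (λ z → (+ 1) ℤ.+ z) (ℤP.*-identityʳ (+ n)))))))))

  -- ∣ numerator ∣ bounds the absolute value.
  archi : ℚ → ℕ
  archi p = ℤ.∣ ↥ p ∣

  ≤archi : ∀ p → p ≤ fromℕ (archi p)
  ≤archi (mkℚ (+ n) d _) = toℚᵘ-cancel-≤
    (ℚᵘP.≤-respʳ-≃ (ℚᵘP.≃-sym (toℚᵘ-fromℚᵘ (ℚᵘ.mkℚᵘ (+ n) 0)))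
      (ℚᵘ.*≤* (ℤP.*-monoˡ-≤-nonNeg (+ n) (ℤ.+≤+ (s≤s z≤n)))))
  ≤archi (mkℚ (ℤ.-[1+ n ]) d _) = toℚᵘ-cancel-≤
    (ℚᵘP.≤-respʳ-≃ (ℚᵘP.≃-sym (toℚᵘ-fromℚᵘ (ℚᵘ.mkℚᵘ (+ suc n) 0)))
      (ℚᵘ.*≤* ℤ.-≤+))

  1/suc-small : 0ℚ < ε → ∃ λ N → ∀ n → N ℕ.≤ n → 1/suc n ≤ ε
  1/suc-small {mkℚ (+ zero) d _} (*<* (ℤ.+<+ ()))
  1/suc-small {mkℚ (+ suc a) d _} _ = d , λ n d≤n → toℚᵘ-cancel-≤
    (ℚᵘP.≤-respˡ-≃ (ℚᵘP.≃-sym (toℚᵘ-fromℚᵘ (ℚᵘ.mkℚᵘ (+ 1) n)))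
      (ℚᵘ.*≤* (ℤP.≤-trans (ℤP.≤-reflexive (ℤP.*-identityˡ (+ suc d)))
        (ℤP.≤-trans (ℤ.+≤+ (s≤s d≤n)) (ℤ.+≤+ (ℕP.m≤n*m (suc n) (suc a)))))))
  1/suc-small {mkℚ (ℤ.-[1+ _ ]) d _} (*<* ())

-- Real numbers are Cauchy sequences of rationals up to _≈_.
IsCauchy : (ℕ → ℚ) → Set
IsCauchy s =
  ∀ {ε} → 0ℚ < ε → ∃ λ N → ∀ m n → N ℕ.≤ m → N ℕ.≤ n → ∣ s m - s n ∣ ≤ ε

record ℝ : Set where
  constructor mkℝ
  field
    seq    : ℕ → ℚ
    cauchy : IsCauchy seq

open ℝ public

infix 4 _≈_ _≤ᴿ_

_≈_ : ℝ → ℝ → Set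
x ≈ y = ∀ {ε} → 0ℚ < ε → ∃ λ N → ∀ n → N ℕ.≤ n → ∣ seq x n - seq y n ∣ ≤ ε

_≤ᴿ_ : ℝ → ℝ → Set
x ≤ᴿ y = ∀ {ε} → 0ℚ < ε → ∃ λ N → ∀ n → N ℕ.≤ n → seq x n ≤ seq y n + ε

fromℚ : ℚ → ℝ
fromℚ p = mkℝ (λ _ → p) λ {ε} 0<ε → 0 , λ _ _ _ _ →
  subst (λ z → ∣ z ∣ ≤ ε) (sym (+-inverseʳ p)) (<⇒≤ 0<ε)

0ᴿ 1ᴿ : ℝ
0ᴿ = fromℚ 0ℚ
1ᴿ = fromℚ 1ℚ

fromℕᴿ : ℕ → ℝ
fromℕᴿ n = fromℚ (fromℕ n)

open Facts

private variable
  a b c B ε : ℚ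

-- It suffices to bound the differences by a fixed multiple of ε.
shrink : ∀ C → 0ℚ < ε → ∃ λ δ → 0ℚ < δ × C * δ ≤ ε
shrink {ε} C 0<ε = ε * 1/suc k , 0<δ , ≤-trans
  (*-monoʳ-≤-nonNeg _ {{nonNegative (<⇒≤ 0<δ)}} (≤-trans (≤archi C) (fromℕ-mono (ℕP.n≤1+n k))))
  (≤-reflexive (trans
    (solve 3 (λ s e i → s :* (e :* i) := e :* (s :* i)) refl (fromℕ (suc k)) ε (1/suc k))
    (trans (cong (ε *_) (suc*1/suc k)) (*-identityʳ ε))))
  where
  k   = archi C
  0<δ = pos* 0<ε (0<1/suc k)

cauchy-scaled : ∀ s C →
  (∀ {δ} → 0ℚ < δ → ∃ λ N → ∀ m n → N ℕ.≤ m → N ℕ.≤ n → ∣ s m - s n ∣ ≤ C * δ) →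
  IsCauchy s
cauchy-scaled s C H 0<ε =
  let δ , 0<δ , Cδ≤ε = shrink C 0<ε
      N , bnd = H 0<δ
  in N , λ m n N≤m N≤n → ≤-trans (bnd m n N≤m N≤n) Cδ≤ε

bounded : ∀ s → IsCauchy s → ∃ λ B → 0ℚ ≤ B × ∃ λ N → ∀ n → N ℕ.≤ n → ∣ s n ∣ ≤ B
bounded s cs with cs {1ℚ} (*<* (ℤ.+<+ (s≤s z≤n)))
... | N , bnd = 1ℚ + ∣ s N ∣ , nonNeg+ (0≤fromℕ 1) (0≤∣p∣ (s N)) , N , λ n N≤n →
  subst (λ z → ∣ z ∣ ≤ 1ℚ + ∣ s N ∣) (solve 2 (λ x y → x :- y :+ y := x) refl (s n) (s N))
    (∣∣-+ (s n - s N) (s N) (bnd n N N≤n ℕP.≤-refl) ≤-refl)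

≤⊔ˡ : ∀ {k} m n → m ℕ.⊔ n ℕ.≤ k → m ℕ.≤ k
≤⊔ˡ m n = ℕP.≤-trans (ℕP.m≤m⊔n m n)

≤⊔ʳ : ∀ {k} m n → m ℕ.⊔ n ℕ.≤ k → n ℕ.≤ k
≤⊔ʳ m n = ℕP.≤-trans (ℕP.m≤n⊔m m n)

infix  8 -ᴿ_
infixl 7 _*ᴿ_
infixl 6 _+ᴿ_

_+ᴿ_ : ℝ → ℝ → ℝ
mkℝ s cs +ᴿ mkℝ u cu = mkℝ (λ n → s n + u n) (cauchy-scaled (λ n → s n + u n) (1ℚ + 1ℚ) λ {δ} 0<δ →
  let N , p = cs 0<δ; M , q = cu 0<δ in
  N ℕ.⊔ M , λ m n ≤m ≤n →
    ∣∣-resp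
      (solve 4 (λ a b c d → (a :- b) :+ (c :- d) := (a :+ c) :- (b :+ d)) refl (s m) (s n) (u m) (u n))
      (≤-trans (∣∣-+ (s m - s n) (u m - u n) (p m n (≤⊔ˡ N M ≤m) (≤⊔ˡ N M ≤n)) (q m n (≤⊔ʳ N M ≤m) (≤⊔ʳ N M ≤n)))
        (≤-reflexive (solve 1 (λ d → d :+ d := (con 1ℚ :+ con 1ℚ) :* d) refl δ))))

_*ᴿ_ : ℝ → ℝ → ℝ
mkℝ s cs *ᴿ mkℝ u cu = mkℝ (λ n → s n * u n)
  (let S , _ , N₁ , ∣s∣≤S = bounded s cs; U , _ , N₂ , ∣u∣≤U = bounded u cu in
  cauchy-scaled (λ n → s n * u n) (S + U) λ {δ} 0<δ →
    let N , p = cs 0<δ; M , q = cu 0<δ in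
    (N ℕ.⊔ N₁) ℕ.⊔ (M ℕ.⊔ N₂) , λ m n ≤m ≤n →
      ∣∣-resp
        (solve 4 (λ a b c d → a :* (c :- d) :+ (a :- b) :* d := a :* c :- b :* d) refl (s m) (s n) (u m) (u n))
        (≤-trans (∣∣-+ (s m * (u m - u n)) ((s m - s n) * u n)
          (∣∣-* (s m) (u m - u n) (∣s∣≤S m (≤⊔ʳ N N₁ (≤⊔ˡ (N ℕ.⊔ N₁) (M ℕ.⊔ N₂) ≤m)))
                (q m n (≤⊔ˡ M N₂ (≤⊔ʳ (N ℕ.⊔ N₁) (M ℕ.⊔ N₂) ≤m)) (≤⊔ˡ M N₂ (≤⊔ʳ (N ℕ.⊔ N₁) (M ℕ.⊔ N₂) ≤n))))
          (∣∣-* (s m - s n) (u n) (p m n (≤⊔ˡ N N₁ (≤⊔ˡ (N ℕ.⊔ N₁) (M ℕ.⊔ N₂) ≤m)) (≤⊔ˡ N N₁ (≤⊔ˡ (N ℕ.⊔ N₁) (M ℕ.⊔ N₂) ≤n)))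
                (∣u∣≤U n (≤⊔ʳ M N₂ (≤⊔ʳ (N ℕ.⊔ N₁) (M ℕ.⊔ N₂) ≤n)))))
          (≤-reflexive (solve 3 (λ S U d → S :* d :+ d :* U := (S :+ U) :* d) refl S U δ))))

-ᴿ_ : ℝ → ℝ
-ᴿ mkℝ s cs = mkℝ (λ n → - s n) λ 0<ε →
  let N , p = cs 0<ε in
  N , λ m n ≤m ≤n → subst (_≤ _)
    (trans (∣∣-sym (s m) (s n)) (cong ∣_∣ (solve 2 (λ a b → b :- a := (:- a) :- (:- b)) refl (s m) (s n))))
    (p m n ≤m ≤n)

∣_∣ᴿ : ℝ → ℝ
∣ mkℝ s cs ∣ᴿ = mkℝ (λ n → ∣ s n ∣) λ 0<ε →
  let N , p = cs 0<ε in
  N , λ m n ≤m ≤n → ≤-trans (∣∣-∣∣ (s m) (s n)) (p m n ≤m ≤n)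

-- expTerm n a = aⁿ / n!
expTerm : ℕ → ℚ → ℚ
expTerm zero    a = 1ℚ
expTerm (suc n) a = expTerm n a * (a * (+ 1 / suc n))

-- expSum n a = 1 + a + ⋯ + aⁿ / n!
expSum : ℕ → ℚ → ℚ
expSum zero    a = expTerm zero a
expSum (suc n) a = expSum n a + expTerm (suc n) a

∣∣⇒0≤ : ∣ a ∣ ≤ B → 0ℚ ≤ B
∣∣⇒0≤ {a} = ≤-trans (0≤∣p∣ a)

∣1/suc∣ : ∀ n → ∣ 1/suc n ∣ ≤ 1/suc n
∣1/suc∣ n = ≤-reflexive (0≤p⇒∣p∣≡p (0≤1/suc n))

expTerm-nonNeg : ∀ n → 0ℚ ≤ a → 0ℚ ≤ expTerm n a
expTerm-nonNeg zero    0≤a = 0≤fromℕ 1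
expTerm-nonNeg (suc n) 0≤a = nonNeg* (expTerm-nonNeg n 0≤a) (nonNeg* 0≤a (0≤1/suc n))

expSum-nonNeg : ∀ n → 0ℚ ≤ a → 0ℚ ≤ expSum n a
expSum-nonNeg zero    0≤a = 0≤fromℕ 1
expSum-nonNeg (suc n) 0≤a = nonNeg+ (expSum-nonNeg n 0≤a) (expTerm-nonNeg (suc n) 0≤a)

expTerm-abs : ∀ n → ∣ a ∣ ≤ B → ∣ expTerm n a ∣ ≤ expTerm n B
expTerm-abs zero    _ = ≤-refl
expTerm-abs {a} (suc n) p =
  ∣∣-* (expTerm n a) (a * 1/suc n) (expTerm-abs {a} n p) (∣∣-* a (1/suc n) p (∣1/suc∣ n))

expSum-diff : ∀ n d → ∣ a ∣ ≤ B →
  ∣ expSum (d ℕ.+ n) a - expSum n a ∣ ≤ expSum (d ℕ.+ n) B - expSum n B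
expSum-diff {a} {B} n zero p =
  ≤-reflexive (trans (cong ∣_∣ (+-inverseʳ (expSum n a))) (sym (+-inverseʳ (expSum n B))))
expSum-diff {a} {B} n (suc d) p =
  subst (λ z → ∣ z ∣ ≤ expSum (suc d ℕ.+ n) B - expSum n B) (shuffle a)
    (subst (∣ (expSum (d ℕ.+ n) a - expSum n a) + expTerm (suc (d ℕ.+ n)) a ∣ ≤_) (shuffle B)
      (∣∣-+ (expSum (d ℕ.+ n) a - expSum n a) (expTerm (suc (d ℕ.+ n)) a)
        (expSum-diff {a} n d p) (expTerm-abs {a} (suc (d ℕ.+ n)) p)))
  where
  shuffle : ∀ a → expSum (d ℕ.+ n) a - expSum n a + expTerm (suc (d ℕ.+ n)) a
                ≡ expSum (suc d ℕ.+ n) a - expSum n a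
  shuffle a = solve 3 (λ x y z → x :- y :+ z := x :+ z :- y) refl
    (expSum (d ℕ.+ n) a) (expSum n a) (expTerm (suc (d ℕ.+ n)) a)

expTerm-lip : ∀ n → ∣ a ∣ ≤ B → ∣ b ∣ ≤ B →
  ∣ expTerm (suc n) a - expTerm (suc n) b ∣ ≤ ∣ a - b ∣ * expTerm n B
expTerm-lip {a} {B} {b} zero p q = ≤-reflexive (trans (cong ∣_∣
    (solve 2 (λ a b → con 1ℚ :* (a :* con 1ℚ) :- con 1ℚ :* (b :* con 1ℚ) := a :- b) refl a b))
    (sym (*-identityʳ ∣ a - b ∣)))
expTerm-lip {a} {B} {b} (suc n) p q =
  ∣∣-resp
    (solve 5 (λ t u a b i → ((t :- u) :* a :+ (a :- b) :* u) :* i := t :* (a :* i) :- u :* (b :* i)) refl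
      t u a b r)
    (≤-trans
      (∣∣-* ((t - u) * a + (a - b) * u) r
        (∣∣-+ ((t - u) * a) ((a - b) * u)
          (∣∣-* (t - u) a (expTerm-lip {a} {b = b} n p q) p)
          (∣∣-* (a - b) u ≤-refl (expTerm-abs {b} (suc n) q)))
        (∣1/suc∣ (suc n)))
      (≤-reflexive eq))
  where
  D = ∣ a - b ∣
  r = 1/suc (suc n)
  t = expTerm (suc n) a
  u = expTerm (suc n) b
  T = expTerm n B
  eq : (D * T * B + D * expTerm (suc n) B) * r ≡ D * expTerm (suc n) B
  eq = trans
    (cong (λ z → (z + D * expTerm (suc n) B) * r)
      (trans (sym (*-identityˡ (D * T * B))) (cong (_* (D * T * B)) (sym (suc*1/suc n)))))
    (trans
      (solve 6 (λ s i D T B r →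
          (s :* i :* (D :* T :* B) :+ D :* (T :* (B :* i))) :* r :=
          D :* (T :* (B :* i)) :* ((con 1ℚ :+ s) :* r)) refl
        (fromℕ (suc n)) (1/suc n) D T B r)
      (trans (cong (λ z → D * (T * (B * 1/suc n)) * z)
          (trans (cong (_* r) (sym (fromℕ-suc (suc n)))) (suc*1/suc (suc n))))
        (*-identityʳ _)))

expSum-lip : ∀ n → ∣ a ∣ ≤ B → ∣ b ∣ ≤ B →
  ∣ expSum (suc n) a - expSum (suc n) b ∣ ≤ ∣ a - b ∣ * expSum n B
expSum-lip {a} {B} {b} zero p q = subst (λ z → ∣ z ∣ ≤ ∣ a - b ∣ * expSum 0 B)
  (solve 2 (λ x y → x :- y := (con 1ℚ :+ x) :- (con 1ℚ :+ y)) refl (expTerm 1 a) (expTerm 1 b))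
  (expTerm-lip {a} {b = b} 0 p q)
expSum-lip {a} {B} {b} (suc n) p q = ∣∣-resp
  (solve 4 (λ x y z w → (x :- y) :+ (z :- w) := (x :+ z) :- (y :+ w)) refl
    (expSum (suc n) a) (expSum (suc n) b) (expTerm (2 ℕ.+ n) a) (expTerm (2 ℕ.+ n) b))
  (≤-trans (∣∣-+ (expSum (suc n) a - expSum (suc n) b) (expTerm (2 ℕ.+ n) a - expTerm (2 ℕ.+ n) b)
      (expSum-lip {a} {b = b} n p q) (expTerm-lip {a} {b = b} (suc n) p q))
    (≤-reflexive (sym (*-distribˡ-+ ∣ a - b ∣ (expSum n B) (expTerm (suc n) B)))))

-- For n ≥ 2B each term is at most half the preceding one, so that
-- expSum n B + expTerm n B decreases.
start : ℚ → ℕ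
start B = archi (B + B)

decreases : ∀ n → 0ℚ ≤ B → start B ℕ.≤ n →
  expSum (suc n) B + expTerm (suc n) B ≤ expSum n B + expTerm n B
decreases {B} n 0≤B N≤n = ≤-trans
  (≤-reflexive (solve 4 (λ E t B i → E :+ t :* (B :* i) :+ t :* (B :* i) := E :+ t :* ((B :+ B) :* i)) refl
    (expSum n B) (expTerm n B) B (1/suc n)))
  (+-monoʳ-≤ (expSum n B) (≤-trans
    (*-monoˡ-≤-nonNeg (expTerm n B) {{nonNegative (expTerm-nonNeg n 0≤B)}}
      (≤-trans
        (*-monoʳ-≤-nonNeg (1/suc n) {{nonNegative (0≤1/suc n)}}
          (≤-trans (≤archi (B + B)) (fromℕ-mono (ℕP.m≤n⇒m≤1+n N≤n))))
        (≤-reflexive (suc*1/suc n))))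
    (≤-reflexive (*-identityʳ _))))

decreases* : ∀ n d → 0ℚ ≤ B → start B ℕ.≤ n →
  expSum (d ℕ.+ n) B + expTerm (d ℕ.+ n) B ≤ expSum n B + expTerm n B
decreases* n zero    0≤B N≤n = ≤-refl
decreases* n (suc d) 0≤B N≤n = ≤-trans
  (decreases (d ℕ.+ n) 0≤B (ℕP.≤-trans N≤n (ℕP.m≤n+m n d))) (decreases* n d 0≤B N≤n)

expMax : ℚ → ℚ
expMax B = expSum (start B) B + expTerm (start B) B

expMax-bound : ∀ n → 0ℚ ≤ B → start B ℕ.≤ n → expSum n B + expTerm n B ≤ expMax B
expMax-bound {B} n 0≤B N≤n =
  subst (λ k → expSum k B + expTerm k B ≤ expMax B) (ℕP.m∸n+n≡m N≤n)
    (decreases* (start B) (n ℕ.∸ start B) 0≤B ℕP.≤-refl)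

expSum≤expMax : ∀ n → 0ℚ ≤ B → start B ℕ.≤ n → expSum n B ≤ expMax B
expSum≤expMax {B} n 0≤B N≤n = ≤-trans (≤-from (expSum n B) (expTerm n B) (expTerm-nonNeg n 0≤B) refl) (expMax-bound n 0≤B N≤n)

expTerm≤expMax : ∀ n → 0ℚ ≤ B → start B ℕ.≤ n → expTerm n B ≤ expMax B
expTerm≤expMax {B} n 0≤B N≤n =
  ≤-trans (≤-from (expTerm n B) (expSum n B) (expSum-nonNeg n 0≤B) (+-comm (expTerm n B) _)) (expMax-bound n 0≤B N≤n)

expMax-nonNeg : 0ℚ ≤ B → 0ℚ ≤ expMax B
expMax-nonNeg {B} 0≤B = ≤-trans (expSum-nonNeg (start B) 0≤B) (expSum≤expMax _ 0≤B ℕP.≤-refl)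

expTerm-small : 0ℚ ≤ B → 0ℚ < ε →
  ∃ λ N → start B ℕ.≤ N × (∀ n → N ℕ.≤ n → expTerm n B ≤ ε)
expTerm-small {B} {ε} 0≤B 0<ε = suc (start B ℕ.⊔ N) , ℕP.m≤n⇒m≤1+n (ℕP.m≤m⊔n (start B) N) , bnd
  where
  δ     = proj₁ (shrink (expMax B * B) 0<ε)
  0<δ   = proj₁ (proj₂ (shrink (expMax B * B) 0<ε))
  Cδ≤ε  = proj₂ (proj₂ (shrink (expMax B * B) 0<ε))
  N     = proj₁ (1/suc-small 0<δ)
  small = proj₂ (1/suc-small 0<δ)
  bnd : ∀ n → suc (start B ℕ.⊔ N) ℕ.≤ n → expTerm n B ≤ ε
  bnd (suc n) (s≤s ≤n) = ≤-trans
    (*-mono-≤ (expTerm-nonNeg n 0≤B) (nonNeg* 0≤B (<⇒≤ 0<δ))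
      (expTerm≤expMax n 0≤B (≤⊔ˡ (start B) N ≤n))
      (*-monoˡ-≤-nonNeg B {{nonNegative 0≤B}} (small n (≤⊔ʳ (start B) N ≤n))))
    (≤-trans (≤-reflexive (sym (*-assoc (expMax B) B δ))) Cδ≤ε)

expSum-tail : 0ℚ ≤ B → 0ℚ < ε → ∃ λ N → ∀ {a} m n → ∣ a ∣ ≤ B →
  N ℕ.≤ m → N ℕ.≤ n → ∣ expSum m a - expSum n a ∣ ≤ ε
expSum-tail {B} {ε} 0≤B 0<ε = N , both
  where
  N       = proj₁ (expTerm-small 0≤B 0<ε)
  start≤N = proj₁ (proj₂ (expTerm-small 0≤B 0<ε))
  small   = proj₂ (proj₂ (expTerm-small 0≤B 0<ε))
  ordered : ∀ {a} n d → ∣ a ∣ ≤ B → N ℕ.≤ n → ∣ expSum (d ℕ.+ n) a - expSum n a ∣ ≤ ε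
  ordered {a} n d p N≤n = ≤-trans (expSum-diff {a} n d p) (≤-trans
    (≤-trans
      (+-monoˡ-≤ (- expSum n B)
        (≤-trans (≤-from (expSum (d ℕ.+ n) B) (expTerm (d ℕ.+ n) B) (expTerm-nonNeg (d ℕ.+ n) 0≤B) refl)
          (decreases* n d 0≤B (ℕP.≤-trans start≤N N≤n))))
      (≤-reflexive (solve 2 (λ x y → x :+ y :- x := y) refl (expSum n B) (expTerm n B))))
    (small n N≤n))
  both : ∀ {a} m n → ∣ a ∣ ≤ B → N ℕ.≤ m → N ℕ.≤ n → ∣ expSum m a - expSum n a ∣ ≤ ε
  both {a} m n p N≤m N≤n = [ up , down ]′ (ℕP.≤-total n m)
    where
    up : n ℕ.≤ m → ∣ expSum m a - expSum n a ∣ ≤ ε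
    up n≤m = subst (λ k → ∣ expSum k a - expSum n a ∣ ≤ ε) (ℕP.m∸n+n≡m n≤m)
      (ordered n (m ℕ.∸ n) p N≤n)
    down : m ℕ.≤ n → ∣ expSum m a - expSum n a ∣ ≤ ε
    down m≤n = subst (_≤ ε) (∣∣-sym (expSum n a) (expSum m a))
      (subst (λ k → ∣ expSum k a - expSum m a ∣ ≤ ε) (ℕP.m∸n+n≡m m≤n)
        (ordered m (n ℕ.∸ m) p N≤m))

expSum-lip′ : ∀ n → suc (start B) ℕ.≤ n → ∣ a ∣ ≤ B → ∣ b ∣ ≤ B → ∣ a - b ∣ ≤ c →
  ∣ expSum n a - expSum n b ∣ ≤ c * expMax B
expSum-lip′ {B} {a} {b} (suc n) (s≤s N≤n) p q r = ≤-trans (expSum-lip {a} {b = b} n p q)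
  (*-mono-≤ (0≤∣p∣ _) (expMax-nonNeg 0≤B) r (expSum≤expMax n 0≤B N≤n))
  where 0≤B = ∣∣⇒0≤ {a} p

exp : ℝ → ℝ
exp (mkℝ s cs) = mkℝ (λ n → expSum n (s n))
  (let B , 0≤B , N₁ , ∣s∣≤B = bounded s cs in
  cauchy-scaled (λ n → expSum n (s n)) (1ℚ + expMax B) λ {δ} 0<δ →
    let N₂ , p = cs 0<δ
        N₃ , q = expSum-tail 0≤B 0<δ
        N₄ = suc (start B)
    in
    (N₁ ℕ.⊔ N₂) ℕ.⊔ (N₃ ℕ.⊔ N₄) , λ m n ≤m ≤n →
      let m₁ = ≤⊔ˡ N₁ N₂ (≤⊔ˡ (N₁ ℕ.⊔ N₂) (N₃ ℕ.⊔ N₄) ≤m); n₁ = ≤⊔ˡ N₁ N₂ (≤⊔ˡ (N₁ ℕ.⊔ N₂) (N₃ ℕ.⊔ N₄) ≤n)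
          m₂ = ≤⊔ʳ N₁ N₂ (≤⊔ˡ (N₁ ℕ.⊔ N₂) (N₃ ℕ.⊔ N₄) ≤m); n₂ = ≤⊔ʳ N₁ N₂ (≤⊔ˡ (N₁ ℕ.⊔ N₂) (N₃ ℕ.⊔ N₄) ≤n)
          m₃ = ≤⊔ˡ N₃ N₄ (≤⊔ʳ (N₁ ℕ.⊔ N₂) (N₃ ℕ.⊔ N₄) ≤m); n₃ = ≤⊔ˡ N₃ N₄ (≤⊔ʳ (N₁ ℕ.⊔ N₂) (N₃ ℕ.⊔ N₄) ≤n)
          n₄ = ≤⊔ʳ N₃ N₄ (≤⊔ʳ (N₁ ℕ.⊔ N₂) (N₃ ℕ.⊔ N₄) ≤n)
      in ≤-trans
        (triangle (expSum m (s m)) (expSum n (s m)) (expSum n (s n))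
          (q {s m} m n (∣s∣≤B m m₁) m₃ n₃)
          (expSum-lip′ {B} {s m} {s n} n n₄ (∣s∣≤B m m₁) (∣s∣≤B n n₁) (p m n m₂ n₂)))
        (≤-reflexive (solve 2 (λ d M → d :+ d :* M := (con 1ℚ :+ M) :* d) refl δ (expMax B))))

-- The least j < b with P j if there is one, and b otherwise.
least : ∀ {P : ℕ → Set} → Decidable P → ℕ → ℕ
least P? zero    = zero
least P? (suc b) = if does (P? zero) then zero else suc (least (λ j → P? (suc j)) b)

least-holds : ∀ {P : ℕ → Set} (P? : Decidable P) b → P b → P (least P? b)
least-holds P? zero    Pb = Pb
least-holds P? (suc b) Pb with P? zero
... | yes P0 = P0
... | no  _  = least-holds (λ j → P? (suc j)) b Pb

least-least : ∀ {P : ℕ → Set} (P? : Decidable P) b →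
  least P? b ≡ 0 ⊎ ∃ λ j → least P? b ≡ suc j × ¬ P j
least-least P? zero    = inj₁ refl
least-least P? (suc b) with P? zero
... | yes _  = inj₁ refl
... | no ¬P0 with least-least (λ j → P? (suc j)) b
...   | inj₁ eq           = inj₂ (0 , cong suc eq , ¬P0)
...   | inj₂ (j , eq , ¬P) = inj₂ (suc j , cong suc eq , ¬P)

grid : ℕ → ℕ → ℚ
grid n j = fromℕ j * (+ 1 / suc n)

-- The n-th approximation to log v is the least y ≥ 0 among the multiples
-- of 1/(n+1) with v ≤ expSum n y.
logIndex : ℕ → ℚ → ℕ
logIndex n v = least (λ j → v ≤? expSum n (grid n j)) (suc n ℕ.* archi v)

logApprox : ℕ → ℚ → ℚ
logApprox n v = grid n (logIndex n v)

fromℕ-+ : ∀ m n → fromℕ (m ℕ.+ n) ≡ fromℕ m + fromℕ n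
fromℕ-+ zero    n = sym (+-identityˡ _)
fromℕ-+ (suc m) n = trans (fromℕ-suc (m ℕ.+ n)) (trans (cong (λ z → 1ℚ + z) (fromℕ-+ m n))
  (trans (sym (+-assoc 1ℚ (fromℕ m) (fromℕ n))) (cong (_+ fromℕ n) (sym (fromℕ-suc m)))))

fromℕ-* : ∀ m n → fromℕ (m ℕ.* n) ≡ fromℕ m * fromℕ n
fromℕ-* zero    n = sym (*-zeroˡ (fromℕ n))
fromℕ-* (suc m) n = trans (fromℕ-+ n (m ℕ.* n)) (trans (cong (λ z → fromℕ n + z) (fromℕ-* m n))
  (trans (solve 2 (λ m n → n :+ m :* n := (con 1ℚ :+ m) :* n) refl (fromℕ m) (fromℕ n))
    (cong (_* fromℕ n) (sym (fromℕ-suc m)))))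

grid-nonNeg : ∀ n j → 0ℚ ≤ grid n j
grid-nonNeg n j = nonNeg* (0≤fromℕ j) (0≤1/suc n)

grid-zero : ∀ n → grid n 0 ≡ 0ℚ
grid-zero n = *-zeroˡ (1/suc n)

grid-suc : ∀ n j → grid n (suc j) ≡ grid n j + 1/suc n
grid-suc n j = trans (cong (_* 1/suc n) (fromℕ-suc j))
  (solve 2 (λ j i → (con 1ℚ :+ j) :* i := j :* i :+ i) refl (fromℕ j) (1/suc n))

grid-mult : ∀ n k → grid n (suc n ℕ.* k) ≡ fromℕ k
grid-mult n k = trans (cong (_* 1/suc n) (fromℕ-* (suc n) k))
  (trans (solve 3 (λ s k i → s :* k :* i := k :* (s :* i)) refl (fromℕ (suc n)) (fromℕ k) (1/suc n))
    (trans (cong (fromℕ k *_) (suc*1/suc n)) (*-identityʳ (fromℕ k))))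

1/suc≤1 : ∀ n → 1/suc n ≤ 1ℚ
1/suc≤1 n = ≤-trans
  (≤-trans (≤-reflexive (sym (*-identityˡ (1/suc n))))
    (*-monoʳ-≤-nonNeg (1/suc n) {{nonNegative (0≤1/suc n)}} (fromℕ-mono {1} {suc n} (s≤s z≤n))))
  (≤-reflexive (suc*1/suc n))

expTerm-mono : ∀ n → 0ℚ ≤ a → a ≤ b → expTerm n a ≤ expTerm n b
expTerm-mono zero    0≤a a≤b = ≤-refl
expTerm-mono {a} {b} (suc n) 0≤a a≤b =
  *-mono-≤ (expTerm-nonNeg n 0≤a) (nonNeg* (≤-trans 0≤a a≤b) (0≤1/suc n)) (expTerm-mono n 0≤a a≤b)
    (*-monoʳ-≤-nonNeg (1/suc n) {{nonNegative (0≤1/suc n)}} a≤b)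

-- expSum n grows at least with slope 1 on a ≥ 0.
expSum-expand : ∀ n → 1 ℕ.≤ n → 0ℚ ≤ a → a ≤ b → b + expSum n a ≤ a + expSum n b
expSum-expand {a} {b} (suc zero) _ 0≤a a≤b = ≤-reflexive
  (solve 2 (λ a b → b :+ (con 1ℚ :+ con 1ℚ :* (a :* con 1ℚ)) := a :+ (con 1ℚ :+ con 1ℚ :* (b :* con 1ℚ))) refl a b)
expSum-expand {a} {b} (suc (suc n)) _ 0≤a a≤b = ≤-trans
  (≤-reflexive (sym (+-assoc b (expSum (suc n) a) (expTerm (2 ℕ.+ n) a))))
  (≤-trans
    (+-mono-≤ (expSum-expand {a} {b} (suc n) (s≤s z≤n) 0≤a a≤b) (expTerm-mono (2 ℕ.+ n) 0≤a a≤b))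
    (≤-reflexive (+-assoc a (expSum (suc n) b) (expTerm (2 ℕ.+ n) b))))

expTerm-at-0 : ∀ n → expTerm (suc n) 0ℚ ≡ 0ℚ
expTerm-at-0 n = trans (cong (expTerm n 0ℚ *_) (*-zeroˡ (1/suc n))) (*-zeroʳ (expTerm n 0ℚ))

expSum-at-0 : ∀ n → expSum n 0ℚ ≡ 1ℚ
expSum-at-0 zero    = refl
expSum-at-0 (suc n) = trans (cong₂ _+_ (expSum-at-0 n) (expTerm-at-0 n)) (+-identityʳ 1ℚ)

1+≤expSum : ∀ n → 1 ℕ.≤ n → 0ℚ ≤ a → a + 1ℚ ≤ expSum n a
1+≤expSum {a} n 1≤n 0≤a =
  subst (λ z → a + z ≤ expSum n a) (expSum-at-0 n)
    (subst (a + expSum n 0ℚ ≤_) (+-identityˡ (expSum n a)) (expSum-expand {0ℚ} {a} n 1≤n ≤-refl 0≤a))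

logApprox-upper : ∀ n v → 1 ℕ.≤ n → v ≤ expSum n (logApprox n v)
logApprox-upper n v 1≤n = least-holds (λ j → v ≤? expSum n (grid n j)) (suc n ℕ.* archi v)
  (subst (λ z → v ≤ expSum n z) (sym (grid-mult n (archi v)))
    (≤-trans (≤archi v) (≤-trans
      (≤-from (fromℕ (archi v)) 1ℚ (0≤fromℕ 1) refl)
      (1+≤expSum {fromℕ (archi v)} n 1≤n (0≤fromℕ (archi v))))))

logApprox-lower : ∀ n v → logApprox n v ≡ 0ℚ ⊎
  ∃ λ y → logApprox n v ≡ y + 1/suc n × 0ℚ ≤ y × expSum n y ≤ v
logApprox-lower n v = [ onGrid0 , onGrid ]′ (least-least _ (suc n ℕ.* archi v))
  where
  Goal : Set
  Goal = logApprox n v ≡ 0ℚ ⊎ ∃ λ y → logApprox n v ≡ y + 1/suc n × 0ℚ ≤ y × expSum n y ≤ v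
  onGrid0 : logIndex n v ≡ 0 → Goal
  onGrid0 eq = inj₁ (trans (cong (grid n) eq) (grid-zero n))
  onGrid : (∃ λ j → logIndex n v ≡ suc j × ¬ (v ≤ expSum n (grid n j))) → Goal
  onGrid (j , eq , ≰) = inj₂
    (grid n j , trans (cong (grid n) eq) (grid-suc n j) , grid-nonNeg n j , <⇒≤ (≰⇒> ≰))

logApprox-nonNeg : ∀ n v → 0ℚ ≤ logApprox n v
logApprox-nonNeg n v = grid-nonNeg n (logIndex n v)

logApprox-bound : ∀ n v → 1 ℕ.≤ n → 0ℚ ≤ B → v ≤ B → logApprox n v ≤ B
logApprox-bound {B} n v 1≤n 0≤B v≤B = [ atZero , above ]′ (logApprox-lower n v)
  where
  atZero : logApprox n v ≡ 0ℚ → logApprox n v ≤ B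
  atZero eq = subst (_≤ B) (sym eq) 0≤B
  above : (∃ λ y → logApprox n v ≡ y + 1/suc n × 0ℚ ≤ y × expSum n y ≤ v) → logApprox n v ≤ B
  above (y , eq , 0≤y , ≤v) = subst (_≤ B) (sym eq)
    (≤-trans (+-monoʳ-≤ y (1/suc≤1 n))
      (≤-trans (1+≤expSum {y} n 1≤n 0≤y) (≤-trans ≤v v≤B)))

∣logApprox∣ : ∀ n v → 1 ℕ.≤ n → 0ℚ ≤ B → ∣ v ∣ ≤ B → ∣ logApprox n v ∣ ≤ B
∣logApprox∣ {B} n v 1≤n 0≤B v≤B = subst (_≤ B) (sym (0≤p⇒∣p∣≡p (logApprox-nonNeg n v)))
  (logApprox-bound n v 1≤n 0≤B (∣∣-elim {v} v≤B))

logApprox-close : ∀ {δ} m n v w → 1 ℕ.≤ m → 1 ℕ.≤ n → 0ℚ ≤ δ →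
  1/suc m ≤ δ → w - v ≤ δ →
  expSum n (logApprox n v) - expSum m (logApprox n v) ≤ δ →
  logApprox m w - logApprox n v ≤ (1ℚ + 1ℚ + 1ℚ) * δ
logApprox-close {δ} m n v w 1≤m 1≤n 0≤δ i≤δ w-v≤δ tail = [ atZero , above ]′ (logApprox-lower m w)
  where
  y = logApprox n v
  3δ = (1ℚ + 1ℚ + 1ℚ) * δ
  split : δ + (δ + δ) ≡ 3δ
  split = solve 1 (λ d → d :+ (d :+ d) := (con 1ℚ :+ con 1ℚ :+ con 1ℚ) :* d) refl δ
  δ≤3δ : δ ≤ 3δ
  δ≤3δ = ≤-from δ (δ + δ) (nonNeg+ 0≤δ 0≤δ) split
  0≤3δ : 0ℚ ≤ 3δ
  0≤3δ = ≤-trans 0≤δ δ≤3δ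
  atZero : logApprox m w ≡ 0ℚ → logApprox m w - y ≤ 3δ
  atZero eq = subst (λ z → z - y ≤ 3δ) (sym eq)
    (≤-trans (≤-from (0ℚ - y) y (logApprox-nonNeg n v)
      (solve 1 (λ y → con 0ℚ :- y :+ y := con 0ℚ) refl y)) 0≤3δ)
  above : (∃ λ z → logApprox m w ≡ z + 1/suc m × 0ℚ ≤ z × expSum m z ≤ w) → logApprox m w - y ≤ 3δ
  above (z , eq , 0≤z , ≤w) = subst (λ u → u - y ≤ 3δ) (sym eq)
    (≤-trans (≤-reflexive (solve 3 (λ z i y → z :+ i :- y := i :+ (z :- y)) refl z (1/suc m) y))
      (≤-trans (+-mono-≤ i≤δ ([ near , far ]′ (≤-total z y))) (≤-reflexive split)))
    where
    near : z ≤ y → z - y ≤ δ + δ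
    near z≤y = ≤-trans (+-monoˡ-≤ (- y) z≤y)
      (≤-trans (≤-reflexive (+-inverseʳ y)) (nonNeg+ 0≤δ 0≤δ))
    far : y ≤ z → z - y ≤ δ + δ
    far y≤z = ≤-trans
      (≤-reflexive (solve 3 (λ z y E → z :- y := z :+ E :- (y :+ E)) refl z y (expSum m y)))
      (≤-trans
        (+-monoˡ-≤ (- (y + expSum m y)) (expSum-expand {y} {z} m 1≤m (logApprox-nonNeg n v) y≤z))
        (≤-trans
          (≤-reflexive (solve 3 (λ y F E → y :+ F :- (y :+ E) := F :- E) refl y (expSum m z) (expSum m y)))
          (≤-trans
            (+-monoˡ-≤ (- expSum m y) ≤w)
            (≤-trans
              (≤-reflexive (solve 3 (λ w v E → w :- E := (w :- v) :+ (v :- E)) refl w v (expSum m y)))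
              (+-mono-≤ w-v≤δ
                (≤-trans (+-monoˡ-≤ (- expSum m y) (logApprox-upper n v 1≤n)) tail))))))

-- The natural logarithm on [1,∞), where it is the inverse of exp (exp-log);
-- on (-∞,1) it takes the value 0.
log : ℝ → ℝ
log (mkℝ s cs) = mkℝ (λ n → logApprox n (s n))
  (let B , 0≤B , N₁ , ∣s∣≤B = bounded s cs in
  cauchy-scaled (λ n → logApprox n (s n)) (1ℚ + 1ℚ + 1ℚ) λ {δ} 0<δ →
    let N₂ , p = cs 0<δ
        N₃ , q = expSum-tail 0≤B 0<δ
        N₄ , r = 1/suc-small 0<δ
        K₁ = suc N₁ ℕ.⊔ N₂
        K₂ = N₃ ℕ.⊔ N₄
        one-sided : ∀ m n → K₁ ℕ.⊔ K₂ ℕ.≤ m → K₁ ℕ.⊔ K₂ ℕ.≤ n →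
          logApprox m (s m) - logApprox n (s n) ≤ (1ℚ + 1ℚ + 1ℚ) * δ
        one-sided m n ≤m ≤n =
          let m₁ = ≤⊔ˡ (suc N₁) N₂ (≤⊔ˡ K₁ K₂ ≤m); n₁ = ≤⊔ˡ (suc N₁) N₂ (≤⊔ˡ K₁ K₂ ≤n)
              m₂ = ≤⊔ʳ (suc N₁) N₂ (≤⊔ˡ K₁ K₂ ≤m); n₂ = ≤⊔ʳ (suc N₁) N₂ (≤⊔ˡ K₁ K₂ ≤n)
              m₃ = ≤⊔ˡ N₃ N₄ (≤⊔ʳ K₁ K₂ ≤m); n₃ = ≤⊔ˡ N₃ N₄ (≤⊔ʳ K₁ K₂ ≤n)
              m₄ = ≤⊔ʳ N₃ N₄ (≤⊔ʳ K₁ K₂ ≤m)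
              1≤m = ℕP.≤-trans (s≤s z≤n) m₁
              1≤n = ℕP.≤-trans (s≤s z≤n) n₁
          in logApprox-close m n (s n) (s m) 1≤m 1≤n (<⇒≤ 0<δ) (r m m₄)
               (∣∣-elim {s m - s n} (p m n m₂ n₂))
               (∣∣-elim {expSum n (logApprox n (s n)) - expSum m (logApprox n (s n))}
                 (q {logApprox n (s n)} n m
                   (∣logApprox∣ n (s n) 1≤n 0≤B (∣s∣≤B n (ℕP.<⇒≤ n₁))) n₃ m₃))
    in K₁ ℕ.⊔ K₂ , λ m n ≤m ≤n →
      ∣∣-intro {logApprox m (s m) - logApprox n (s n)} (one-sided m n ≤m ≤n)
        (≤-trans
          (≤-reflexive (solve 2 (λ x y → :- (x :- y) := y :- x) refl
            (logApprox m (s m)) (logApprox n (s n))))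
          (one-sided n m ≤n ≤m)))

exp-log : ∀ x → 1ᴿ ≤ᴿ x → exp (log x) ≈ x
exp-log (mkℝ s cs) 1≤x {ε} 0<ε = K₁ ℕ.⊔ K₂ , λ n ≤n →
  let n₁ = ≤⊔ˡ N₁ N₂ (≤⊔ˡ K₁ K₂ ≤n)
      n₂ = ≤⊔ʳ N₁ N₂ (≤⊔ˡ K₁ K₂ ≤n)
      n₃ = ≤⊔ˡ N₃ N₄ (≤⊔ʳ K₁ K₂ ≤n)
      n₄ = ≤⊔ʳ N₃ N₄ (≤⊔ʳ K₁ K₂ ≤n)
      1≤n = ℕP.≤-trans (s≤s z≤n) n₃
  in ∣∣-intro {expSum n (logApprox n (s n)) - s n}
    (above n 1≤n (proj₂ 1≤x′ n n₁) (∣s∣≤S n n₂) n₃ (proj₂ small n n₄) (logApprox-lower n (s n)))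
    (≤-trans
      (≤-reflexive (solve 2 (λ x y → :- (x :- y) := y :- x) refl (expSum n (logApprox n (s n))) (s n)))
      (≤-trans (+-monoˡ-≤ (- expSum n (logApprox n (s n))) (logApprox-upper n (s n) 1≤n))
        (≤-trans (≤-reflexive (+-inverseʳ (expSum n (logApprox n (s n))))) (<⇒≤ 0<ε))))
  where
  1≤x′   = 1≤x 0<ε
  bnd    = bounded s cs
  S      = proj₁ bnd
  0≤S    = proj₁ (proj₂ bnd)
  ∣s∣≤S  = proj₂ (proj₂ (proj₂ bnd))
  shr    = shrink (expMax S) 0<ε
  small  = 1/suc-small (proj₁ (proj₂ shr))
  N₁ = proj₁ 1≤x′
  N₂ = proj₁ (proj₂ (proj₂ bnd))
  N₃ = suc (start S)
  N₄ = proj₁ small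
  K₁ = N₁ ℕ.⊔ N₂
  K₂ = N₃ ℕ.⊔ N₄
  above : ∀ n → 1 ℕ.≤ n → 1ℚ ≤ s n + ε → ∣ s n ∣ ≤ S → N₃ ℕ.≤ n → 1/suc n ≤ proj₁ shr →
    (logApprox n (s n) ≡ 0ℚ ⊎ ∃ λ y → logApprox n (s n) ≡ y + 1/suc n × 0ℚ ≤ y × expSum n y ≤ s n) →
    expSum n (logApprox n (s n)) - s n ≤ ε
  above n 1≤n 1≤sn+ε _ _ _ (inj₁ eq) = ≤-trans
    (+-monoˡ-≤ (- s n) (≤-trans (≤-reflexive (trans (cong (expSum n) eq) (expSum-at-0 n))) 1≤sn+ε))
    (≤-reflexive (solve 2 (λ x e → x :+ e :- x := e) refl (s n) ε))
  above n 1≤n _ sn≤S n₃ i≤ (inj₂ (y , eq , 0≤y , ≤sn)) = ≤-trans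
    (+-monoʳ-≤ (expSum n Y) (neg-antimono-≤ ≤sn))
    (∣∣-elim {expSum n Y - expSum n y} (≤-trans
      (expSum-lip′ {S} {Y} {y} n n₃ ∣Y∣≤S ∣y∣≤S (≤-reflexive ∣Y-y∣))
      (≤-trans (≤-reflexive (*-comm (1/suc n) (expMax S)))
        (≤-trans (*-monoˡ-≤-nonNeg (expMax S) {{nonNegative (expMax-nonNeg 0≤S)}} i≤) (proj₂ (proj₂ shr))))))
    where
    Y = logApprox n (s n)
    ∣Y∣≤S : ∣ Y ∣ ≤ S
    ∣Y∣≤S = ∣logApprox∣ n (s n) 1≤n 0≤S sn≤S
    ∣y∣≤S : ∣ y ∣ ≤ S
    ∣y∣≤S = subst (_≤ S) (sym (0≤p⇒∣p∣≡p 0≤y))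
      (≤-trans (≤-from y (1/suc n) (0≤1/suc n) (sym eq))
        (logApprox-bound n (s n) 1≤n 0≤S (∣∣-elim {s n} sn≤S)))
    ∣Y-y∣ : ∣ Y - y ∣ ≡ 1/suc n
    ∣Y-y∣ = trans
      (cong ∣_∣ (trans (cong (_- y) eq) (solve 2 (λ y i → y :+ i :- y := i) refl y (1/suc n))))
      (0≤p⇒∣p∣≡p (0≤1/suc n))

infix 4 _⟶0

_⟶0 : (ℕ → ℝ) → Set
δ ⟶0 = ∀ {ε} → 0ℚ < ε → ∃ λ K → ∀ k → K ℕ.≤ k → ∣ δ k ∣ᴿ ≤ᴿ fromℚ ε

-- The factor m of q_m(i) = (m / 2 h_{m-1}) / (i (m - i)) telescopes along a tree, so ℙ(DTCS(k) = T)
-- is k times the product of 1 / (2 h_{s-1}) over the internal vertices, s being the number of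
-- leaves below the vertex.  For the caterpillar s runs through 2, …, k, and replacing two
-- subtrees by caterpillars and then merging these only increases the factors h, strictly if both
-- subtrees have an internal vertex; this gives the minimisers.
--
-- Let Y be the inverse of the probability of Cat(k).  By induction on k,
-- (h_k / 6)^k ≤ Y ≤ (2 h_k)^k, the lower bound because (h_{k+1} / h_k)^k ≤ (1 + 1 / (k + 1))^k ≤ 3.
-- Since log k ≤ h_k ≤ 1 + log k, the difference x of (log Y) / k and log log k is bounded, and
-- δ_k = x / log log k is as required.
module Submission where

open import Data.Bool.Base using (true; false; if_then_else_)
open import Data.Fin.Base as Fin using (Fin; toℕ; fromℕ<)
open import Data.Fin.Properties using (toℕ-fromℕ<; toℕ-injective; toℕ<n)
open import Data.Integer.Base as ℤ using (+_)
import Data.Integer.Properties as ℤP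
open import Data.List.Base using ([]; _∷_; _++_; _∷ʳ_; map; tabulate; upTo)
open import Data.List.Properties using (map-++; map-tabulate; upTo-∷ʳ)
open import Data.Nat.Base as ℕ using (ℕ; zero; suc; s≤s; z≤n; NonZero)
open import Data.Nat.Induction using (Acc; acc; <-wellFounded)
import Data.Nat.Properties as ℕP
open import Data.Product.Base using (∃; ∃-syntax; _×_; _,_; proj₁; proj₂)
open import Data.Rational.Base hiding (NonZero)
open import Data.Rational.Properties
open import Data.Rational.Solver using (module +-*-Solver)
open import Data.Sum.Base using (_⊎_; inj₁; inj₂; [_,_]′)
open import Algebra.Definitions.RawSemiring +-*-rawSemiring using (_^_)
open import Function.Base using (_∘_; id)
open import Function.Bundles using (_⇔_; mk⇔)
open import Relation.Binary.Bundles using (Preorder)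
open import Relation.Binary.PropositionalEquality
  using (_≡_; _≢_; refl; sym; trans; cong; cong₂; subst; module ≡-Reasoning)
open import Relation.Nullary using (yes; no; does; contradiction)
import Data.Rational.Unnormalised.Base as ℚᵘ
import Data.Rational.Unnormalised.Properties as ℚᵘP
open import Defs
open Facts
open +-*-Solver using (solve; _:=_; _:+_; _:*_; _:-_; :-_; con)

-- No functional equation of `log` is established. Comparisons of logarithms are moved through
-- `exp`, where they become comparisons of powers of rationals, and are pulled back because the
-- partial sums of the exponential series have slope at least 1 on nonnegative arguments. The price
-- is the additivity of `exp`, proved with the Cauchy product of the series. Since `log` is 0 below
-- 1, the probability itself has no useful logarithm, which is why the argument runs with its
-- inverse Y. Crude bounds on Y suffice: a factor c^k moves (log Y) / k by log c only, while log log
-- k tends to infinity. Whether a real number is at least 1 cannot be decided, so the reciprocal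
-- that enters δ is clamped at 1, and the formula is claimed for k so large that log log k is at
-- least 1.

1/*-split : ∀ a b → + 1 / (suc a ℕ.* suc b) ≡ 1/suc a * 1/suc b
1/*-split a b = toℚᵘ-injective (ℚᵘP.≃-trans (toℚᵘ-fromℚᵘ (ℚᵘ.mkℚᵘ (+ 1) _))
  (ℚᵘP.≃-sym (ℚᵘP.≃-trans (toℚᵘ-homo-* (1/suc a) (1/suc b))
    (ℚᵘP.≃-trans (ℚᵘP.*-cong (toℚᵘ-fromℚᵘ (ℚᵘ.mkℚᵘ (+ 1) a)) (toℚᵘ-fromℚᵘ (ℚᵘ.mkℚᵘ (+ 1) b)))
      (ℚᵘ.*≡* refl)))))

/2-split : ∀ n → + n / 2 ≡ fromℕ n * ½
/2-split n = toℚᵘ-injective (ℚᵘP.≃-trans (toℚᵘ-fromℚᵘ (ℚᵘ.mkℚᵘ (+ n) 1))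
  (ℚᵘP.≃-sym (ℚᵘP.≃-trans (toℚᵘ-homo-* (fromℕ n) ½)
    (ℚᵘP.≃-trans (ℚᵘP.*-cong (toℚᵘ-fromℚᵘ (ℚᵘ.mkℚᵘ (+ n) 0)) (ℚᵘP.≃-refl {ℚᵘ.½}))
      (ℚᵘ.*≡* (cong (ℤ._* (+ 2)) (ℤP.*-identityʳ (+ n))))))))

*1/suc-cancel : ∀ n p → fromℕ (suc n) * (1/suc n * p) ≡ p
*1/suc-cancel n p = trans (sym (*-assoc (fromℕ (suc n)) (1/suc n) p))
  (trans (cong (_* p) (suc*1/suc n)) (*-identityˡ p))

h*1/h : ∀ n → h (suc n) * 1/h (suc n) ≡ 1ℚ
h*1/h n = *-inverseʳ (h (suc n)) {{pos⇒nonZero (h (suc n)) {{h-pos n}}}}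

0<1/h : ∀ n → 0ℚ < 1/h (suc n)
0<1/h n = positive⁻¹ (1/h (suc n)) {{1/pos⇒pos (h (suc n)) {{h-pos n}}}}

-- Expectations under finite distributions

module _ where
  private variable A B : Set

  -- Written as the expectation of an indicator, a probability becomes linear and passes through
  -- `_>>=_`, which the filter in `prob` does not do directly.
  E : Dist A → (A → ℚ) → ℚ
  E []            f = 0ℚ
  E ((a , p) ∷ d) f = p * f a + E d f

  E-cong : ∀ (d : Dist A) {f g : A → ℚ} → (∀ a → f a ≡ g a) → E d f ≡ E d g
  E-cong []            eq = refl
  E-cong ((a , p) ∷ d) eq = cong₂ _+_ (cong (p *_) (eq a)) (E-cong d eq)

  E-++ : ∀ (d e : Dist A) f → E (d ++ e) f ≡ E d f + E e f
  E-++ []            e f = sym (+-identityˡ _)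
  E-++ ((a , p) ∷ d) e f = trans (cong (λ z → p * f a + z) (E-++ d e f)) (sym (+-assoc (p * f a) (E d f) (E e f)))

  E-*ʳ : ∀ (d : Dist A) f c → E d (λ a → f a * c) ≡ E d f * c
  E-*ʳ []            f c = sym (*-zeroˡ c)
  E-*ʳ ((a , p) ∷ d) f c = trans (cong (λ z → p * (f a * c) + z) (E-*ʳ d f c))
    (solve 4 (λ p f c e → p :* (f :* c) :+ e :* c := (p :* f :+ e) :* c) refl p (f a) c (E d f))

  E-*ˡ : ∀ (d : Dist A) f c → E d (λ a → c * f a) ≡ c * E d f
  E-*ˡ d f c = trans (E-cong d λ a → *-comm c (f a)) (trans (E-*ʳ d f c) (*-comm (E d f) c))

  E-scale : ∀ p (d : Dist A) f → E (map (λ (a , p′) → a , p * p′) d) f ≡ p * E d f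
  E-scale p []             f = sym (*-zeroʳ p)
  E-scale p ((a , p′) ∷ d) f = trans (cong (λ z → p * p′ * f a + z) (E-scale p d f))
    (solve 4 (λ p p′ f e → p :* p′ :* f :+ p :* e := p :* (p′ :* f :+ e)) refl p p′ (f a) (E d f))

  E->>= : ∀ (d : Dist A) (k : A → Dist B) f → E (d >>= k) f ≡ E d (λ a → E (k a) f)
  E->>= []            k f = refl
  E->>= ((a , p) ∷ d) k f = trans (E-++ (map _ (k a)) (d >>= k) f)
    (cong₂ _+_ (E-scale p (k a) f) (E->>= d k f))

  E-pure : ∀ (a : A) f → E (pure a) f ≡ f a
  E-pure a f = trans (+-identityʳ _) (*-identityˡ (f a))

  E-zero : ∀ (d : Dist A) {f} → (∀ a → f a ≡ 0ℚ) → E d f ≡ 0ℚ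
  E-zero []            z = refl
  E-zero ((a , p) ∷ d) z = trans (cong₂ _+_ (trans (cong (p *_) (z a)) (*-zeroʳ p)) (E-zero d z)) (+-identityʳ 0ℚ)

  E-tabulate-zero : ∀ {n} (g : Fin n → A × ℚ) f → (∀ j → f (proj₁ (g j)) ≡ 0ℚ) → E (tabulate g) f ≡ 0ℚ
  E-tabulate-zero {n = zero}  g f z = refl
  E-tabulate-zero {n = suc n} g f z = trans
    (cong₂ _+_ (trans (cong (proj₂ (g Fin.zero) *_) (z Fin.zero)) (*-zeroʳ (proj₂ (g Fin.zero)))) (E-tabulate-zero (g ∘ Fin.suc) f (z ∘ Fin.suc)))
    (+-identityʳ 0ℚ)

  -- For the split at the root: the shape of a tree fixes the size of its left subtree, so a single
  -- outcome contributes.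
  E-tabulate-single : ∀ {n} (g : Fin n → A × ℚ) f i → (∀ j → j ≢ i → f (proj₁ (g j)) ≡ 0ℚ) →
    E (tabulate g) f ≡ proj₂ (g i) * f (proj₁ (g i))
  E-tabulate-single {n = suc n} g f Fin.zero z = trans
    (cong (λ z → proj₂ (g Fin.zero) * f (proj₁ (g Fin.zero)) + z)
      (E-tabulate-zero (g ∘ Fin.suc) f λ j → z (Fin.suc j) λ ()))
    (+-identityʳ _)
  E-tabulate-single {n = suc n} g f (Fin.suc i) z = trans
    (cong₂ _+_ (trans (cong (proj₂ (g Fin.zero) *_) (z Fin.zero λ ())) (*-zeroʳ (proj₂ (g Fin.zero))))
      (E-tabulate-single (g ∘ Fin.suc) f i λ j j≢i → z (Fin.suc j) λ { refl → j≢i refl }))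
    (+-identityˡ _)

𝟙 : Tree → Tree → ℚ
𝟙 T T′ = if does (T′ ≟ᵀ T) then 1ℚ else 0ℚ

prob≡E : ∀ d T → prob d T ≡ E d (𝟙 T)
prob≡E []             T = refl
prob≡E ((T′ , p) ∷ d) T with does (T′ ≟ᵀ T)
... | true  = cong₂ _+_ (sym (*-identityʳ p)) (prob≡E d T)
... | false = trans (prob≡E d T) (trans (sym (+-identityˡ _)) (cong (_+ E d (𝟙 T)) (sym (*-zeroʳ p))))

-- This factorisation turns the independence of the two subtrees into a product of probabilities in
-- `E-node`.
𝟙-node : ∀ l r L R → 𝟙 (node l r) (node L R) ≡ 𝟙 l L * 𝟙 r R
𝟙-node l r L R with L ≟ᵀ l | R ≟ᵀ r
... | yes refl | yes refl = refl
... | yes refl | no _     = refl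
... | no _     | yes _    = refl
... | no _     | no _     = refl

E-node : ∀ dL dR l r →
  E (dL >>= λ L → dR >>= λ R → pure (node L R)) (𝟙 (node l r)) ≡ prob dL l * prob dR r
E-node dL dR l r = begin
  E (dL >>= λ L → dR >>= λ R → pure (node L R)) f
    ≡⟨ E->>= dL (λ L → dR >>= λ R → pure (node L R)) f ⟩
  E dL (λ L → E (dR >>= λ R → pure (node L R)) f)
    ≡⟨ E-cong dL (λ L → trans (E->>= dR (λ R → pure (node L R)) f)
         (trans (E-cong dR λ R → trans (E-pure (node L R) f) (𝟙-node l r L R)) (E-*ˡ dR (𝟙 r) (𝟙 l L)))) ⟩
  E dL (λ L → 𝟙 l L * E dR (𝟙 r))
    ≡⟨ E-*ʳ dL (𝟙 l) (E dR (𝟙 r)) ⟩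
  E dL (𝟙 l) * E dR (𝟙 r)
    ≡⟨ cong₂ _*_ (sym (prob≡E dL l)) (sym (prob≡E dR r)) ⟩
  prob dL l * prob dR r ∎
  where
  open ≡-Reasoning
  f = 𝟙 (node l r)

-- Shape probabilities as products over internal vertices

internals : Tree → ℕ
internals leaf       = 0
internals (node l r) = suc (internals l ℕ.+ internals r)

size≡ : ∀ T → size T ≡ suc (internals T)
size≡ leaf       = refl
size≡ (node l r) = trans (cong₂ ℕ._+_ (size≡ l) (size≡ r)) (cong suc (ℕP.+-suc (internals l) (internals r)))

size⇒internals : ∀ T {n} → size T ≡ suc n → internals T ≡ n
size⇒internals T eq = ℕP.suc-injective (trans (sym (size≡ T)) eq)

splitFactor : ℕ → ℚ
splitFactor n = ½ * 1/h (suc n)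

-- The probability of the shape divided by the number of leaves. After this division the numerator
-- of `q` is gone, and the sizes in its denominator are absorbed by the two subtrees.
weight : Tree → ℚ
weight leaf       = 1ℚ
weight (node l r) = splitFactor (internals l ℕ.+ internals r) * (weight l * weight r)

module _ (r : ℕ) (rs : ∀ {m} → m ℕ.< suc (suc r) → Acc ℕ._<_ m) where

  leftDist rightDist branch : Fin (suc r) → Dist Tree
  leftDist  j = dtcs (leftSize r j)  (rs (s≤s (toℕ<n j)))
  rightDist j = dtcs (rightSize r j) (rs (s≤s (s≤s (ℕP.m∸n≤m r (toℕ j)))))
  branch    j = leftDist j >>= λ L → rightDist j >>= λ R → pure (node L R)

  E-dtcs : ∀ f → E (dtcs (suc (suc r)) (acc rs)) f ≡ E (tabulate (λ j → j , q r j)) (λ j → E (branch j) f)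
  E-dtcs f = trans (E->>= (splitDist r) branch f)
    (cong (λ d → E d (λ j → E (branch j) f)) (map-tabulate id (λ j → j , q r j)))

  E-branch-leaf : ∀ j → E (branch j) (𝟙 leaf) ≡ 0ℚ
  E-branch-leaf j =
    trans (E->>= (leftDist j) (λ L → rightDist j >>= λ R → pure (node L R)) (𝟙 leaf)) (E-zero (leftDist j) λ L →
      trans (E->>= (rightDist j) (λ R → pure (node L R)) (𝟙 leaf)) (E-zero (rightDist j) λ R →
        E-pure (node L R) (𝟙 leaf)))

  E-branch-node : ∀ j l t → E (branch j) (𝟙 (node l t)) ≡ prob (leftDist j) l * prob (rightDist j) t
  E-branch-node j l t = E-node (leftDist j) (rightDist j) l t

  prob-dtcs-leaf : prob (dtcs (suc (suc r)) (acc rs)) leaf ≡ 0ℚ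
  prob-dtcs-leaf = trans (prob≡E (dtcs (suc (suc r)) (acc rs)) leaf)
    (trans (E-dtcs (𝟙 leaf)) (E-tabulate-zero (λ j → j , q r j) (λ j → E (branch j) (𝟙 leaf)) E-branch-leaf))

  prob-dtcs-node : ∀ l t → prob (dtcs (suc (suc r)) (acc rs)) (node l t) ≡
    E (tabulate (λ j → j , q r j)) (λ j → prob (leftDist j) l * prob (rightDist j) t)
  prob-dtcs-node l t = trans (prob≡E (dtcs (suc (suc r)) (acc rs)) (node l t))
    (trans (E-dtcs (𝟙 (node l t))) (E-cong (tabulate (λ j → j , q r j)) λ j → E-branch-node j l t))

-- If the total is wrong, every split gives at least one subtree of the wrong size: two correct
-- sizes would add up to a correct total.
prob-dtcs-≢ : ∀ n ac T → internals T ≢ n → prob (dtcs (suc n) ac) T ≡ 0ℚ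
prob-dtcs-≢ zero    ac       leaf       ≢ = contradiction refl ≢
prob-dtcs-≢ zero    ac       (node _ _) ≢ = refl
prob-dtcs-≢ (suc r) (acc rs) leaf       ≢ = prob-dtcs-leaf r rs
prob-dtcs-≢ (suc r) (acc rs) (node l t) ≢ = trans (prob-dtcs-node r rs l t)
  (E-tabulate-zero (λ j → j , q r j) (λ j → prob (leftDist r rs j) l * prob (rightDist r rs j) t) zero-at)
  where
  zero-at : ∀ j → prob (leftDist r rs j) l * prob (rightDist r rs j) t ≡ 0ℚ
  zero-at j with internals l ℕP.≟ toℕ j | internals t ℕP.≟ r ℕ.∸ toℕ j
  ... | no l≢  | _     = trans (cong (_* prob (rightDist r rs j) t) (prob-dtcs-≢ (toℕ j) (rs (s≤s (toℕ<n j))) l l≢))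
    (*-zeroˡ (prob (rightDist r rs j) t))
  ... | yes _  | no t≢ = trans
    (cong (prob (leftDist r rs j) l *_) (prob-dtcs-≢ (r ℕ.∸ toℕ j) (rs (s≤s (s≤s (ℕP.m∸n≤m r (toℕ j))))) t t≢))
    (*-zeroʳ (prob (leftDist r rs j) l))
  ... | yes l≡ | yes t≡ = contradiction
    (cong suc (trans (cong₂ ℕ._+_ l≡ t≡) (ℕP.m+[n∸m]≡n (ℕ.s≤s⁻¹ (toℕ<n j))))) ≢

q-split : ∀ r j → q r j ≡
  fromℕ (2 ℕ.+ r) * ½ * 1/h (suc r) * (1/suc (toℕ j) * 1/suc (r ℕ.∸ toℕ j))
q-split r j = cong₂ (λ x y → x * 1/h (suc r) * y) (/2-split (2 ℕ.+ r)) (1/*-split (toℕ j) (r ℕ.∸ toℕ j))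

-- By `prob-dtcs-≢` one split survives, and the leaf counts from the two induction hypotheses cancel
-- its denominator. The accessibility proof is arbitrary because each recursive call of `dtcs`
-- carries its own.
prob-dtcs : ∀ n ac T → internals T ≡ n → prob (dtcs (suc n) ac) T ≡ fromℕ (suc n) * weight T
prob-dtcs zero    ac       leaf       eq = refl
prob-dtcs (suc r) (acc rs) (node l t) eq = begin
  prob (dtcs (suc (suc r)) (acc rs)) (node l t)
    ≡⟨ prob-dtcs-node r rs l t ⟩
  E (tabulate (λ j → j , q r j)) (λ j → prob (leftDist r rs j) l * prob (rightDist r rs j) t)
    ≡⟨ E-tabulate-single (λ j → j , q r j) (λ j → prob (leftDist r rs j) l * prob (rightDist r rs j) t) i
         (λ j j≢i → trans (cong (_* prob (rightDist r rs j) t)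
           (prob-dtcs-≢ (toℕ j) (rs (s≤s (toℕ<n j))) l λ l≡j → j≢i (toℕ-injective (trans (sym l≡j) (sym i≡)))))
           (*-zeroˡ (prob (rightDist r rs j) t))) ⟩
  q r i * (prob (leftDist r rs i) l * prob (rightDist r rs i) t)
    ≡⟨ cong₂ _*_ (q-split r i)
         (cong₂ _*_ (prob-dtcs (toℕ i) (rs (s≤s (toℕ<n i))) l (sym i≡))
                    (prob-dtcs (r ℕ.∸ toℕ i) (rs (s≤s (s≤s (ℕP.m∸n≤m r (toℕ i))))) t t≡)) ⟩
  fromℕ (2 ℕ.+ r) * ½ * 1/h (suc r) * (1/suc (toℕ i) * 1/suc (r ℕ.∸ toℕ i))
    * (fromℕ (suc (toℕ i)) * weight l * (fromℕ (suc (r ℕ.∸ toℕ i)) * weight t))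
    ≡⟨ cancel (fromℕ (2 ℕ.+ r)) (1/h (suc r)) (toℕ i) (r ℕ.∸ toℕ i) (weight l) (weight t) ⟩
  fromℕ (2 ℕ.+ r) * (½ * 1/h (suc r) * (weight l * weight t))
    ≡⟨ cong (λ z → fromℕ (2 ℕ.+ r) * (splitFactor z * (weight l * weight t))) (sym r≡) ⟩
  fromℕ (2 ℕ.+ r) * weight (node l t) ∎
  where
  open ≡-Reasoning
  r≡ : internals l ℕ.+ internals t ≡ r
  r≡ = ℕP.suc-injective eq
  l<sr : internals l ℕ.< suc r
  l<sr = s≤s (subst (internals l ℕ.≤_) r≡ (ℕP.m≤m+n (internals l) (internals t)))
  i = fromℕ< l<sr
  i≡ : toℕ i ≡ internals l
  i≡ = toℕ-fromℕ< l<sr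
  t≡ : internals t ≡ r ℕ.∸ toℕ i
  t≡ = trans (sym (ℕP.m+n∸m≡n (internals l) (internals t))) (cong₂ ℕ._∸_ r≡ (sym i≡))
  cancel : ∀ m u a b x y →
    m * ½ * u * (1/suc a * 1/suc b) * (fromℕ (suc a) * x * (fromℕ (suc b) * y)) ≡ m * (½ * u * (x * y))
  cancel m u a b x y = trans
    (solve 9 (λ m v u i j s t x y →
        m :* v :* u :* (i :* j) :* (s :* x :* (t :* y)) := s :* (i :* (t :* (j :* (m :* (v :* u :* (x :* y)))))))
      refl m ½ u (1/suc a) (1/suc b) (fromℕ (suc a)) (fromℕ (suc b)) x y)
    (trans (*1/suc-cancel a (fromℕ (suc b) * (1/suc b * (m * (½ * u * (x * y))))))
      (*1/suc-cancel b (m * (½ * u * (x * y)))))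

-- The probability of the caterpillar

catWeight : ℕ → ℚ
catWeight zero    = 1ℚ
catWeight (suc n) = catWeight n * splitFactor n

internals-Cat : ∀ n → internals (Cat (suc n)) ≡ n
internals-Cat zero    = refl
internals-Cat (suc n) = cong suc (internals-Cat n)

weight-Cat : ∀ n → weight (Cat (suc n)) ≡ catWeight n
weight-Cat zero    = refl
weight-Cat (suc n) = trans
  (cong₂ (λ m w → splitFactor m * (1ℚ * w)) (internals-Cat n) (weight-Cat n))
  (solve 2 (λ s w → s :* (con 1ℚ :* w) := w :* s) refl (splitFactor n) (catWeight n))

prob-Cat : ∀ n → prob (DTCS (suc n)) (Cat (suc n)) ≡ fromℕ (suc n) * catWeight n
prob-Cat n = trans (prob-dtcs n _ (Cat (suc n)) (internals-Cat n)) (cong (fromℕ (suc n) *_) (weight-Cat n))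

productℚ-∷ʳ : ∀ xs x → productℚ (xs ∷ʳ x) ≡ productℚ xs * x
productℚ-∷ʳ []       x = *-comm x 1ℚ
productℚ-∷ʳ (y ∷ xs) x = trans (cong (y *_) (productℚ-∷ʳ xs x)) (sym (*-assoc y (productℚ xs) x))

catWeight-product : ∀ n → catWeight n ≡ ½ ^ n * productℚ (map (λ j → 1/h (suc j)) (upTo n))
catWeight-product zero    = refl
catWeight-product (suc n) = begin
  catWeight n * (½ * 1/h (suc n))
    ≡⟨ cong (_* (½ * 1/h (suc n))) (catWeight-product n) ⟩
  ½ ^ n * Π n * (½ * 1/h (suc n))
    ≡⟨ solve 4 (λ a b c d → a :* b :* (c :* d) := c :* a :* (b :* d)) refl (½ ^ n) (Π n) ½ (1/h (suc n)) ⟩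
  ½ * ½ ^ n * (Π n * 1/h (suc n))
    ≡⟨ cong (½ * ½ ^ n *_) (sym (trans (cong (productℚ ∘ map f) (sym (upTo-∷ʳ n)))
         (trans (cong productℚ (map-++ f (upTo n) (n ∷ []))) (productℚ-∷ʳ (map f (upTo n)) (f n))))) ⟩
  ½ * ½ ^ n * Π (suc n) ∎
  where
  open ≡-Reasoning
  f = λ j → 1/h (suc j)
  Π = λ n → productℚ (map f (upTo n))

-- Comparison of an arbitrary tree with the caterpillar

0<splitFactor : ∀ n → 0ℚ < splitFactor n
0<splitFactor n = pos* {½} (positive⁻¹ ½) (0<1/h n)

0<catWeight : ∀ n → 0ℚ < catWeight n
0<catWeight zero    = positive⁻¹ 1ℚ
0<catWeight (suc n) = pos* (0<catWeight n) (0<splitFactor n)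

h-<-step : ∀ n → h n < h (suc n)
h-<-step n = subst (_< h (suc n)) (+-identityʳ (h n)) (+-monoʳ-< (h n) (0<1/suc n))

h-mono-< : ∀ {m n} → m ℕ.< n → h m < h n
h-mono-< {m} {suc n} (s≤s m≤n) with ℕP.m≤n⇒m<n∨m≡n m≤n
... | inj₁ m<n  = <-trans (h-mono-< m<n) (h-<-step n)
... | inj₂ refl = h-<-step m

h-mono-≤ : ∀ {m n} → m ℕ.≤ n → h m ≤ h n
h-mono-≤ m≤n with ℕP.m≤n⇒m<n∨m≡n m≤n
... | inj₁ m<n  = <⇒≤ (h-mono-< m<n)
... | inj₂ refl = ≤-refl

*-monoˡ-< : ∀ {p q r} → 0ℚ < r → p < q → r * p < r * q
*-monoˡ-< {r = r} 0<r = *-monoʳ-<-pos r {{positive 0<r}}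

*-monoʳ-< : ∀ {p q r} → 0ℚ < r → p < q → p * r < q * r
*-monoʳ-< {r = r} 0<r = *-monoˡ-<-pos r {{positive 0<r}}

1/h-mono-< : ∀ {m n} → m ℕ.< n → 1/h (suc n) < 1/h (suc m)
1/h-mono-< {m} {n} m<n = <-respˡ-≡ (trans (cong (_* 1/h (suc n)) (trans (*-comm (1/h (suc m)) (h (suc m))) (h*1/h m))) (*-identityˡ _)) (<-respʳ-≡
  (trans (*-assoc (1/h (suc m)) (h (suc n)) (1/h (suc n))) (trans (cong (1/h (suc m) *_) (h*1/h n)) (*-identityʳ _)))
  (*-monoʳ-< (0<1/h n) (*-monoˡ-< (0<1/h m) (h-mono-< (s≤s m<n)))))

splitFactor-mono-< : ∀ {m n} → m ℕ.< n → splitFactor n < splitFactor m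
splitFactor-mono-< m<n = *-monoˡ-< (positive⁻¹ ½) (1/h-mono-< m<n)

-- The factors of catWeight (a + b) beyond the first a are smaller than those of catWeight b.
catWeight-+-< : ∀ a b → 1 ℕ.≤ a → 1 ℕ.≤ b → catWeight (b ℕ.+ a) < catWeight b * catWeight a
catWeight-+-< a (suc zero) 1≤a _ = subst (catWeight (suc a) <_)
  (trans (*-comm (catWeight a) (splitFactor 0)) (cong (_* catWeight a) (sym (*-identityˡ (splitFactor 0)))))
  (*-monoˡ-< (0<catWeight a) (splitFactor-mono-< 1≤a))
catWeight-+-< a (suc (suc b)) 1≤a _ = <-trans
  (*-monoʳ-< (0<splitFactor (suc b ℕ.+ a)) (catWeight-+-< a (suc b) 1≤a (s≤s z≤n)))
  (subst (catWeight (suc b) * catWeight a * splitFactor (suc b ℕ.+ a) <_)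
    (solve 3 (λ x y z → x :* y :* z := x :* z :* y) refl (catWeight (suc b)) (catWeight a) (splitFactor (suc b)))
    (*-monoˡ-< (pos* (0<catWeight (suc b)) (0<catWeight a))
      (splitFactor-mono-< (ℕP.m<m+n (suc b) 1≤a))))

≅-refl : ∀ T → T ≅ T
≅-refl leaf       = leaf
≅-refl (node l r) = node (≅-refl l) (≅-refl r)

≅-internals : ∀ {S T} → S ≅ T → internals S ≡ internals T
≅-internals leaf       = refl
≅-internals (node p q) = cong suc (cong₂ ℕ._+_ (≅-internals p) (≅-internals q))
≅-internals {node l r} (swap p q) = cong suc (trans (ℕP.+-comm (internals l) (internals r)) (cong₂ ℕ._+_ (≅-internals q) (≅-internals p)))

≅-weight : ∀ {S T} → S ≅ T → weight S ≡ weight T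
≅-weight leaf = refl
≅-weight (node p q) = cong₂ (λ m w → splitFactor m * w)
  (cong₂ ℕ._+_ (≅-internals p) (≅-internals q)) (cong₂ _*_ (≅-weight p) (≅-weight q))
≅-weight {node l r} (swap p q) = cong₂ (λ m w → splitFactor m * w)
  (ℕP.suc-injective (≅-internals (swap p q)))
  (trans (*-comm (weight l) (weight r)) (cong₂ _*_ (≅-weight q) (≅-weight p)))

≅-Cat-weight : ∀ {T n} → T ≅ Cat (suc n) → weight T ≡ catWeight n
≅-Cat-weight {n = n} T≅ = trans (≅-weight T≅) (weight-Cat n)

-- Both directions of the characterisation come from this dichotomy. Its strictness excludes further
-- minimisers; weakened to an inequality, it shows that the orderings of the caterpillar are
-- minimal.
CatOrHeavier : Tree → Set
CatOrHeavier T = T ≅ Cat (suc (internals T)) ⊎ catWeight (internals T) < weight T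

CatOrHeavier⇒≤ : ∀ T → CatOrHeavier T → catWeight (internals T) ≤ weight T
CatOrHeavier⇒≤ T = [ (λ T≅ → ≤-reflexive (sym (≅-Cat-weight T≅))) , <⇒≤ ]′

heavier-leaf-node : ∀ r → catWeight (internals r) < weight r →
  catWeight (internals (node leaf r)) < weight (node leaf r)
heavier-leaf-node r w< = subst (catWeight (internals r) * splitFactor (internals r) <_)
  (solve 2 (λ w s → w :* s := s :* (con 1ℚ :* w)) refl (weight r) (splitFactor (internals r)))
  (*-monoʳ-< {catWeight (internals r)} {weight r} (0<splitFactor (internals r)) w<)

swap-weight : ∀ l r → weight (node l r) ≡ weight (node r l)
swap-weight l r = ≅-weight {node l r} {node r l} (swap (≅-refl l) (≅-refl r))

heavier-node-leaf : ∀ l → catWeight (internals l) < weight l →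
  catWeight (internals (node l leaf)) < weight (node l leaf)
heavier-node-leaf l w< = subst (catWeight (internals (node l leaf)) <_) (swap-weight leaf l)
  (subst (λ m → catWeight (suc m) < weight (node leaf l)) (sym (ℕP.+-identityʳ (internals l))) (heavier-leaf-node l w<))

heavier-node : ∀ l r → 1 ℕ.≤ internals l → 1 ℕ.≤ internals r →
  catWeight (internals l) ≤ weight l → catWeight (internals r) ≤ weight r →
  catWeight (internals (node l r)) < weight (node l r)
heavier-node l r 1≤l 1≤r l≤ r≤ = subst (catWeight (a ℕ.+ b) * splitFactor (a ℕ.+ b) <_)
  (*-comm (weight l * weight r) (splitFactor (a ℕ.+ b)))
  (*-monoʳ-< {catWeight (a ℕ.+ b)} {weight l * weight r} (0<splitFactor (a ℕ.+ b))
    (<-≤-trans (catWeight-+-< b a 1≤r 1≤l)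
      (*-mono-≤ {catWeight a} {weight r} {weight l} {catWeight b}
        (<⇒≤ (0<catWeight a)) (≤-trans (<⇒≤ (0<catWeight b)) r≤) l≤ r≤)))
  where
  a = internals l
  b = internals r

catOrHeavier : ∀ T → CatOrHeavier T
catOrHeavier leaf = inj₁ leaf
catOrHeavier (node leaf r) =
  [ (λ r≅ → inj₁ (node leaf r≅)) , (λ w< → inj₂ (heavier-leaf-node r w<)) ]′ (catOrHeavier r)
catOrHeavier (node l@(node _ _) leaf) =
  [ (λ l≅ → inj₁ (swap (subst (λ m → l ≅ Cat (suc m)) (sym (ℕP.+-identityʳ (internals l))) l≅) leaf))
  , (λ w< → inj₂ (heavier-node-leaf l w<)) ]′ (catOrHeavier l)
catOrHeavier (node l@(node _ _) r@(node _ _)) = inj₂ (heavier-node l r (s≤s z≤n) (s≤s z≤n)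
  (CatOrHeavier⇒≤ l (catOrHeavier l)) (CatOrHeavier⇒≤ r (catOrHeavier r)))

≅-Cat : ∀ {n} T → size T ≡ suc n → T ≅ Cat (suc n) ⊎ catWeight n < weight T
≅-Cat T eq = subst (λ m → T ≅ Cat (suc m) ⊎ catWeight m < weight T) (size⇒internals T eq) (catOrHeavier T)

≅-Cat-size : ∀ {n T} → T ≅ Cat (suc n) → size T ≡ suc n
≅-Cat-size {n} {T} T≅ = trans (size≡ T) (cong suc (trans (≅-internals T≅) (internals-Cat n)))

prob-DTCS : ∀ n T → size T ≡ suc n → prob (DTCS (suc n)) T ≡ fromℕ (suc n) * weight T
prob-DTCS n T eq = prob-dtcs n (<-wellFounded (suc n)) T (size⇒internals T eq)

0<fromℕ-suc : ∀ n → 0ℚ < fromℕ (suc n)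
0<fromℕ-suc n = <-≤-trans (positive⁻¹ 1ℚ) (fromℕ-mono {1} {suc n} (s≤s z≤n))

minimiser⇒≅ : ∀ n T → IsMinimiser (suc n) T → T ≅ Cat (suc n)
minimiser⇒≅ n T (eq , min) = [ id , heavier ]′ (≅-Cat T eq)
  where
  heavier : catWeight n < weight T → T ≅ Cat (suc n)
  heavier w< = contradiction
    (<-≤-trans (*-monoˡ-< {catWeight n} {weight T} (0<fromℕ-suc n) w<)
      (subst (_≤ fromℕ (suc n) * catWeight n) (prob-DTCS n T eq)
        (subst (prob (DTCS (suc n)) T ≤_) (prob-Cat n)
          (min (Cat (suc n)) (≅-Cat-size (≅-refl (Cat (suc n))))))))
    (<-irrefl refl)

≅⇒minimiser : ∀ n T → T ≅ Cat (suc n) → IsMinimiser (suc n) T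
≅⇒minimiser n T T≅ = size-T , λ T′ eq →
  subst (_≤ prob (DTCS (suc n)) T′) (sym (prob-DTCS n T size-T))
    (subst (fromℕ (suc n) * weight T ≤_) (sym (prob-DTCS n T′ eq))
      (*-monoˡ-≤-nonNeg (fromℕ (suc n)) {{nonNegative (<⇒≤ (0<fromℕ-suc n))}}
        (subst (_≤ weight T′) (sym (≅-Cat-weight T≅)) (bound T′ eq))))
  where
  size-T : size T ≡ suc n
  size-T = ≅-Cat-size T≅
  bound : ∀ T′ → size T′ ≡ suc n → catWeight n ≤ weight T′
  bound T′ eq = [ (λ T′≅ → ≤-reflexive (sym (≅-Cat-weight T′≅))) , <⇒≤ ]′ (≅-Cat T′ eq)

-- Rational bounds on the inverse probability

-- Unlike _^_ this reduces in one step, which keeps the unfolding of fromℚ (p ^ℚ n) manageable.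
infixr 8 _^ℚ_
_^ℚ_ : ℚ → ℕ → ℚ
p ^ℚ zero  = 1ℚ
p ^ℚ suc n = p * p ^ℚ n

^-nonNeg : ∀ {p} n → 0ℚ ≤ p → 0ℚ ≤ p ^ℚ n
^-nonNeg zero    0≤p = 0≤fromℕ 1
^-nonNeg (suc n) 0≤p = nonNeg* 0≤p (^-nonNeg n 0≤p)

^-mono-≤ : ∀ {p q} n → 0ℚ ≤ p → p ≤ q → p ^ℚ n ≤ q ^ℚ n
^-mono-≤ zero    0≤p p≤q = ≤-refl
^-mono-≤ (suc n) 0≤p p≤q = *-mono-≤ 0≤p (^-nonNeg n (≤-trans 0≤p p≤q)) p≤q (^-mono-≤ n 0≤p p≤q)

^-distrib-* : ∀ p q n → (p * q) ^ℚ n ≡ p ^ℚ n * q ^ℚ n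
^-distrib-* p q zero    = refl
^-distrib-* p q (suc n) = trans (cong (p * q *_) (^-distrib-* p q n))
  (solve 4 (λ p q x y → p :* q :* (x :* y) := p :* x :* (q :* y)) refl p q (p ^ℚ n) (q ^ℚ n))

*ˡ-≤ : ∀ {p q} r → 0ℚ ≤ r → p ≤ q → r * p ≤ r * q
*ˡ-≤ r 0≤r = *-monoˡ-≤-nonNeg r {{nonNegative 0≤r}}

*ʳ-≤ : ∀ {p q} r → 0ℚ ≤ r → p ≤ q → p * r ≤ q * r
*ʳ-≤ r 0≤r = *-monoʳ-≤-nonNeg r {{nonNegative 0≤r}}

-- The quadratic right-hand side is stable under induction: with N for the smaller exponent, the
-- slack in the step is x * x * (N * (1 - N * x) + 1), nonnegative as N * x is at most 1.
[1+x]^n-bound : ∀ n x → 0ℚ ≤ x → fromℕ n * x ≤ 1ℚ →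
  (1ℚ + x) ^ℚ n ≤ 1ℚ + fromℕ n * x + fromℕ n * x * (fromℕ n * x)
[1+x]^n-bound zero    x 0≤x nx≤1 = ≤-reflexive
  (sym (trans (cong (λ z → 1ℚ + z + z * z) (*-zeroˡ x)) refl))
[1+x]^n-bound (suc n) x 0≤x nx≤1 rewrite fromℕ-suc n = ≤-trans
  (*ˡ-≤ (1ℚ + x) (nonNeg+ (0≤fromℕ 1) 0≤x) ([1+x]^n-bound n x 0≤x Nx≤1))
  (≤-from ((1ℚ + x) * (1ℚ + N * x + N * x * (N * x))) (x * x * (N * (1ℚ - N * x) + 1ℚ))
    (nonNeg* (nonNeg* 0≤x 0≤x) (nonNeg+ (nonNeg* (0≤fromℕ n) (0≤- Nx≤1)) (0≤fromℕ 1)))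
    (solve 2 (λ x N →
        (con 1ℚ :+ x) :* (con 1ℚ :+ N :* x :+ N :* x :* (N :* x)) :+ x :* x :* (N :* (con 1ℚ :- N :* x) :+ con 1ℚ)
        := con 1ℚ :+ (con 1ℚ :+ N) :* x :+ (con 1ℚ :+ N) :* x :* ((con 1ℚ :+ N) :* x))
      refl x N))
  where
  N = fromℕ n
  Nx≤1 : N * x ≤ 1ℚ
  Nx≤1 = ≤-trans (≤-from (N * x) x 0≤x (solve 2 (λ x N → N :* x :+ x := (con 1ℚ :+ N) :* x) refl x N)) nx≤1

2ℚ : ℚ
2ℚ = 1ℚ + 1ℚ

6ℚ : ℚ
6ℚ = fromℕ 6

1≤h : ∀ n → 1ℚ ≤ h (suc n)
1≤h n = h-mono-≤ {1} {suc n} (s≤s z≤n)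

0≤h : ∀ n → 0ℚ ≤ h n
0≤h n = nonNegative⁻¹ (h n) {{h-nonNeg n}}

-- The quotient k / (k + 1) at k = n + 1, by which the leading factor k of the probability enters
-- the recursion for the inverse. It lies between 1/2 and 1.
ratio : ℕ → ℚ
ratio n = fromℕ (suc n) * 1/suc (suc n)

1/suc+ratio : ∀ n → 1/suc (suc n) + ratio n ≡ 1ℚ
1/suc+ratio n = trans
  (solve 2 (λ i s → i :+ s :* i := (con 1ℚ :+ s) :* i) refl (1/suc (suc n)) (fromℕ (suc n)))
  (trans (cong (_* 1/suc (suc n)) (sym (fromℕ-suc (suc n)))) (suc*1/suc (suc n)))

ratio≤1 : ∀ n → ratio n ≤ 1ℚ
ratio≤1 n = ≤-from (ratio n) (1/suc (suc n)) (0≤1/suc (suc n)) (trans (+-comm (ratio n) (1/suc (suc n))) (1/suc+ratio n))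

1≤2*ratio : ∀ n → 1ℚ ≤ 2ℚ * ratio n
1≤2*ratio n = subst (_≤ 2ℚ * ratio n) (1/suc+ratio n)
  (≤-trans
    (+-monoˡ-≤ (ratio n) (≤-trans (≤-reflexive (sym (*-identityˡ (1/suc (suc n)))))
      (*ʳ-≤ (1/suc (suc n)) (0≤1/suc (suc n)) (fromℕ-mono {1} {suc n} (s≤s z≤n)))))
    (≤-reflexive (solve 1 (λ r → r :+ r := (con 1ℚ :+ con 1ℚ) :* r) refl (ratio n))))

0≤ratio : ∀ n → 0ℚ ≤ ratio n
0≤ratio n = nonNeg* (0≤fromℕ (suc n)) (0≤1/suc (suc n))

-- The overview's Y at k = n + 1. The recursion replaces a division; `prob*invProb` certifies that
-- this is the inverse.
invProb : ℕ → ℚ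
invProb zero    = 1ℚ
invProb (suc n) = invProb n * (2ℚ * ratio n * h (suc n))

prob*invProb : ∀ n → fromℕ (suc n) * catWeight n * invProb n ≡ 1ℚ
prob*invProb zero    = refl
prob*invProb (suc n) = begin
  fromℕ (2 ℕ.+ n) * (catWeight n * (½ * 1/h (suc n))) * (invProb n * (2ℚ * (fromℕ (suc n) * 1/suc (suc n)) * h (suc n)))
    ≡⟨ solve 9 (λ s t w y i u v z H → s :* (w :* (v :* u)) :* (y :* (z :* (t :* i) :* H))
          := (v :* z) :* (H :* u) :* (t :* w :* y) :* (s :* i)) refl
        (fromℕ (2 ℕ.+ n)) (fromℕ (suc n)) (catWeight n) (invProb n) (1/suc (suc n)) (1/h (suc n)) ½ 2ℚ (h (suc n)) ⟩
  1ℚ * (h (suc n) * 1/h (suc n)) * (fromℕ (suc n) * catWeight n * invProb n) * (fromℕ (2 ℕ.+ n) * 1/suc (suc n))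
    ≡⟨ cong₂ _*_ (cong₂ (λ x y → 1ℚ * x * y) (h*1/h n) (prob*invProb n)) (suc*1/suc (suc n)) ⟩
  1ℚ * 1ℚ * 1ℚ * 1ℚ
    ≡⟨⟩
  1ℚ ∎
  where open ≡-Reasoning

1≤p⇒0≤p : ∀ {p} → 1ℚ ≤ p → 0ℚ ≤ p
1≤p⇒0≤p = ≤-trans (0≤fromℕ 1)

1≤* : ∀ {p q} → 1ℚ ≤ p → 1ℚ ≤ q → 1ℚ ≤ p * q
1≤* {p} {q} 1≤p 1≤q = *-mono-≤ {1ℚ} {q} {p} {1ℚ} (0≤fromℕ 1) (1≤p⇒0≤p 1≤q) 1≤p 1≤q

-- This places Y in the range where `log` inverts `exp`.
1≤invProb : ∀ n → 1ℚ ≤ invProb n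
1≤invProb zero    = ≤-refl
1≤invProb (suc n) = 1≤* {invProb n} (1≤invProb n) (1≤* {2ℚ * ratio n} (1≤2*ratio n) (1≤h n))

0≤invProb : ∀ n → 0ℚ ≤ invProb n
0≤invProb n = 1≤p⇒0≤p (1≤invProb n)

-- The base b is kept fixed so that the induction compares factor by factor; a base moving with n
-- would change all earlier factors as well.
invProb≤^ : ∀ n b → 1ℚ ≤ b → 2ℚ * h n ≤ b → invProb n ≤ b ^ℚ n
invProb≤^ zero    b 1≤b _    = ≤-refl
invProb≤^ (suc n) b 1≤b 2h≤b = ≤-trans
  (*-mono-≤ {invProb n} {b} {b ^ℚ n} {2ℚ * ratio n * h (suc n)} (0≤invProb n) (1≤p⇒0≤p 1≤b)
    (invProb≤^ n b 1≤b (≤-trans (*ˡ-≤ 2ℚ (0≤fromℕ 2) (<⇒≤ (h-<-step n))) 2h≤b))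
    (≤-trans (*ʳ-≤ (h (suc n)) (0≤h (suc n)) (≤-trans (*ˡ-≤ 2ℚ (0≤fromℕ 2) (ratio≤1 n)) (≤-reflexive (*-identityʳ 2ℚ)))) 2h≤b))
  (≤-reflexive (*-comm (b ^ℚ n) b))

invProb-upper : ∀ n → invProb n ≤ (2ℚ * h (suc n)) ^ℚ suc n
invProb-upper n = ≤-trans (invProb≤^ n b 1≤b (*ˡ-≤ 2ℚ (0≤fromℕ 2) (<⇒≤ (h-<-step n))))
  -- One more factor b, at least 1, raises the exponent from n to k = n + 1.
  (≤-trans (≤-reflexive (sym (*-identityˡ (b ^ℚ n)))) (*ʳ-≤ (b ^ℚ n) (^-nonNeg n (1≤p⇒0≤p 1≤b)) 1≤b))
  where
  b = 2ℚ * h (suc n)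
  1≤b : 1ℚ ≤ b
  1≤b = 1≤* {2ℚ} (fromℕ-mono {1} {2} (s≤s z≤n)) (1≤h n)

-- As `h (suc n)` is at least 1, adding x = 1 / (n + 2) to it multiplies it by at most 1 + x. The
-- power of 1 + x is at most 1 + 1 + 1 because (n + 1) * x is at most 1.
h-suc-^ : ∀ n → h (2 ℕ.+ n) ^ℚ suc n ≤ h (suc n) ^ℚ suc n * fromℕ 3
h-suc-^ n = ≤-trans (^-mono-≤ (suc n) (0≤h (2 ℕ.+ n)) h≤)
  (≤-trans (≤-reflexive (^-distrib-* (h (suc n)) (1ℚ + x) (suc n)))
    (*ˡ-≤ (h (suc n) ^ℚ suc n) (^-nonNeg (suc n) (0≤h (suc n)))
      (≤-trans ([1+x]^n-bound (suc n) x (0≤1/suc (suc n)) (ratio≤1 n))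
        (+-mono-≤ (+-monoʳ-≤ 1ℚ (ratio≤1 n))
          (*-mono-≤ {ratio n} {1ℚ} {1ℚ} {ratio n} (0≤ratio n) (0≤fromℕ 1) (ratio≤1 n) (ratio≤1 n))))))
  where
  x = 1/suc (suc n)
  h≤ : h (suc n) + x ≤ h (suc n) * (1ℚ + x)
  h≤ = ≤-trans (+-monoʳ-≤ (h (suc n)) (≤-trans (≤-reflexive (sym (*-identityˡ x))) (*ʳ-≤ x (0≤1/suc (suc n)) (1≤h n))))
    (≤-reflexive (solve 2 (λ H x → H :+ H :* x := H :* (con 1ℚ :+ x)) refl (h (suc n)) x))

h-suc≤2h : ∀ n → h (2 ℕ.+ n) ≤ 2ℚ * h (suc n)
h-suc≤2h n = ≤-trans (+-monoʳ-≤ (h (suc n)) (≤-trans (1/suc≤1 (suc n)) (1≤h n)))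
  (≤-reflexive (solve 1 (λ H → H :+ H := (con 1ℚ :+ con 1ℚ) :* H) refl (h (suc n))))

-- The ratio of consecutive left-hand sides is at most 3 h (2 + n) because (1 + 1 / (n + 2)) ^ (n + 1) ≤ 3.
h^≤invProb : ∀ n → h (suc n) ^ℚ suc n ≤ 6ℚ ^ℚ suc n * invProb n
h^≤invProb zero    = fromℕ-mono {1} {6} (s≤s z≤n)
h^≤invProb (suc n) = begin
  H′ * H′ ^ℚ suc n
    ≤⟨ *-mono-≤ {H′} {H ^ℚ suc n * fromℕ 3} {2ℚ * H} {H′ ^ℚ suc n} (0≤h (2 ℕ.+ n))
         (nonNeg* (^-nonNeg (suc n) (0≤h (suc n))) (0≤fromℕ 3)) (h-suc≤2h n) (h-suc-^ n) ⟩
  2ℚ * H * (H ^ℚ suc n * fromℕ 3)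
    ≡⟨ solve 4 (λ a H x b → a :* H :* (x :* b) := a :* b :* (H :* x)) refl 2ℚ H (H ^ℚ suc n) (fromℕ 3) ⟩
  6ℚ * (H * H ^ℚ suc n)
    ≤⟨ *ˡ-≤ 6ℚ (0≤fromℕ 6) (*ˡ-≤ H (0≤h (suc n)) (h^≤invProb n)) ⟩
  6ℚ * (H * (6ℚ ^ℚ suc n * invProb n))
    ≡⟨ solve 4 (λ a H x y → a :* (H :* (x :* y)) := a :* x :* (y :* (con 1ℚ :* H))) refl 6ℚ H (6ℚ ^ℚ suc n) (invProb n) ⟩
  6ℚ ^ℚ (2 ℕ.+ n) * (invProb n * (1ℚ * H))
    ≤⟨ *ˡ-≤ (6ℚ ^ℚ (2 ℕ.+ n)) (^-nonNeg (2 ℕ.+ n) (0≤fromℕ 6))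
         (*ˡ-≤ (invProb n) (0≤invProb n) (*ʳ-≤ H (0≤h (suc n)) (1≤2*ratio n))) ⟩
  6ℚ ^ℚ (2 ℕ.+ n) * invProb (suc n) ∎
  where
  open ≤-Reasoning
  H  = h (suc n)
  H′ = h (2 ℕ.+ n)

-- Cauchy products and the additivity of the exponential series

-- The Cauchy product, the sum of f i * g (n - i); shifting `f` in the recursion avoids subtraction
-- of indices.
conv : (ℕ → ℚ) → (ℕ → ℚ) → ℕ → ℚ
conv f g zero    = f 0 * g 0
conv f g (suc n) = f 0 * g (suc n) + conv (f ∘ suc) g n

sumTo : (ℕ → ℚ) → ℕ → ℚ
sumTo f zero    = f 0
sumTo f (suc n) = f 0 + sumTo (f ∘ suc) n

sumTo-suc : ∀ f n → sumTo f (suc n) ≡ sumTo f n + f (suc n)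
sumTo-suc f zero    = refl
sumTo-suc f (suc n) = trans (cong (λ z → f 0 + z) (sumTo-suc (f ∘ suc) n))
  (sym (+-assoc (f 0) (sumTo (f ∘ suc) n) (f (2 ℕ.+ n))))

conv-cong : ∀ {f f′ g g′} n → (∀ i → f i ≡ f′ i) → (∀ i → g i ≡ g′ i) → conv f g n ≡ conv f′ g′ n
conv-cong zero    f≡ g≡ = cong₂ _*_ (f≡ 0) (g≡ 0)
conv-cong (suc n) f≡ g≡ = cong₂ _+_ (cong₂ _*_ (f≡ 0) (g≡ (suc n))) (conv-cong n (f≡ ∘ suc) g≡)

conv-+ˡ : ∀ f f′ g n → conv (λ i → f i + f′ i) g n ≡ conv f g n + conv f′ g n
conv-+ˡ f f′ g zero    = *-distribʳ-+ (g 0) (f 0) (f′ 0)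
conv-+ˡ f f′ g (suc n) = trans (cong (λ z → (f 0 + f′ 0) * g (suc n) + z) (conv-+ˡ (f ∘ suc) (f′ ∘ suc) g n))
  (solve 5 (λ x y z u v → (x :+ y) :* z :+ (u :+ v) := (x :* z :+ u) :+ (y :* z :+ v)) refl
    (f 0) (f′ 0) (g (suc n)) (conv (f ∘ suc) g n) (conv (f′ ∘ suc) g n))

conv-*ˡ : ∀ c f g n → conv (λ i → c * f i) g n ≡ c * conv f g n
conv-*ˡ c f g zero    = *-assoc c (f 0) (g 0)
conv-*ˡ c f g (suc n) = trans (cong (λ z → c * f 0 * g (suc n) + z) (conv-*ˡ c (f ∘ suc) g n))
  (solve 4 (λ c x y z → c :* x :* y :+ c :* z := c :* (x :* y :+ z)) refl c (f 0) (g (suc n)) (conv (f ∘ suc) g n))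

conv-*ʳ : ∀ c f g n → conv f (λ i → c * g i) n ≡ c * conv f g n
conv-*ʳ c f g zero    = solve 3 (λ c x y → x :* (c :* y) := c :* (x :* y)) refl c (f 0) (g 0)
conv-*ʳ c f g (suc n) = trans (cong (λ z → f 0 * (c * g (suc n)) + z) (conv-*ʳ c (f ∘ suc) g n))
  (solve 4 (λ c x y z → x :* (c :* y) :+ c :* z := c :* (x :* y :+ z)) refl c (f 0) (g (suc n)) (conv (f ∘ suc) g n))

-- Sequences are the coefficients of power series in what follows.
deriv : (ℕ → ℚ) → ℕ → ℚ
deriv f n = fromℕ (suc n) * f (suc n)

-- The Leibniz rule.
deriv-conv : ∀ f g n → deriv (conv f g) n ≡ conv (deriv f) g n + conv f (deriv g) n
deriv-conv f g zero = solve 4 (λ a b c d → con 1ℚ :* (a :* d :+ b :* c) := con 1ℚ :* b :* c :+ a :* (con 1ℚ :* d)) refl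
  (f 0) (f 1) (g 0) (g 1)
deriv-conv f g (suc n) = begin
  k * (f 0 * g (2 ℕ.+ n) + conv f′ g (suc n))
    ≡⟨ cong (λ z → z * (f 0 * g (2 ℕ.+ n) + conv f′ g (suc n))) (fromℕ-suc (suc n)) ⟩
  (1ℚ + k′) * (f 0 * g (2 ℕ.+ n) + conv f′ g (suc n))
    ≡⟨ solve 4 (λ k f g c → (con 1ℚ :+ k) :* (f :* g :+ c) := f :* ((con 1ℚ :+ k) :* g) :+ (c :+ k :* c)) refl
         k′ (f 0) (g (2 ℕ.+ n)) (conv f′ g (suc n)) ⟩
  f 0 * ((1ℚ + k′) * g (2 ℕ.+ n)) + (conv f′ g (suc n) + deriv (conv f′ g) n)
    ≡⟨ cong₂ (λ x y → f 0 * (x * g (2 ℕ.+ n)) + (conv f′ g (suc n) + y)) (sym (fromℕ-suc (suc n))) (deriv-conv f′ g n) ⟩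
  f 0 * deriv g (suc n) + (f 1 * g (suc n) + conv (f′ ∘ suc) g n + (conv (deriv f′) g n + conv f′ (deriv g) n))
    ≡⟨ solve 5 (λ a b c d e → a :+ (b :+ c :+ (d :+ e)) := b :+ (c :+ d) :+ (a :+ e)) refl
         (f 0 * deriv g (suc n)) (f 1 * g (suc n)) (conv (f′ ∘ suc) g n) (conv (deriv f′) g n) (conv f′ (deriv g) n) ⟩
  f 1 * g (suc n) + (conv (f′ ∘ suc) g n + conv (deriv f′) g n) + conv f (deriv g) (suc n)
    ≡⟨ cong (_+ conv f (deriv g) (suc n)) (cong₂ _+_ (cong (_* g (suc n)) (sym (*-identityˡ (f 1))))
         (trans (sym (conv-+ˡ (f′ ∘ suc) (deriv f′) g n)) (conv-cong n shift (λ _ → refl)))) ⟩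
  conv (deriv f) g (suc n) + conv f (deriv g) (suc n) ∎
  where
  open ≡-Reasoning
  f′ = f ∘ suc
  k  = fromℕ (2 ℕ.+ n)
  k′ = fromℕ (suc n)
  -- Differentiating after the shift of `f` loses one copy of each coefficient; the summand 1 split
  -- off from the factor n + 2 supplies it.
  shift : ∀ i → f (2 ℕ.+ i) + deriv f′ i ≡ deriv f (suc i)
  shift i = trans (solve 2 (λ x k → x :+ k :* x := (con 1ℚ :+ k) :* x) refl (f (2 ℕ.+ i)) (fromℕ (suc i)))
    (cong (_* f (2 ℕ.+ i)) (sym (fromℕ-suc (suc i))))

term : ℚ → ℕ → ℚ
term a n = expTerm n a

deriv-term : ∀ a n → deriv (term a) n ≡ a * term a n
deriv-term a n = trans
  (solve 4 (λ s t a i → s :* (t :* (a :* i)) := s :* i :* (a :* t)) refl (fromℕ (suc n)) (term a n) a (1/suc n))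
  (trans (cong (_* (a * term a n)) (suc*1/suc n)) (*-identityˡ (a * term a n)))

-- The binomial theorem without binomial coefficients: by the Leibniz rule the product series c
-- satisfies c' = (a + b) c and starts with 1, which determines its coefficients.
expTerm-+ : ∀ a b n → conv (term a) (term b) n ≡ expTerm n (a + b)
expTerm-+ a b zero    = refl
expTerm-+ a b (suc n) = begin
  c (suc n)
    ≡⟨ sym (*1/suc-cancel n (c (suc n))) ⟩
  fromℕ (suc n) * (1/suc n * c (suc n))
    ≡⟨ solve 3 (λ s i c → s :* (i :* c) := s :* c :* i) refl (fromℕ (suc n)) (1/suc n) (c (suc n)) ⟩
  deriv c n * 1/suc n
    ≡⟨ cong (_* 1/suc n) (trans (deriv-conv (term a) (term b) n)
         (cong₂ _+_ (trans (conv-cong n (deriv-term a) (λ _ → refl)) (conv-*ˡ a (term a) (term b) n))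
                    (trans (conv-cong n (λ _ → refl) (deriv-term b)) (conv-*ʳ b (term a) (term b) n)))) ⟩
  (a * c n + b * c n) * 1/suc n
    ≡⟨ solve 4 (λ a b c i → (a :* c :+ b :* c) :* i := c :* ((a :+ b) :* i)) refl a b (c n) (1/suc n) ⟩
  c n * ((a + b) * 1/suc n)
    ≡⟨ cong (_* ((a + b) * 1/suc n)) (expTerm-+ a b n) ⟩
  expTerm (suc n) (a + b) ∎
  where
  open ≡-Reasoning
  c = conv (term a) (term b)

partial : ℚ → ℕ → ℚ
partial a n = expSum n a

partial≡sumTo : ∀ a n → expSum n a ≡ sumTo (term a) n
partial≡sumTo a zero    = refl
partial≡sumTo a (suc n) = trans (cong (_+ expTerm (suc n) a) (partial≡sumTo a n)) (sym (sumTo-suc (term a) n))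

conv-partial-suc : ∀ f b n → conv f (partial b) (suc n) ≡ conv f (partial b) n + conv f (term b) (suc n)
conv-partial-suc f b zero = solve 3 (λ x y t → x :* (con 1ℚ :+ t) :+ y :* con 1ℚ := x :* con 1ℚ :+ (x :* t :+ y :* con 1ℚ)) refl
  (f 0) (f 1) (term b 1)
conv-partial-suc f b (suc n) = trans
  (cong (λ z → f 0 * (expSum (suc n) b + expTerm (2 ℕ.+ n) b) + z) (conv-partial-suc (f ∘ suc) b n))
  (solve 5 (λ x e t u v → x :* (e :+ t) :+ (u :+ v) := x :* e :+ u :+ (x :* t :+ v)) refl
    (f 0) (expSum (suc n) b) (expTerm (2 ℕ.+ n) b) (conv (f ∘ suc) (partial b) n) (conv (f ∘ suc) (term b) (suc n)))

-- The left-hand side sums the products of terms with indices i, j over the triangle i + j ≤ n,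
-- whereas the product of two partial sums runs over the square i, j ≤ n.
conv-partial : ∀ a b n → conv (term a) (partial b) n ≡ expSum n (a + b)
conv-partial a b zero    = refl
conv-partial a b (suc n) = trans (conv-partial-suc (term a) b n) (cong₂ _+_ (conv-partial a b n) (expTerm-+ a b (suc n)))

-- The difference is the sum of f i * (c - U (n - i)), dominated term by term. In the application it
-- is the part of the square outside the triangle.
conv-remainder : ∀ {f F U V c C} n → (∀ i → ∣ f i ∣ ≤ F i) → (∀ i → i ℕ.≤ n → ∣ c - U i ∣ ≤ C - V i) →
  ∣ sumTo f n * c - conv f U n ∣ ≤ sumTo F n * C - conv F V n
conv-remainder {f} {F} {U} {V} {c} {C} zero f≤F c≤C =
  ∣∣-resp (solve 3 (λ f c u → f :* (c :- u) := f :* c :- f :* u) refl (f 0) c (U 0))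
    (≤-trans (∣∣-* (f 0) (c - U 0) (f≤F 0) (c≤C 0 z≤n))
      (≤-reflexive (solve 3 (λ f c u → f :* (c :- u) := f :* c :- f :* u) refl (F 0) C (V 0))))
conv-remainder {f} {F} {U} {V} {c} {C} (suc n) f≤F c≤C =
  ∣∣-resp (shuffle (f 0) c (U (suc n)) (sumTo (f ∘ suc) n) (conv (f ∘ suc) U n))
    (≤-trans
      (∣∣-+ (f 0 * (c - U (suc n))) (sumTo (f ∘ suc) n * c - conv (f ∘ suc) U n)
        (∣∣-* (f 0) (c - U (suc n)) (f≤F 0) (c≤C (suc n) ℕP.≤-refl))
        (conv-remainder {f ∘ suc} {F ∘ suc} {U} {V} n (f≤F ∘ suc) (λ i i≤n → c≤C i (ℕP.m≤n⇒m≤1+n i≤n))))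
      (≤-reflexive (shuffle (F 0) C (V (suc n)) (sumTo (F ∘ suc) n) (conv (F ∘ suc) V n))))
  where
  shuffle : ∀ f c u s k → f * (c - u) + (s * c - k) ≡ (f + s) * c - (f * u + k)
  shuffle = solve 5 (λ f c u s k → f :* (c :- u) :+ (s :* c :- k) := (f :+ s) :* c :- (f :* u :+ k)) refl

-- For partial sums V of nonnegative terms: the rectangle i ≤ n, j ≤ m lies inside the triangle i +
-- j ≤ n + m.
conv-lower : ∀ {F V} n m → (∀ i → 0ℚ ≤ F i) → (∀ i → 0ℚ ≤ V i) → (∀ i → V m ≤ V (i ℕ.+ m)) →
  sumTo F n * V m ≤ conv F V (n ℕ.+ m)
conv-lower {F} {V} zero    zero    0≤F 0≤V mono = ≤-refl
conv-lower {F} {V} zero    (suc m) 0≤F 0≤V mono =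
  ≤-from (F 0 * V (suc m)) (conv (F ∘ suc) V m) (conv-nonNeg m (0≤F ∘ suc)) refl
  where
  conv-nonNeg : ∀ {F} n → (∀ i → 0ℚ ≤ F i) → 0ℚ ≤ conv F V n
  conv-nonNeg zero    0≤F = nonNeg* (0≤F 0) (0≤V 0)
  conv-nonNeg (suc n) 0≤F = nonNeg+ (nonNeg* (0≤F 0) (0≤V (suc n))) (conv-nonNeg n (0≤F ∘ suc))
conv-lower {F} {V} (suc n) m 0≤F 0≤V mono = ≤-trans
  (≤-reflexive (*-distribʳ-+ (V m) (F 0) (sumTo (F ∘ suc) n)))
  (+-mono-≤ (*-monoˡ-≤-nonNeg (F 0) {{nonNegative (0≤F 0)}} (mono (suc n)))
    (conv-lower {F ∘ suc} {V} n m (0≤F ∘ suc) 0≤V mono))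

expSum-monoⁿ : ∀ {a} d n → 0ℚ ≤ a → expSum n a ≤ expSum (d ℕ.+ n) a
expSum-monoⁿ zero    n 0≤a = ≤-refl
expSum-monoⁿ {a} (suc d) n 0≤a = ≤-trans (expSum-monoⁿ {a} d n 0≤a)
  (≤-from (expSum (d ℕ.+ n) a) (expTerm (suc (d ℕ.+ n)) a) (expTerm-nonNeg (suc (d ℕ.+ n)) 0≤a) refl)

-- The square minus the triangle for a, b is dominated by that for B, B. The latter square lies in
-- the triangle of side 2n, leaving a segment of the series at B + B.
expSum-*-expSum : ∀ {a b B} n → ∣ a ∣ ≤ B → ∣ b ∣ ≤ B →
  ∣ expSum n a * expSum n b - expSum n (a + b) ∣ ≤ expSum (n ℕ.+ n) (B + B) - expSum n (B + B)
expSum-*-expSum {a} {b} {B} n a≤B b≤B =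
  ∣∣-resp (cong₂ (λ x y → x * expSum n b - y) (sym (partial≡sumTo a n)) (conv-partial a b n))
    (≤-trans
      (conv-remainder {term a} {term B} {partial b} {partial B} n (λ i → expTerm-abs {a} i a≤B) diff)
      (+-mono-≤
        (≤-trans (conv-lower {term B} {partial B} n n (λ i → expTerm-nonNeg i 0≤B) (λ i → expSum-nonNeg i 0≤B)
                   (λ i → expSum-monoⁿ {B} i n 0≤B))
          (≤-reflexive (conv-partial B B (n ℕ.+ n))))
        (≤-reflexive (cong -_ (conv-partial B B n)))))
  where
  0≤B : 0ℚ ≤ B
  0≤B = ∣∣⇒0≤ {a} a≤B
  diff : ∀ i → i ℕ.≤ n → ∣ expSum n b - expSum i b ∣ ≤ expSum n B - expSum i B
  diff i i≤n = subst (λ m → ∣ expSum m b - expSum i b ∣ ≤ expSum m B - expSum i B) (ℕP.m∸n+n≡m i≤n)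
    (expSum-diff {b} i (n ℕ.∸ i) b≤B)

-- Uniform in a and b, since the entries of `exp x` evaluate the partial sums at arguments that vary
-- with the index.
expSum-+ : ∀ {B ε} → 0ℚ ≤ B → 0ℚ < ε → ∃ λ N → ∀ {a b} n → N ℕ.≤ n → ∣ a ∣ ≤ B → ∣ b ∣ ≤ B →
  ∣ expSum n a * expSum n b - expSum n (a + b) ∣ ≤ ε
expSum-+ {B} {ε} 0≤B 0<ε = let N , tail = expSum-tail {B + B} (nonNeg+ 0≤B 0≤B) 0<ε in
  N , λ {a} {b} n N≤n a≤B b≤B → ≤-trans (expSum-*-expSum {a} {b} n a≤B b≤B)
    (∣∣-elim {expSum (n ℕ.+ n) (B + B) - expSum n (B + B)}
      (tail {B + B} (n ℕ.+ n) n (≤-reflexive (0≤p⇒∣p∣≡p (nonNeg+ 0≤B 0≤B))) (ℕP.≤-trans N≤n (ℕP.m≤m+n n n)) N≤n))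

-- Order and arithmetic of the reals

Eventually : (ℕ → Set) → Set
Eventually P = ∃ λ N → ∀ n → N ℕ.≤ n → P n

always : ∀ {P : ℕ → Set} → (∀ n → P n) → Eventually P
always p = 0 , λ n _ → p n

eventually₁ : ∀ {P Q : ℕ → Set} → (∀ n → P n → Q n) → Eventually P → Eventually Q
eventually₁ f (N , p) = N , λ n N≤n → f n (p n N≤n)

eventually₂ : ∀ {P Q R : ℕ → Set} → (∀ n → P n → Q n → R n) → Eventually P → Eventually Q → Eventually R
eventually₂ f (N , p) (M , q) = N ℕ.⊔ M , λ n ≤n → f n (p n (≤⊔ˡ N M ≤n)) (q n (≤⊔ʳ N M ≤n))

from-index : ∀ N → Eventually (N ℕ.≤_)
from-index N = N , λ _ N≤n → N≤n

infix 4 _≋_ _≲_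

-- _≈_ and _≤ᴿ_ as records, so that x and y can be inferred from a proof.
record _≋_ (x y : ℝ) : Set where
  constructor mk≋
  field close : ∀ {ε} → 0ℚ < ε → Eventually λ n → ∣ seq x n - seq y n ∣ ≤ ε

record _≲_ (x y : ℝ) : Set where
  constructor mk≲
  field below : ∀ {ε} → 0ℚ < ε → Eventually λ n → seq x n ≤ seq y n + ε

open _≋_
open _≲_

bound : ∀ x → ∃ λ B → 0ℚ ≤ B × Eventually λ n → ∣ seq x n ∣ ≤ B
bound x = bounded (seq x) (cauchy x)

≋-scaled : ∀ {x y} C → (∀ {δ} → 0ℚ < δ → Eventually λ n → ∣ seq x n - seq y n ∣ ≤ C * δ) → x ≋ y
≋-scaled C H = mk≋ λ 0<ε → let δ , 0<δ , Cδ≤ε = shrink C 0<ε in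
  eventually₁ (λ n b → ≤-trans b Cδ≤ε) (H 0<δ)

≲-scaled : ∀ {x y} C → (∀ {δ} → 0ℚ < δ → Eventually λ n → seq x n ≤ seq y n + C * δ) → x ≲ y
≲-scaled {x} {y} C H = mk≲ λ 0<ε → let δ , 0<δ , Cδ≤ε = shrink C 0<ε in
  eventually₁ (λ n b → ≤-trans b (+-monoʳ-≤ (seq y n) Cδ≤ε)) (H 0<δ)

2*δ : ∀ δ → δ + δ ≡ 2ℚ * δ
2*δ = solve 1 (λ δ → δ :+ δ := (con 1ℚ :+ con 1ℚ) :* δ) refl

≋-pointwise : ∀ {x y} → (∀ n → seq x n ≡ seq y n) → x ≋ y
≋-pointwise {x} {y} x≡y = mk≋ λ {ε} 0<ε → always λ n →
  subst (_≤ ε) (sym (trans (cong (λ z → ∣ z - seq y n ∣) (x≡y n)) (cong ∣_∣ (+-inverseʳ (seq y n))))) (<⇒≤ 0<ε)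

≲-eventually : ∀ {x y} → Eventually (λ n → seq x n ≤ seq y n) → x ≲ y
≲-eventually {x} {y} x≤y = mk≲ λ {ε} 0<ε →
  eventually₁ (λ n b → ≤-trans b (≤-from (seq y n) ε (<⇒≤ 0<ε) refl)) x≤y

≲-pointwise : ∀ {x y} → (∀ n → seq x n ≤ seq y n) → x ≲ y
≲-pointwise x≤y = ≲-eventually (always x≤y)

fromℚ-mono : ∀ {p q} → p ≤ q → fromℚ p ≲ fromℚ q
fromℚ-mono p≤q = ≲-pointwise λ _ → p≤q

≋-refl : ∀ {x} → x ≋ x
≋-refl = ≋-pointwise λ _ → refl

≋-sym : ∀ {x y} → x ≋ y → y ≋ x
≋-sym {x} {y} x≋y = mk≋ λ 0<ε →
  eventually₁ (λ n → subst (_≤ _) (∣∣-sym (seq x n) (seq y n))) (close x≋y 0<ε)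

≋-trans : ∀ {x y z} → x ≋ y → y ≋ z → x ≋ z
≋-trans {x} {y} {z} x≋y y≋z = ≋-scaled 2ℚ λ {δ} 0<δ →
  eventually₂ (λ n a b → ≤-trans (triangle (seq x n) (seq y n) (seq z n) a b) (≤-reflexive (2*δ δ)))
    (close x≋y 0<δ) (close y≋z 0<δ)

≋⇒≲ : ∀ {x y} → x ≋ y → x ≲ y
≋⇒≲ {x} {y} x≋y = mk≲ λ {ε} 0<ε → eventually₁
  (λ n b → ≤-trans (≤-reflexive (solve 2 (λ x y → x := y :+ (x :- y)) refl (seq x n) (seq y n)))
    (+-monoʳ-≤ (seq y n) (∣∣-elim {seq x n - seq y n} b)))
  (close x≋y 0<ε)

≲-trans : ∀ {x y z} → x ≲ y → y ≲ z → x ≲ z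
≲-trans {x} {y} {z} x≲y y≲z = ≲-scaled 2ℚ λ {δ} 0<δ → eventually₂
  (λ n a b → ≤-trans a (≤-trans (+-monoˡ-≤ δ b)
    (≤-reflexive (trans (+-assoc (seq z n) δ δ) (cong (λ w → seq z n + w) (2*δ δ))))))
  (below x≲y 0<δ) (below y≲z 0<δ)

≲-preorder : Preorder _ _ _
≲-preorder = record
  { Carrier = ℝ ; _≈_ = _≋_ ; _≲_ = _≲_
  ; isPreorder = record
    { isEquivalence = record { refl = ≋-refl ; sym = ≋-sym ; trans = ≋-trans }
    ; reflexive = ≋⇒≲
    ; trans = ≲-trans } }

module ≲-Reasoning where
  open import Relation.Binary.Reasoning.Preorder ≲-preorder public

+ᴿ-cong : ∀ {x y u v} → x ≋ y → u ≋ v → (x +ᴿ u) ≋ (y +ᴿ v)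
+ᴿ-cong {x} {y} {u} {v} x≋y u≋v = ≋-scaled 2ℚ λ {δ} 0<δ → eventually₂
  (λ n a b → ∣∣-resp
    (solve 4 (λ x y u v → (x :- y) :+ (u :- v) := (x :+ u) :- (y :+ v)) refl (seq x n) (seq y n) (seq u n) (seq v n))
    (≤-trans (∣∣-+ (seq x n - seq y n) (seq u n - seq v n) a b) (≤-reflexive (2*δ δ))))
  (close x≋y 0<δ) (close u≋v 0<δ)

+ᴿ-mono : ∀ {x y u v} → x ≲ y → u ≲ v → (x +ᴿ u) ≲ (y +ᴿ v)
+ᴿ-mono {x} {y} {u} {v} x≲y u≲v = ≲-scaled 2ℚ λ {δ} 0<δ → eventually₂
  (λ n a b → ≤-trans (+-mono-≤ a b) (≤-reflexive
    (solve 3 (λ y v δ → y :+ δ :+ (v :+ δ) := y :+ v :+ (con 1ℚ :+ con 1ℚ) :* δ) refl (seq y n) (seq v n) δ)))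
  (below x≲y 0<δ) (below u≲v 0<δ)

-ᴿ-cong : ∀ {x y} → x ≋ y → (-ᴿ x) ≋ (-ᴿ y)
-ᴿ-cong {x} {y} x≋y = mk≋ λ 0<ε → eventually₁
  (λ n → subst (_≤ _) (trans (∣∣-sym (seq x n) (seq y n))
    (cong ∣_∣ (solve 2 (λ x y → y :- x := (:- x) :- (:- y)) refl (seq x n) (seq y n)))))
  (close x≋y 0<ε)

*ᴿ-cong : ∀ {x y u v} → x ≋ y → u ≋ v → (x *ᴿ u) ≋ (y *ᴿ v)
*ᴿ-cong {x} {y} {u} {v} x≋y u≋v =
  let X , _ , ∣x∣≤X = bound x; V , _ , ∣v∣≤V = bound v in
  ≋-scaled (X + V) λ {δ} 0<δ → eventually₂
    (λ n (a , b) (c , d) → ∣∣-resp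
      (solve 4 (λ x y u v → x :* (u :- v) :+ (x :- y) :* v := x :* u :- y :* v) refl (seq x n) (seq y n) (seq u n) (seq v n))
      (≤-trans
        (∣∣-+ (seq x n * (seq u n - seq v n)) ((seq x n - seq y n) * seq v n)
          (∣∣-* (seq x n) (seq u n - seq v n) a d) (∣∣-* (seq x n - seq y n) (seq v n) c b))
        (≤-reflexive (solve 3 (λ X V δ → X :* δ :+ δ :* V := (X :+ V) :* δ) refl X V δ))))
    (eventually₂ (λ _ → _,_) ∣x∣≤X ∣v∣≤V)
    (eventually₂ (λ _ → _,_) (close x≋y 0<δ) (close u≋v 0<δ))

-- Entries of nonnegative reals may fall to -δ, so a product of entries can be negative; in
-- `approx`, (A + B) * δ compensates for either sign of a.
*ᴿ-nonNeg : ∀ {x y} → 0ᴿ ≲ x → 0ᴿ ≲ y → 0ᴿ ≲ (x *ᴿ y)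
*ᴿ-nonNeg {x} {y} 0≲x 0≲y =
  let X , 0≤X , ∣x∣≤X = bound x; Y , 0≤Y , ∣y∣≤Y = bound y in
  ≲-scaled (X + Y) λ {δ} 0<δ → eventually₂
    (λ n (a , b) (c , d) → approx {seq x n} {seq y n} (<⇒≤ 0<δ) 0≤X 0≤Y (∣∣-elim {seq x n} a) (∣∣-elim {seq y n} b) c d)
    (eventually₂ (λ _ → _,_) ∣x∣≤X ∣y∣≤Y)
    (eventually₂ (λ _ → _,_) (below 0≲x 0<δ) (below 0≲y 0<δ))
  where
  approx : ∀ {a b δ A B} → 0ℚ ≤ δ → 0ℚ ≤ A → 0ℚ ≤ B → a ≤ A → b ≤ B → 0ℚ ≤ a + δ → 0ℚ ≤ b + δ → 0ℚ ≤ a * b + (A + B) * δ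
  approx {a} {b} {δ} {A} {B} 0≤δ 0≤A 0≤B a≤A b≤B 0≤a+δ 0≤b+δ = [ whenNonNeg , whenNonPos ]′ (≤-total 0ℚ a)
    where
    whenNonNeg : 0ℚ ≤ a → 0ℚ ≤ a * b + (A + B) * δ
    whenNonNeg 0≤a = subst (0ℚ ≤_)
      (solve 5 (λ a b δ A B → a :* (b :+ δ) :+ ((A :- a) :+ B) :* δ := a :* b :+ (A :+ B) :* δ) refl a b δ A B)
      (nonNeg+ (nonNeg* 0≤a 0≤b+δ) (nonNeg* (nonNeg+ (0≤- a≤A) 0≤B) 0≤δ))
    whenNonPos : a ≤ 0ℚ → 0ℚ ≤ a * b + (A + B) * δ
    whenNonPos a≤0 = subst (0ℚ ≤_)
      (solve 5 (λ a b δ A B → (con 0ℚ :- a) :* (B :- b) :+ (a :+ δ) :* B :+ A :* δ := a :* b :+ (A :+ B) :* δ) refl a b δ A B)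
      (nonNeg+ (nonNeg+ (nonNeg* (0≤- a≤0) (0≤- b≤B)) (nonNeg* 0≤a+δ 0≤B)) (nonNeg* 0≤A 0≤δ))

≲⇒0≲- : ∀ {x y} → x ≲ y → 0ᴿ ≲ (y +ᴿ (-ᴿ x))
≲⇒0≲- {x} {y} x≲y = mk≲ λ {ε} 0<ε → eventually₁
  (λ n a → ≤-trans (0≤- a) (≤-reflexive
    (solve 3 (λ x y ε → y :+ ε :- x := y :+ (:- x) :+ ε) refl (seq x n) (seq y n) ε)))
  (below x≲y 0<ε)

*ᴿ-monoˡ : ∀ {x y u} → 0ᴿ ≲ u → x ≲ y → (x *ᴿ u) ≲ (y *ᴿ u)
*ᴿ-monoˡ {x} {y} {u} 0≲u x≲y = mk≲ λ {ε} 0<ε → eventually₁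
  (λ n a → ≤-trans (≤-reflexive (sym (+-identityʳ (seq x n * seq u n))))
    (≤-trans (+-monoʳ-≤ (seq x n * seq u n) a) (≤-reflexive (solve 4
      (λ x y u ε → x :* u :+ ((y :+ (:- x)) :* u :+ ε) := y :* u :+ ε) refl
      (seq x n) (seq y n) (seq u n) ε))))
  (below (*ᴿ-nonNeg {y +ᴿ (-ᴿ x)} {u} (≲⇒0≲- {x} {y} x≲y) 0≲u) 0<ε)

*ᴿ-comm : ∀ x y → (x *ᴿ y) ≋ (y *ᴿ x)
*ᴿ-comm x y = ≋-pointwise λ n → *-comm (seq x n) (seq y n)

*ᴿ-monoʳ : ∀ {x u v} → 0ᴿ ≲ x → u ≲ v → (x *ᴿ u) ≲ (x *ᴿ v)
*ᴿ-monoʳ {x} {u} {v} 0≲x u≲v = ≲-trans {x *ᴿ u} {u *ᴿ x} {x *ᴿ v} (≋⇒≲ (*ᴿ-comm x u))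
  (≲-trans {u *ᴿ x} {v *ᴿ x} {x *ᴿ v} (*ᴿ-monoˡ {u} {v} {x} 0≲x u≲v) (≋⇒≲ (*ᴿ-comm v x)))

*ᴿ-mono : ∀ {x y u v} → 0ᴿ ≲ x → 0ᴿ ≲ v → x ≲ y → u ≲ v → (x *ᴿ u) ≲ (y *ᴿ v)
*ᴿ-mono {x} {y} {u} {v} 0≲x 0≲v x≲y u≲v = ≲-trans {x *ᴿ u} {x *ᴿ v} {y *ᴿ v}
  (*ᴿ-monoʳ {x} {u} {v} 0≲x u≲v) (*ᴿ-monoˡ {x} {y} {v} 0≲v x≲y)

∣∣ᴿ-≲ : ∀ {x ε} → x ≲ fromℚ ε → (-ᴿ x) ≲ fromℚ ε → ∣ x ∣ᴿ ≲ fromℚ ε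
∣∣ᴿ-≲ {x} x≲ε -x≲ε = mk≲ λ 0<δ →
  eventually₂ (λ n a b → ∣∣-intro {seq x n} a b) (below x≲ε 0<δ) (below -x≲ε 0<δ)

-- The exponential function on the reals

exp-cong : ∀ {x y} → x ≋ y → exp x ≋ exp y
exp-cong {x} {y} x≋y =
  let X , 0≤X , ∣x∣≤X = bound x; Y , 0≤Y , ∣y∣≤Y = bound y; B = X + Y in
  ≋-scaled (expMax B) λ {δ} 0<δ → eventually₂
    (λ n (a , b) (c , s) → ≤-trans
      (expSum-lip′ {B} {seq x n} {seq y n} n s
        (≤-trans a (≤-from X Y 0≤Y refl)) (≤-trans b (≤-from Y X 0≤X (+-comm Y X))) c)
      (≤-reflexive (*-comm δ (expMax B))))
    (eventually₂ (λ _ → _,_) ∣x∣≤X ∣y∣≤Y)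
    (eventually₂ (λ _ → _,_) (close x≋y 0<δ) (from-index (suc (start B))))

exp-+ : ∀ x y → exp (x +ᴿ y) ≋ (exp x *ᴿ exp y)
exp-+ x y =
  let X , 0≤X , ∣x∣≤X = bound x; Y , 0≤Y , ∣y∣≤Y = bound y; B = X + Y in
  ≋-sym (mk≋ λ {ε} 0<ε → eventually₂
    (λ n (a , b) c → c {seq x n} {seq y n}
        (≤-trans a (≤-from X Y 0≤Y refl)) (≤-trans b (≤-from Y X 0≤X (+-comm Y X))))
    (eventually₂ (λ _ → _,_) ∣x∣≤X ∣y∣≤Y)
    (let N , p = expSum-+ {B} (nonNeg+ 0≤X 0≤Y) 0<ε in
      N , λ n N≤n {a} {b} → p {a} {b} n N≤n))

exp-0 : exp 0ᴿ ≋ 1ᴿ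
exp-0 = ≋-pointwise expSum-at-0

-- Stronger than `0ᴿ ≲ x`, which permits slightly negative entries: the slope estimate
-- `expSum-expand` requires nonnegative arguments at each index. Values of `log` have this form.
NonNegSeq : ℝ → Set
NonNegSeq x = ∀ n → 0ℚ ≤ seq x n

NonNegSeq⇒0≲ : ∀ {x} → NonNegSeq x → 0ᴿ ≲ x
NonNegSeq⇒0≲ = ≲-pointwise

exp-nonNeg : ∀ {x} → NonNegSeq x → NonNegSeq (exp x)
exp-nonNeg {x} 0≤x n = expSum-nonNeg n (0≤x n)

-- With slope at least 1, an error ε between the exponentials is an error of at most ε between the
-- arguments. This stands in for the monotonicity of `log`.
exp-reflects-≲ : ∀ {x y} → NonNegSeq x → NonNegSeq y → exp x ≲ exp y → x ≲ y
exp-reflects-≲ {x} {y} 0≤x 0≤y ex≲ey = mk≲ λ {ε} 0<ε → eventually₂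
  (λ n a 1≤n → approx n (<⇒≤ 0<ε) 1≤n a)
  (below ex≲ey 0<ε) (from-index 1)
  where
  approx : ∀ n {ε} → 0ℚ ≤ ε → 1 ℕ.≤ n → expSum n (seq x n) ≤ expSum n (seq y n) + ε → seq x n ≤ seq y n + ε
  approx n {ε} 0≤ε 1≤n Ex≤ = [ le , ge ]′ (≤-total a b)
    where
    a = seq x n
    b = seq y n
    le : a ≤ b → a ≤ b + ε
    le a≤b = ≤-trans a≤b (≤-from b ε 0≤ε refl)
    ge : b ≤ a → a ≤ b + ε
    ge b≤a = ≤-trans
      (≤-reflexive (solve 2 (λ a E → a := a :+ E :- E) refl a (expSum n b)))
      (≤-trans (+-monoˡ-≤ (- expSum n b) (≤-trans (expSum-expand {b} {a} n 1≤n (0≤y n) b≤a) (+-monoʳ-≤ b Ex≤)))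
        (≤-reflexive (solve 3 (λ b E ε → b :+ (E :+ ε) :- E := b :+ ε) refl b (expSum n b) ε)))

1+≲exp : ∀ {p} → 0ℚ ≤ p → fromℚ (p + 1ℚ) ≲ exp (fromℚ p)
1+≲exp {p} 0≤p = ≲-eventually (eventually₁ (λ n 1≤n → 1+≤expSum {p} n 1≤n 0≤p) (from-index 1))

log-nonNeg : ∀ x → NonNegSeq (log x)
log-nonNeg x n = logApprox-nonNeg n (seq x n)

exp∘log : ∀ {x} → 1ᴿ ≲ x → exp (log x) ≋ x
exp∘log {x} 1≲x = mk≋ (exp-log x (below 1≲x))

-- Clamped reciprocals

⊔1-pos : ∀ p → Positive (p ⊔ 1ℚ)
⊔1-pos p = positive (<-≤-trans (positive⁻¹ 1ℚ) (p≤q⊔p p 1ℚ))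

-- Clamping at 1 makes inversion total and 1-Lipschitz, so a Cauchy modulus carries over unchanged.
recip⊔1 : ℚ → ℚ
recip⊔1 p = (1/ (p ⊔ 1ℚ)) {{pos⇒nonZero (p ⊔ 1ℚ) {{⊔1-pos p}}}}

⊔1*recip : ∀ p → (p ⊔ 1ℚ) * recip⊔1 p ≡ 1ℚ
⊔1*recip p = *-inverseʳ (p ⊔ 1ℚ) {{pos⇒nonZero (p ⊔ 1ℚ) {{⊔1-pos p}}}}

0≤recip : ∀ p → 0ℚ ≤ recip⊔1 p
0≤recip p = <⇒≤ (positive⁻¹ (recip⊔1 p) {{1/pos⇒pos (p ⊔ 1ℚ) {{⊔1-pos p}}}})

recip≤1 : ∀ p → recip⊔1 p ≤ 1ℚ
recip≤1 p = ≤-trans (≤-reflexive (sym (*-identityˡ (recip⊔1 p))))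
  (≤-trans (*ʳ-≤ (recip⊔1 p) (0≤recip p) (p≤q⊔p p 1ℚ)) (≤-reflexive (⊔1*recip p)))

⊔1-lip : ∀ p q → p ⊔ 1ℚ - (q ⊔ 1ℚ) ≤ ∣ p - q ∣
⊔1-lip p q = ≤-trans
  (+-monoˡ-≤ (- (q ⊔ 1ℚ)) (⊔-lub {q ⊔ 1ℚ + ∣ p - q ∣} {p} {1ℚ}
    (≤-trans (≤-reflexive (solve 2 (λ p q → p := q :+ (p :- q)) refl p q)) (+-mono-≤ (p≤p⊔q q 1ℚ) (≤∣∣ (p - q))))
    (≤-trans (p≤q⊔p q 1ℚ) (≤-from (q ⊔ 1ℚ) ∣ p - q ∣ (0≤∣p∣ (p - q)) refl))))
  (≤-reflexive (solve 2 (λ a b → a :+ b :- a := b) refl (q ⊔ 1ℚ) ∣ p - q ∣))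

∣⊔1∣-lip : ∀ p q → ∣ p ⊔ 1ℚ - (q ⊔ 1ℚ) ∣ ≤ ∣ p - q ∣
∣⊔1∣-lip p q = ∣∣-intro {p ⊔ 1ℚ - (q ⊔ 1ℚ)} (⊔1-lip p q) (≤-trans
  (≤-reflexive (solve 2 (λ a b → :- (a :- b) := b :- a) refl (p ⊔ 1ℚ) (q ⊔ 1ℚ)))
  (subst (q ⊔ 1ℚ - (p ⊔ 1ℚ) ≤_) (∣∣-sym q p) (⊔1-lip q p)))

recip-lip : ∀ p q → ∣ recip⊔1 p - recip⊔1 q ∣ ≤ ∣ p - q ∣
recip-lip p q = ∣∣-resp eq
  (≤-trans
    (∣∣-* ((q ⊔ 1ℚ) - (p ⊔ 1ℚ)) (r * s) (∣⊔1∣-lip q p) (∣∣-* r s (abs≤1 p) (abs≤1 q)))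
    (≤-trans (≤-reflexive (*-identityʳ ∣ q - p ∣)) (≤-reflexive (∣∣-sym q p))))
  where
  r = recip⊔1 p
  s = recip⊔1 q
  abs≤1 : ∀ p → ∣ recip⊔1 p ∣ ≤ 1ℚ
  abs≤1 p = subst (_≤ 1ℚ) (sym (0≤p⇒∣p∣≡p (0≤recip p))) (recip≤1 p)
  eq : ((q ⊔ 1ℚ) - (p ⊔ 1ℚ)) * (r * s) ≡ r - s
  eq = trans (solve 4 (λ b a r s → (b :- a) :* (r :* s) := r :* (b :* s) :- s :* (a :* r)) refl (q ⊔ 1ℚ) (p ⊔ 1ℚ) r s)
    (trans (cong₂ (λ x y → r * x - s * y) (⊔1*recip q) (⊔1*recip p))
      (cong₂ _-_ (*-identityʳ r) (*-identityʳ s)))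

-- The inverse of x on [1,∞); on (-∞,1) it takes the value 1.
recip : ℝ → ℝ
recip x = mkℝ (λ n → recip⊔1 (seq x n)) λ 0<ε →
  let N , p = cauchy x 0<ε in
  N , λ m n N≤m N≤n → ≤-trans (recip-lip (seq x m) (seq x n)) (p m n N≤m N≤n)

recip-nonNeg : ∀ x → NonNegSeq (recip x)
recip-nonNeg x n = 0≤recip (seq x n)

-- Entries of x may lie below 1 by ε; there the clamping changes them by at most ε, and the
-- reciprocal, at most 1, does not enlarge this error.
recip-inverse : ∀ {x} → 1ᴿ ≲ x → (recip x *ᴿ x) ≋ 1ᴿ
recip-inverse {x} 1≲x = mk≋ λ {ε} 0<ε → eventually₁
  (λ n a → approx (seq x n) (<⇒≤ 0<ε) a) (below 1≲x 0<ε)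
  where
  approx : ∀ p {ε} → 0ℚ ≤ ε → 1ℚ ≤ p + ε → ∣ recip⊔1 p * p - 1ℚ ∣ ≤ ε
  approx p {ε} 0≤ε 1≤p+ε = ∣∣-resp {r * (p - (p ⊔ 1ℚ))}
    (trans (solve 3 (λ r p m → r :* (p :- m) := r :* p :- m :* r) refl r p (p ⊔ 1ℚ)) (cong (λ z → r * p - z) (⊔1*recip p)))
    (≤-trans (∣∣-* r (p - (p ⊔ 1ℚ)) (≤-trans (≤-reflexive (0≤p⇒∣p∣≡p (0≤recip p))) (recip≤1 p))
        (∣∣-intro {p - (p ⊔ 1ℚ)}
          (≤-trans (≤-trans (+-monoˡ-≤ (- (p ⊔ 1ℚ)) (p≤p⊔q p 1ℚ)) (≤-reflexive (+-inverseʳ (p ⊔ 1ℚ)))) 0≤ε)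
          (≤-trans (≤-reflexive (solve 2 (λ p m → :- (p :- m) := m :- p) refl p (p ⊔ 1ℚ)))
            (≤-trans (+-monoˡ-≤ (- p) (⊔-lub {p + ε} {p} {1ℚ} (≤-from p ε 0≤ε refl) 1≤p+ε))
              (≤-reflexive (solve 2 (λ p ε → p :+ ε :- p := ε) refl p ε))))))
      (≤-reflexive (*-identityˡ ε)))
    where r = recip⊔1 p

-- Powers under the exponential

-- Splitting on n in a statement about reals makes Agda unfold their Cauchy proofs; a motive avoids this.
ℕ-ind : (P : ℕ → Set) → P zero → (∀ n → P n → P (suc n)) → ∀ n → P n
ℕ-ind P P0 Ps zero    = P0
ℕ-ind P P0 Ps (suc n) = Ps n (ℕ-ind P P0 Ps n)

fromℚ-cong : ∀ {p q} → p ≡ q → fromℚ p ≋ fromℚ q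
fromℚ-cong p≡q = ≋-pointwise λ _ → p≡q

exp-fromℚ-cong : ∀ {p q} → p ≡ q → exp (fromℚ p) ≋ exp (fromℚ q)
exp-fromℚ-cong p≡q = ≋-pointwise λ n → cong (expSum n) p≡q

fromℚ-0≤ : ∀ {p} → 0ℚ ≤ p → 0ᴿ ≲ fromℚ p
fromℚ-0≤ 0≤p = ≲-pointwise λ _ → 0≤p

fromℕᴿ-*-zero : ∀ x → (fromℕᴿ zero *ᴿ x) ≋ 0ᴿ
fromℕᴿ-*-zero x = ≋-pointwise λ n → *-zeroˡ (seq x n)

fromℕᴿ-*-suc : ∀ k x → (fromℕᴿ (suc k) *ᴿ x) ≋ (x +ᴿ (fromℕᴿ k *ᴿ x))
fromℕᴿ-*-suc k x = ≋-pointwise λ n → trans (cong (_* seq x n) (fromℕ-suc k))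
  (solve 2 (λ k x → (con 1ℚ :+ k) :* x := x :+ k :* x) refl (fromℕ k) (seq x n))

exp-fromℕᴿ-*-zero : ∀ x → exp (fromℕᴿ zero *ᴿ x) ≋ 1ᴿ
exp-fromℕᴿ-*-zero x = ≋-trans {exp (fromℕᴿ zero *ᴿ x)} {exp 0ᴿ} {1ᴿ}
  (exp-cong {fromℕᴿ zero *ᴿ x} {0ᴿ} (fromℕᴿ-*-zero x)) exp-0

exp-fromℕᴿ-*-suc : ∀ k x → exp (fromℕᴿ (suc k) *ᴿ x) ≋ (exp x *ᴿ exp (fromℕᴿ k *ᴿ x))
exp-fromℕᴿ-*-suc k x = ≋-trans {exp (fromℕᴿ (suc k) *ᴿ x)} {exp (x +ᴿ (fromℕᴿ k *ᴿ x))} {exp x *ᴿ exp (fromℕᴿ k *ᴿ x)}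
  (exp-cong {fromℕᴿ (suc k) *ᴿ x} {x +ᴿ (fromℕᴿ k *ᴿ x)} (fromℕᴿ-*-suc k x)) (exp-+ x (fromℕᴿ k *ᴿ x))

^-≲-exp-suc : ∀ {p} x k → 0ℚ ≤ p → fromℚ p ≲ exp x →
  fromℚ (p ^ℚ k) ≲ exp (fromℕᴿ k *ᴿ x) → fromℚ (p ^ℚ suc k) ≲ exp (fromℕᴿ (suc k) *ᴿ x)
^-≲-exp-suc {p} x k 0≤p p≲ ih = begin
  fromℚ (p ^ℚ suc k)
    ≈⟨ ≋-pointwise (λ _ → refl) ⟩
  fromℚ p *ᴿ fromℚ (p ^ℚ k)
    ≲⟨ *ᴿ-monoʳ {fromℚ p} {fromℚ (p ^ℚ k)} {exp (fromℕᴿ k *ᴿ x)} (fromℚ-0≤ 0≤p) ih ⟩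
  fromℚ p *ᴿ exp (fromℕᴿ k *ᴿ x)
    ≲⟨ *ᴿ-monoˡ {fromℚ p} {exp x} {exp (fromℕᴿ k *ᴿ x)}
         (≲-trans {0ᴿ} {fromℚ (p ^ℚ k)} {exp (fromℕᴿ k *ᴿ x)} (fromℚ-0≤ (^-nonNeg k 0≤p)) ih) p≲ ⟩
  exp x *ᴿ exp (fromℕᴿ k *ᴿ x)
    ≈⟨ ≋-sym {exp (fromℕᴿ (suc k) *ᴿ x)} {exp x *ᴿ exp (fromℕᴿ k *ᴿ x)} (exp-fromℕᴿ-*-suc k x) ⟩
  exp (fromℕᴿ (suc k) *ᴿ x) ∎
  where open ≲-Reasoning

^-≲-exp : ∀ {p} x k → 0ℚ ≤ p → fromℚ p ≲ exp x → fromℚ (p ^ℚ k) ≲ exp (fromℕᴿ k *ᴿ x)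
^-≲-exp {p} x k 0≤p p≲ = ℕ-ind (λ k → fromℚ (p ^ℚ k) ≲ exp (fromℕᴿ k *ᴿ x))
  (≲-trans {fromℚ (p ^ℚ zero)} {1ᴿ} {exp (fromℕᴿ zero *ᴿ x)} (≲-pointwise λ _ → ≤-refl)
    (≋⇒≲ (≋-sym {exp (fromℕᴿ zero *ᴿ x)} {1ᴿ} (exp-fromℕᴿ-*-zero x))))
  (λ k → ^-≲-exp-suc {p} x k 0≤p p≲) k

exp-≲-^-suc : ∀ {p} x k → 0ℚ ≤ p → NonNegSeq x → exp x ≲ fromℚ p →
  exp (fromℕᴿ k *ᴿ x) ≲ fromℚ (p ^ℚ k) → exp (fromℕᴿ (suc k) *ᴿ x) ≲ fromℚ (p ^ℚ suc k)
exp-≲-^-suc {p} x k 0≤p 0≤x ≲p ih = begin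
  exp (fromℕᴿ (suc k) *ᴿ x)
    ≈⟨ exp-fromℕᴿ-*-suc k x ⟩
  exp x *ᴿ exp (fromℕᴿ k *ᴿ x)
    ≲⟨ *ᴿ-mono {exp x} {fromℚ p} {exp (fromℕᴿ k *ᴿ x)} {fromℚ (p ^ℚ k)}
         (NonNegSeq⇒0≲ {exp x} (exp-nonNeg {x} 0≤x)) (fromℚ-0≤ (^-nonNeg k 0≤p)) ≲p ih ⟩
  fromℚ p *ᴿ fromℚ (p ^ℚ k)
    ≈⟨ ≋-pointwise (λ _ → refl) ⟩
  fromℚ (p ^ℚ suc k) ∎
  where open ≲-Reasoning

exp-≲-^ : ∀ {p} x k → 0ℚ ≤ p → NonNegSeq x → exp x ≲ fromℚ p → exp (fromℕᴿ k *ᴿ x) ≲ fromℚ (p ^ℚ k)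
exp-≲-^ {p} x k 0≤p 0≤x ≲p = ℕ-ind (λ k → exp (fromℕᴿ k *ᴿ x) ≲ fromℚ (p ^ℚ k))
  (≲-trans {exp (fromℕᴿ zero *ᴿ x)} {1ᴿ} {fromℚ (p ^ℚ zero)} (≋⇒≲ (exp-fromℕᴿ-*-zero x)) (≲-pointwise λ _ → ≤-refl))
  (λ k → exp-≲-^-suc {p} x k 0≤p 0≤x ≲p) k

-- Harmonic numbers against the logarithm

exp-fromℚ-+ : ∀ p q → exp (fromℚ (p + q)) ≋ (exp (fromℚ p) *ᴿ exp (fromℚ q))
exp-fromℚ-+ p q = ≋-trans {exp (fromℚ (p + q))} {exp (fromℚ p +ᴿ fromℚ q)} {exp (fromℚ p) *ᴿ exp (fromℚ q)}
  (≋-pointwise λ n → refl) (exp-+ (fromℚ p) (fromℚ q))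

exp-fromℚ-nonNeg : ∀ {p} → 0ℚ ≤ p → 0ᴿ ≲ exp (fromℚ p)
exp-fromℚ-nonNeg {p} 0≤p = NonNegSeq⇒0≲ {exp (fromℚ p)} (exp-nonNeg {fromℚ p} (λ _ → 0≤p))

-- The product of the factors 1 + 1/j, each at most exp (1/j), telescopes.
suc≲exp-h-suc : ∀ n → fromℕᴿ (suc n) ≲ exp (fromℚ (h n)) → fromℕᴿ (suc (suc n)) ≲ exp (fromℚ (h (suc n)))
suc≲exp-h-suc n ih = begin
  fromℕᴿ (suc (suc n))
    ≈⟨ ≋-pointwise (λ _ → eq) ⟩
  fromℕᴿ (suc n) *ᴿ fromℚ (i + 1ℚ)
    ≲⟨ *ᴿ-mono {fromℕᴿ (suc n)} {exp (fromℚ (h n))} {fromℚ (i + 1ℚ)} {exp (fromℚ i)}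
         (fromℚ-0≤ (0≤fromℕ (suc n))) (exp-fromℚ-nonNeg {i} (0≤1/suc n)) ih (1+≲exp {i} (0≤1/suc n)) ⟩
  exp (fromℚ (h n)) *ᴿ exp (fromℚ i)
    ≈⟨ ≋-sym {exp (fromℚ (h n + i))} {exp (fromℚ (h n)) *ᴿ exp (fromℚ i)} (exp-fromℚ-+ (h n) i) ⟩
  exp (fromℚ (h n + i))
    ≈⟨ exp-fromℚ-cong {h n + i} {h (suc n)} refl ⟩
  exp (fromℚ (h (suc n))) ∎
  where
  open ≲-Reasoning
  i = 1/suc n
  eq : fromℕ (2 ℕ.+ n) ≡ fromℕ (suc n) * (i + 1ℚ)
  eq = trans (fromℕ-suc (suc n)) (trans (cong (_+ fromℕ (suc n)) (sym (suc*1/suc n)))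
    (solve 2 (λ s i → s :* i :+ s := s :* (i :+ con 1ℚ)) refl (fromℕ (suc n)) i))

suc≲exp-h : ∀ n → fromℕᴿ (suc n) ≲ exp (fromℚ (h n))
suc≲exp-h = ℕ-ind (λ n → fromℕᴿ (suc n) ≲ exp (fromℚ (h n)))
  (≲-pointwise λ n → ≤-reflexive (sym (expSum-at-0 n))) suc≲exp-h-suc

-- The geometric series bounds the exponential one: exp x ≤ 1 / (1 - x).
expSum*[1-x]≤1 : ∀ {x} n → 0ℚ ≤ x → expSum n x * (1ℚ - x) + expTerm n x * x ≤ 1ℚ
expSum*[1-x]≤1 {x} zero    0≤x = ≤-reflexive (solve 1 (λ x → con 1ℚ :* (con 1ℚ :- x) :+ con 1ℚ :* x := con 1ℚ) refl x)
expSum*[1-x]≤1 {x} (suc n) 0≤x = ≤-trans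
  (≤-reflexive (solve 3 (λ e t x → (e :+ t) :* (con 1ℚ :- x) :+ t :* x := e :* (con 1ℚ :- x) :+ t) refl
    (expSum n x) (expTerm (suc n) x) x))
  (≤-trans (+-monoʳ-≤ (expSum n x * (1ℚ - x))
      (*ˡ-≤ (expTerm n x) (expTerm-nonNeg n 0≤x)
        (≤-trans (*ˡ-≤ x 0≤x (1/suc≤1 n)) (≤-reflexive (*-identityʳ x)))))
    (expSum*[1-x]≤1 {x} n 0≤x))

-- At x = 1 / (n + 2) the bound 1 / (1 - x) equals (n + 2) / (n + 1), so these bounds telescope too.
expSum-1/suc : ∀ m n → fromℕ (suc n) * expSum m (1/suc (suc n)) ≤ fromℕ (2 ℕ.+ n)
expSum-1/suc m n = ≤-trans (≤-reflexive eq)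
  (≤-trans (*ˡ-≤ (fromℕ (2 ℕ.+ n)) (0≤fromℕ (2 ℕ.+ n))
      (≤-trans (≤-from (expSum m x * (1ℚ - x)) (expTerm m x * x) (nonNeg* (expTerm-nonNeg m 0≤x) 0≤x) refl)
        (expSum*[1-x]≤1 {x} m 0≤x)))
    (≤-reflexive (*-identityʳ (fromℕ (2 ℕ.+ n)))))
  where
  x = 1/suc (suc n)
  0≤x = 0≤1/suc (suc n)
  eq : fromℕ (suc n) * expSum m x ≡ fromℕ (2 ℕ.+ n) * (expSum m x * (1ℚ - x))
  eq = sym (trans (solve 3 (λ s e x → s :* (e :* (con 1ℚ :- x)) := (s :- s :* x) :* e) refl (fromℕ (2 ℕ.+ n)) (expSum m x) x)
    (cong (_* expSum m x) (trans (cong₂ _-_ (fromℕ-suc (suc n)) (suc*1/suc (suc n)))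
      (solve 1 (λ s → con 1ℚ :+ s :- con 1ℚ := s) refl (fromℕ (suc n))))))

exp-h≲-suc : ∀ e → NonNegSeq e → ∀ n → exp (fromℚ (h (suc n))) ≲ (fromℕᴿ (suc n) *ᴿ e) →
  exp (fromℚ (h (suc (suc n)))) ≲ (fromℕᴿ (suc (suc n)) *ᴿ e)
exp-h≲-suc e 0≤e n ih = begin
  exp (fromℚ (h (suc (suc n))))
    ≈⟨ exp-fromℚ-cong {h (suc (suc n))} {h (suc n) + x} refl ⟩
  exp (fromℚ (h (suc n) + x))
    ≈⟨ exp-fromℚ-+ (h (suc n)) x ⟩
  exp (fromℚ (h (suc n))) *ᴿ exp (fromℚ x)
    ≲⟨ *ᴿ-monoˡ {exp (fromℚ (h (suc n)))} {fromℕᴿ (suc n) *ᴿ e} {exp (fromℚ x)}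
         (exp-fromℚ-nonNeg {x} (0≤1/suc (suc n))) ih ⟩
  (fromℕᴿ (suc n) *ᴿ e) *ᴿ exp (fromℚ x)
    ≲⟨ ≲-pointwise (λ m → ≤-trans
         (≤-reflexive (solve 3 (λ s e f → s :* e :* f := s :* f :* e) refl (fromℕ (suc n)) (seq e m) (expSum m x)))
         (*ʳ-≤ (seq e m) (0≤e m) (expSum-1/suc m n))) ⟩
  fromℕᴿ (suc (suc n)) *ᴿ e ∎
  where
  open ≲-Reasoning
  x = 1/suc (suc n)

fromℕᴿ-*-one : ∀ x → x ≋ (fromℕᴿ (suc zero) *ᴿ x)
fromℕᴿ-*-one x = ≋-pointwise λ n → sym (*-identityˡ (seq x n))

-- The geometric bound is void at x = 1, so the first harmonic summand stays as the factor exp (h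
-- 1); it becomes the 1 in `h≲log+1`.
exp-h≲ : ∀ n → exp (fromℚ (h (suc n))) ≲ (fromℕᴿ (suc n) *ᴿ exp (fromℚ (h (suc zero))))
exp-h≲ = ℕ-ind (λ n → exp (fromℚ (h (suc n))) ≲ (fromℕᴿ (suc n) *ᴿ exp (fromℚ (h (suc zero)))))
  (≋⇒≲ (fromℕᴿ-*-one (exp (fromℚ (h (suc zero))))))
  (exp-h≲-suc (exp (fromℚ (h (suc zero)))) (exp-nonNeg {fromℚ (h (suc zero))} (λ _ → 0≤h (suc zero))))

1≲fromℕᴿ-suc : ∀ n → 1ᴿ ≲ fromℕᴿ (suc n)
1≲fromℕᴿ-suc n = ≲-pointwise λ _ → fromℕ-mono {1} {suc n} (s≤s z≤n)

exp-log-fromℕᴿ : ∀ n → exp (log (fromℕᴿ (suc n))) ≋ fromℕᴿ (suc n)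
exp-log-fromℕᴿ n = exp∘log {fromℕᴿ (suc n)} (1≲fromℕᴿ-suc n)

log≲h : ∀ n → log (fromℕᴿ (suc n)) ≲ fromℚ (h (suc n))
log≲h n = exp-reflects-≲ {log (fromℕᴿ (suc n))} {fromℚ (h (suc n))} (log-nonNeg (fromℕᴿ (suc n))) (λ _ → 0≤h (suc n))
  (≲-trans {exp (log (fromℕᴿ (suc n)))} {fromℕᴿ (suc n)} {exp (fromℚ (h (suc n)))} (≋⇒≲ (exp-log-fromℕᴿ n))
    (≲-trans {fromℕᴿ (suc n)} {fromℕᴿ (suc (suc n))} {exp (fromℚ (h (suc n)))}
      (≲-pointwise λ _ → fromℕ-mono (ℕP.n≤1+n (suc n))) (suc≲exp-h (suc n))))

≲-log-+ : ∀ {p x y} → 0ℚ ≤ p → NonNegSeq y → 1ᴿ ≲ x → exp (fromℚ p) ≲ (x *ᴿ exp y) → fromℚ p ≲ (log x +ᴿ y)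
≲-log-+ {p} {x} {y} 0≤p 0≤y 1≲x ep≲ = exp-reflects-≲ {fromℚ p} {log x +ᴿ y} (λ _ → 0≤p)
  (λ m → nonNeg+ (log-nonNeg x m) (0≤y m))
  (begin
    exp (fromℚ p)
      ≲⟨ ep≲ ⟩
    x *ᴿ exp y
      ≈⟨ *ᴿ-cong {x} {exp (log x)} {exp y} {exp y} (≋-sym {exp (log x)} {x} (exp∘log {x} 1≲x)) (≋-refl {exp y}) ⟩
    exp (log x) *ᴿ exp y
      ≈⟨ ≋-sym {exp (log x +ᴿ y)} {exp (log x) *ᴿ exp y} (exp-+ (log x) y) ⟩
    exp (log x +ᴿ y) ∎)
  where open ≲-Reasoning

h≲log+1 : ∀ n → fromℚ (h (suc n)) ≲ (log (fromℕᴿ (suc n)) +ᴿ 1ᴿ)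
h≲log+1 n = ≲-trans {fromℚ (h (suc n))} {log (fromℕᴿ (suc n)) +ᴿ fromℚ (h (suc zero))} {log (fromℕᴿ (suc n)) +ᴿ 1ᴿ}
  (≲-log-+ {h (suc n)} {fromℕᴿ (suc n)} {fromℚ (h (suc zero))} (0≤h (suc n)) (λ _ → 0≤h (suc zero)) (1≲fromℕᴿ-suc n) (exp-h≲ n))
  (≲-pointwise {log (fromℕᴿ (suc n)) +ᴿ fromℚ (h (suc zero))} {log (fromℕᴿ (suc n)) +ᴿ 1ᴿ}
    λ m → +-monoʳ-≤ (seq (log (fromℕᴿ (suc n))) m) {h (suc zero)} {1ℚ} ≤-refl)

-- Divergence of log k and log log k

expSum-mono : ∀ {a b} n → 0ℚ ≤ a → a ≤ b → expSum n a ≤ expSum n b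
expSum-mono zero    0≤a a≤b = ≤-refl
expSum-mono {a} {b} (suc n) 0≤a a≤b = +-mono-≤ (expSum-mono {a} {b} n 0≤a a≤b) (expTerm-mono {a} {b} (suc n) 0≤a a≤b)

fromℕ-cancel-≤ : ∀ {m n} → fromℕ m ≤ fromℕ n → m ℕ.≤ n
fromℕ-cancel-≤ {m} {n} m≤n = ℕP.≮⇒≥ λ n<m → <-irrefl refl
  (<-≤-trans (+-monoˡ-< (fromℕ n) (positive⁻¹ 1ℚ))
    (≤-trans (≤-reflexive (sym (fromℕ-suc n))) (≤-trans (fromℕ-mono n<m) (≤-trans m≤n (≤-reflexive (sym (+-identityˡ (fromℕ n))))))))

-- If h k ≤ B then k + 1 ≤ exp (h k) ≤ exp B.
h-unbounded : ∀ B → 0ℚ ≤ B → ∃ λ K → ∀ k → K ℕ.≤ k → B ≤ h k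
h-unbounded B 0≤B = suc A , λ k A<k → [ id , (λ hk≤B → contradiction (small k hk≤B) (ℕP.<⇒≱ A<k)) ]′ (≤-total B (h k))
  where
  A = archi (expMax B)
  small : ∀ k → h k ≤ B → k ℕ.≤ A
  small k hk≤B = fromℕ-cancel-≤ (≤-trans (k≤ (below (suc≲exp-h k) (positive⁻¹ 1ℚ))) (≤archi (expMax B)))
    where
    k≤ : Eventually (λ n → fromℕ (suc k) ≤ expSum n (h k) + 1ℚ) → fromℕ k ≤ expMax B
    k≤ (N , p) = ≤-trans
      (≤-reflexive (sym (trans (cong (_- 1ℚ) (fromℕ-suc k)) (solve 1 (λ k → con 1ℚ :+ k :- con 1ℚ := k) refl (fromℕ k)))))
      (≤-trans (+-monoˡ-≤ (- 1ℚ) (p M (ℕP.m≤m⊔n N (start B))))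
        (≤-trans (≤-reflexive (solve 1 (λ e → e :+ con 1ℚ :- con 1ℚ := e) refl (expSum M (h k))))
          (≤-trans (expSum-mono {h k} {B} M (0≤h k) hk≤B) (expSum≤expMax M 0≤B (ℕP.m≤n⊔m N (start B))))))
      where M = N ℕ.⊔ start B

log-unbounded : ∀ B → 0ℚ ≤ B → ∃ λ K → ∀ n → K ℕ.≤ suc n → fromℚ B ≲ log (fromℕᴿ (suc n))
log-unbounded B 0≤B = proj₁ hu , λ n K≤ → ≲-+-cancel {B} {log (fromℕᴿ (suc n))}
  (≲-trans {fromℚ (B + 1ℚ)} {fromℚ (h (suc n))} {log (fromℕᴿ (suc n)) +ᴿ 1ᴿ} (fromℚ-mono (proj₂ hu (suc n) K≤)) (h≲log+1 n))
  where
  hu = h-unbounded (B + 1ℚ) (nonNeg+ 0≤B (0≤fromℕ 1))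
  ≲-+-cancel : ∀ {p y} → fromℚ (p + 1ℚ) ≲ (y +ᴿ 1ᴿ) → fromℚ p ≲ y
  ≲-+-cancel {p} {y} p≲y = mk≲ λ {ε} 0<ε → eventually₁
    (λ n a → ≤-trans (≤-reflexive (solve 1 (λ p → p := p :+ con 1ℚ :- con 1ℚ) refl p))
      (≤-trans (+-monoˡ-≤ (- 1ℚ) a)
        (≤-reflexive (solve 2 (λ y ε → y :+ con 1ℚ :+ ε :- con 1ℚ := y :+ ε) refl (seq y n) ε))))
    (below p≲y 0<ε)

1≤⇒1≲ : ∀ {p x} → 1ℚ ≤ p → fromℚ p ≲ x → 1ᴿ ≲ x
1≤⇒1≲ {p} {x} 1≤p p≲x = ≲-trans {1ᴿ} {fromℚ p} {x} (≲-pointwise λ _ → 1≤p) p≲x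

log-lower : ∀ {p x} → 0ℚ ≤ p → 1ᴿ ≲ x → exp (fromℚ p) ≲ x → fromℚ p ≲ log x
log-lower {p} {x} 0≤p 1≲x ep≲x = exp-reflects-≲ {fromℚ p} {log x} (λ _ → 0≤p) (log-nonNeg x)
  (≲-trans {exp (fromℚ p)} {x} {exp (log x)} ep≲x (≋⇒≲ (≋-sym {exp (log x)} {x} (exp∘log {x} 1≲x))))

-- Provides a rational threshold for `log-unbounded`. Being at least 1, it also guarantees that the
-- outer logarithm in log log k inverts `exp`.
exp-bound : ∀ p → ∃ λ B → 1ℚ ≤ B × exp (fromℚ p) ≲ fromℚ B
exp-bound p = let B , 0≤B , ∣e∣≤B = bound (exp (fromℚ p)) in
  1ℚ + B , ≤-from 1ℚ B 0≤B refl ,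
  ≲-eventually (eventually₁ (λ n e≤B → ≤-trans (∣∣-elim {expSum n p} e≤B) (≤-from B 1ℚ (0≤fromℕ 1) (+-comm B 1ℚ))) ∣e∣≤B)

loglog-unbounded : ∀ M → 1ℚ ≤ M → ∃ λ K → ∀ n → K ℕ.≤ suc n →
  1ᴿ ≲ log (fromℕᴿ (suc n)) × fromℚ M ≲ log (log (fromℕᴿ (suc n)))
loglog-unbounded M 1≤M =
  let B , 1≤B , eM≲B = exp-bound M
      K , B≲log      = log-unbounded B (1≤p⇒0≤p 1≤B)
  in K , λ n K≤ → bounds B 1≤B eM≲B (log (fromℕᴿ (suc n))) (B≲log n K≤)
  where
  bounds : ∀ B → 1ℚ ≤ B → exp (fromℚ M) ≲ fromℚ B → ∀ x → fromℚ B ≲ x → 1ᴿ ≲ x × fromℚ M ≲ log x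
  bounds B 1≤B eM≲B x B≲x = 1≤⇒1≲ {B} {x} 1≤B B≲x ,
    log-lower {M} {x} (1≤p⇒0≤p 1≤M) (1≤⇒1≲ {B} {x} 1≤B B≲x) (≲-trans {exp (fromℚ M)} {fromℚ B} {x} eM≲B B≲x)

-- Bounds on log Y in terms of k log log k

-- By 1 + t ≤ exp t, exp 5 is at least 6, which covers the factor 6 of the lower bound on Y and the
-- factor 4 of `2h≲exp`.
5ℚ : ℚ
5ℚ = fromℕ 5

-- The reals stand for log k, log log k and log Y at k = n + 1; the two logarithms `ll` and `L` are
-- specified by their exponentials.
module _ (n : ℕ) (ℓ ll L : ℝ) (0≤ll : NonNegSeq ll) (0≤L : NonNegSeq L)
  (exp-ll : exp ll ≋ ℓ) (exp-L : exp L ≋ fromℚ (invProb n)) where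
  open ≲-Reasoning

  k*loglog≲ : ℓ ≲ fromℚ (h (suc n)) →
    (fromℕᴿ (suc n) *ᴿ ll) ≲ (L +ᴿ (fromℕᴿ (suc n) *ᴿ fromℚ 5ℚ))
  k*loglog≲ ℓ≲h = exp-reflects-≲ {fromℕᴿ (suc n) *ᴿ ll} {L +ᴿ (fromℕᴿ (suc n) *ᴿ fromℚ 5ℚ)}
    (λ m → nonNeg* (0≤fromℕ (suc n)) (0≤ll m)) (λ m → nonNeg+ (0≤L m) (nonNeg* (0≤fromℕ (suc n)) (0≤fromℕ 5)))
    (begin
      exp (fromℕᴿ (suc n) *ᴿ ll)
        ≲⟨ exp-≲-^ {h (suc n)} ll (suc n) (0≤h (suc n)) 0≤ll
             (≲-trans {exp ll} {ℓ} {fromℚ (h (suc n))} (≋⇒≲ exp-ll) ℓ≲h) ⟩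
      fromℚ (h (suc n) ^ℚ suc n)
        ≲⟨ fromℚ-mono (h^≤invProb n) ⟩
      fromℚ (6ℚ ^ℚ suc n * invProb n)
        ≈⟨ ≋-pointwise (λ _ → refl) ⟩
      fromℚ (6ℚ ^ℚ suc n) *ᴿ fromℚ (invProb n)
        ≲⟨ *ᴿ-mono {fromℚ (6ℚ ^ℚ suc n)} {exp (fromℕᴿ (suc n) *ᴿ fromℚ 5ℚ)} {fromℚ (invProb n)} {exp L}
             (fromℚ-0≤ (^-nonNeg (suc n) (0≤fromℕ 6)))
             (NonNegSeq⇒0≲ {exp L} (exp-nonNeg {L} 0≤L))
             (^-≲-exp {6ℚ} (fromℚ 5ℚ) (suc n) (0≤fromℕ 6)
               (≲-trans {fromℚ 6ℚ} {fromℚ (5ℚ + 1ℚ)} {exp (fromℚ 5ℚ)} (≲-pointwise λ _ → ≤-refl) (1+≲exp {5ℚ} (0≤fromℕ 5))))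
             (≋⇒≲ (≋-sym {exp L} {fromℚ (invProb n)} exp-L)) ⟩
      exp (fromℕᴿ (suc n) *ᴿ fromℚ 5ℚ) *ᴿ exp L
        ≈⟨ *ᴿ-comm (exp (fromℕᴿ (suc n) *ᴿ fromℚ 5ℚ)) (exp L) ⟩
      exp L *ᴿ exp (fromℕᴿ (suc n) *ᴿ fromℚ 5ℚ)
        ≈⟨ ≋-sym {exp (L +ᴿ (fromℕᴿ (suc n) *ᴿ fromℚ 5ℚ))} {exp L *ᴿ exp (fromℕᴿ (suc n) *ᴿ fromℚ 5ℚ)}
             (exp-+ L (fromℕᴿ (suc n) *ᴿ fromℚ 5ℚ)) ⟩
      exp (L +ᴿ (fromℕᴿ (suc n) *ᴿ fromℚ 5ℚ)) ∎)

  -- From ℓ + 1 ≤ 2 ℓ follows 2 h ≤ 4 ℓ, and the 4 is absorbed by exp 5.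
  2h≲exp : 1ᴿ ≲ ℓ → fromℚ (h (suc n)) ≲ (ℓ +ᴿ 1ᴿ) → fromℚ (2ℚ * h (suc n)) ≲ exp (ll +ᴿ fromℚ 5ℚ)
  2h≲exp 1≲ℓ h≲ = begin
    fromℚ (2ℚ * h (suc n))
      ≈⟨ ≋-pointwise (λ _ → *-comm 2ℚ (h (suc n))) ⟩
    fromℚ (h (suc n)) *ᴿ fromℚ 2ℚ
      ≲⟨ *ᴿ-monoˡ {fromℚ (h (suc n))} {ℓ +ᴿ ℓ} {fromℚ 2ℚ} (fromℚ-0≤ (0≤fromℕ 2))
           (≲-trans {fromℚ (h (suc n))} {ℓ +ᴿ 1ᴿ} {ℓ +ᴿ ℓ} h≲ (+ᴿ-mono {ℓ} {ℓ} {1ᴿ} {ℓ} (≋⇒≲ (≋-refl {ℓ})) 1≲ℓ)) ⟩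
    (ℓ +ᴿ ℓ) *ᴿ fromℚ 2ℚ
      ≈⟨ ≋-pointwise (λ m → solve 1 (λ l → (l :+ l) :* (con 1ℚ :+ con 1ℚ) :=
           l :* ((con 1ℚ :+ con 1ℚ) :* (con 1ℚ :+ con 1ℚ))) refl (seq ℓ m)) ⟩
    ℓ *ᴿ fromℚ (2ℚ * 2ℚ)
      ≲⟨ *ᴿ-mono {ℓ} {exp ll} {fromℚ (2ℚ * 2ℚ)} {exp (fromℚ 5ℚ)}
           (≲-trans {0ᴿ} {1ᴿ} {ℓ} (fromℚ-0≤ (0≤fromℕ 1)) 1≲ℓ) (exp-fromℚ-nonNeg {5ℚ} (0≤fromℕ 5))
           (≋⇒≲ (≋-sym {exp ll} {ℓ} exp-ll))
           (≲-trans {fromℚ (2ℚ * 2ℚ)} {fromℚ (5ℚ + 1ℚ)} {exp (fromℚ 5ℚ)}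
             (≲-pointwise λ _ → fromℕ-mono {4} {6} (s≤s (s≤s (s≤s (s≤s z≤n))))) (1+≲exp {5ℚ} (0≤fromℕ 5))) ⟩
    exp ll *ᴿ exp (fromℚ 5ℚ)
      ≈⟨ ≋-sym {exp (ll +ᴿ fromℚ 5ℚ)} {exp ll *ᴿ exp (fromℚ 5ℚ)} (exp-+ ll (fromℚ 5ℚ)) ⟩
    exp (ll +ᴿ fromℚ 5ℚ) ∎

  logInvProb≲ : 1ᴿ ≲ ℓ → fromℚ (h (suc n)) ≲ (ℓ +ᴿ 1ᴿ) → L ≲ (fromℕᴿ (suc n) *ᴿ (ll +ᴿ fromℚ 5ℚ))
  logInvProb≲ 1≲ℓ h≲ = exp-reflects-≲ {L} {fromℕᴿ (suc n) *ᴿ (ll +ᴿ fromℚ 5ℚ)} 0≤L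
    (λ m → nonNeg* (0≤fromℕ (suc n)) (nonNeg+ (0≤ll m) (0≤fromℕ 5)))
    (begin
      exp L
        ≈⟨ exp-L ⟩
      fromℚ (invProb n)
        ≲⟨ fromℚ-mono (invProb-upper n) ⟩
      fromℚ ((2ℚ * h (suc n)) ^ℚ suc n)
        ≲⟨ ^-≲-exp {2ℚ * h (suc n)} (ll +ᴿ fromℚ 5ℚ) (suc n) (nonNeg* (0≤fromℕ 2) (0≤h (suc n))) (2h≲exp 1≲ℓ h≲) ⟩
      exp (fromℕᴿ (suc n) *ᴿ (ll +ᴿ fromℚ 5ℚ)) ∎)

-- The relative error δ

excess : ℕ → ℝ → ℝ → ℝ
excess n L ll = (L *ᴿ fromℚ (1/suc n)) +ᴿ (-ᴿ ll)

k*/k : ∀ n p → fromℕ (suc n) * p * 1/suc n ≡ p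
k*/k n p = trans (solve 3 (λ s p i → s :* p :* i := s :* (i :* p)) refl (fromℕ (suc n)) p (1/suc n)) (*1/suc-cancel n p)

excess-upper : ∀ n L ll {c} → L ≲ (fromℕᴿ (suc n) *ᴿ (ll +ᴿ fromℚ c)) → excess n L ll ≲ fromℚ c
excess-upper n L ll {c} L≲ = begin
  excess n L ll
    ≲⟨ +ᴿ-mono {L *ᴿ fromℚ (1/suc n)} {(fromℕᴿ (suc n) *ᴿ (ll +ᴿ fromℚ c)) *ᴿ fromℚ (1/suc n)} { -ᴿ ll} { -ᴿ ll}
         (*ᴿ-monoˡ {L} {fromℕᴿ (suc n) *ᴿ (ll +ᴿ fromℚ c)} {fromℚ (1/suc n)} (fromℚ-0≤ (0≤1/suc n)) L≲)
         (≋⇒≲ (≋-refl { -ᴿ ll})) ⟩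
  ((fromℕᴿ (suc n) *ᴿ (ll +ᴿ fromℚ c)) *ᴿ fromℚ (1/suc n)) +ᴿ (-ᴿ ll)
    ≈⟨ ≋-pointwise (λ m → trans (cong (_+ - seq ll m) (k*/k n (seq ll m + c)))
         (solve 2 (λ l c → l :+ c :+ (:- l) := c) refl (seq ll m) c)) ⟩
  fromℚ c ∎
  where open ≲-Reasoning

excess-lower : ∀ n L ll {c} → (fromℕᴿ (suc n) *ᴿ ll) ≲ (L +ᴿ (fromℕᴿ (suc n) *ᴿ fromℚ c)) → (-ᴿ excess n L ll) ≲ fromℚ c
excess-lower n L ll {c} ≲L = begin
  -ᴿ excess n L ll
    ≈⟨ ≋-pointwise (λ m → trans (solve 2 (λ a l → :- (a :+ (:- l)) := l :+ (:- a)) refl (seq L m * 1/suc n) (seq ll m))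
         (cong (_+ - (seq L m * 1/suc n)) (sym (k*/k n (seq ll m))))) ⟩
  ((fromℕᴿ (suc n) *ᴿ ll) *ᴿ fromℚ (1/suc n)) +ᴿ (-ᴿ (L *ᴿ fromℚ (1/suc n)))
    ≲⟨ +ᴿ-mono {(fromℕᴿ (suc n) *ᴿ ll) *ᴿ fromℚ (1/suc n)} {(L +ᴿ (fromℕᴿ (suc n) *ᴿ fromℚ c)) *ᴿ fromℚ (1/suc n)}
         { -ᴿ (L *ᴿ fromℚ (1/suc n))} { -ᴿ (L *ᴿ fromℚ (1/suc n))}
         (*ᴿ-monoˡ {fromℕᴿ (suc n) *ᴿ ll} {L +ᴿ (fromℕᴿ (suc n) *ᴿ fromℚ c)} {fromℚ (1/suc n)} (fromℚ-0≤ (0≤1/suc n)) ≲L)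
         (≋⇒≲ (≋-refl { -ᴿ (L *ᴿ fromℚ (1/suc n))})) ⟩
  ((L +ᴿ (fromℕᴿ (suc n) *ᴿ fromℚ c)) *ᴿ fromℚ (1/suc n)) +ᴿ (-ᴿ (L *ᴿ fromℚ (1/suc n)))
    ≈⟨ ≋-pointwise (λ m → trans
         (solve 4 (λ L s c i → (L :+ s :* c) :* i :+ (:- (L :* i)) := s :* c :* i) refl (seq L m) (fromℕ (suc n)) c (1/suc n))
         (k*/k n c)) ⟩
  fromℚ c ∎
  where open ≲-Reasoning

-- Since l is at least M, c ≤ ε * M gives x ≤ ε l, and the reciprocal cancels l. The rational M lets
-- this be checked without dividing by a real.
*-recip-≲ : ∀ {x l c M ε} → 0ℚ ≤ ε → 1ᴿ ≲ l → fromℚ M ≲ l → c ≤ ε * M → x ≲ fromℚ c → (x *ᴿ recip l) ≲ fromℚ ε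
*-recip-≲ {x} {l} {c} {M} {ε} 0≤ε 1≲l M≲l c≤ x≲c = begin
  x *ᴿ recip l
    ≲⟨ *ᴿ-monoˡ {x} {fromℚ (ε * M)} {recip l} 0≲r (≲-trans {x} {fromℚ c} {fromℚ (ε * M)} x≲c (fromℚ-mono c≤)) ⟩
  fromℚ (ε * M) *ᴿ recip l
    ≈⟨ ≋-pointwise (λ m → solve 3 (λ e M r → e :* M :* r := M :* (e :* r)) refl ε M (seq (recip l) m)) ⟩
  fromℚ M *ᴿ (fromℚ ε *ᴿ recip l)
    ≲⟨ *ᴿ-monoˡ {fromℚ M} {l} {fromℚ ε *ᴿ recip l} (*ᴿ-nonNeg {fromℚ ε} {recip l} (fromℚ-0≤ 0≤ε) 0≲r) M≲l ⟩
  l *ᴿ (fromℚ ε *ᴿ recip l)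
    ≈⟨ ≋-pointwise (λ m → solve 3 (λ e l r → l :* (e :* r) := e :* (r :* l)) refl ε (seq l m) (seq (recip l) m)) ⟩
  fromℚ ε *ᴿ (recip l *ᴿ l)
    ≈⟨ *ᴿ-cong {fromℚ ε} {fromℚ ε} {recip l *ᴿ l} {1ᴿ} (≋-refl {fromℚ ε}) (recip-inverse {l} 1≲l) ⟩
  fromℚ ε *ᴿ 1ᴿ
    ≈⟨ ≋-pointwise (λ _ → *-identityʳ ε) ⟩
  fromℚ ε ∎
  where
  open ≲-Reasoning
  0≲r = NonNegSeq⇒0≲ {recip l} (recip-nonNeg l)

∣*-recip∣≲ : ∀ {x l c M ε} d → d ≋ (x *ᴿ recip l) → 0ℚ ≤ ε → 1ᴿ ≲ l → fromℚ M ≲ l → c ≤ ε * M →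
  x ≲ fromℚ c → (-ᴿ x) ≲ fromℚ c → ∣ d ∣ᴿ ≲ fromℚ ε
∣*-recip∣≲ {x} {l} {c} {M} {ε} d d≋ 0≤ε 1≲l M≲l c≤ x≲c -x≲c = ∣∣ᴿ-≲ {d} {ε}
  (≲-trans {d} {x *ᴿ recip l} {fromℚ ε} (≋⇒≲ d≋) (*-recip-≲ {x} {l} {c} {M} {ε} 0≤ε 1≲l M≲l c≤ x≲c))
  (≲-trans { -ᴿ d} { -ᴿ (x *ᴿ recip l)} {fromℚ ε} (≋⇒≲ (-ᴿ-cong {d} {x *ᴿ recip l} d≋))
    (≲-trans { -ᴿ (x *ᴿ recip l)} {(-ᴿ x) *ᴿ recip l} {fromℚ ε}
      (≋⇒≲ (≋-pointwise { -ᴿ (x *ᴿ recip l)} {(-ᴿ x) *ᴿ recip l}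
        λ m → solve 2 (λ x r → :- (x :* r) := (:- x) :* r) refl (seq x m) (seq (recip l) m)))
      (*-recip-≲ { -ᴿ x} {l} {c} {M} {ε} 0≤ε 1≲l M≲l c≤ -x≲c)))

*-recip-cancel : ∀ x k l d → 1ᴿ ≲ l → d ≋ (x *ᴿ recip l) →
  ((1ᴿ +ᴿ d) *ᴿ (k *ᴿ l)) ≋ ((k *ᴿ l) +ᴿ (x *ᴿ k))
*-recip-cancel x k l d 1≲l d≋ = begin-equality
  (1ᴿ +ᴿ d) *ᴿ (k *ᴿ l)
    ≈⟨ *ᴿ-cong {1ᴿ +ᴿ d} {1ᴿ +ᴿ (x *ᴿ recip l)} {k *ᴿ l} {k *ᴿ l}
         (+ᴿ-cong {1ᴿ} {1ᴿ} {d} {x *ᴿ recip l} (≋-refl {1ᴿ}) d≋) (≋-refl {k *ᴿ l}) ⟩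
  (1ᴿ +ᴿ (x *ᴿ recip l)) *ᴿ (k *ᴿ l)
    ≈⟨ ≋-pointwise (λ m → solve 4 (λ x r k l → (con 1ℚ :+ x :* r) :* (k :* l) := k :* l :+ x :* k :* (r :* l)) refl
         (seq x m) (seq (recip l) m) (seq k m) (seq l m)) ⟩
  (k *ᴿ l) +ᴿ ((x *ᴿ k) *ᴿ (recip l *ᴿ l))
    ≈⟨ +ᴿ-cong {k *ᴿ l} {k *ᴿ l} {(x *ᴿ k) *ᴿ (recip l *ᴿ l)} {(x *ᴿ k) *ᴿ 1ᴿ} (≋-refl {k *ᴿ l})
         (*ᴿ-cong {x *ᴿ k} {x *ᴿ k} {recip l *ᴿ l} {1ᴿ} (≋-refl {x *ᴿ k}) (recip-inverse {l} 1≲l)) ⟩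
  (k *ᴿ l) +ᴿ ((x *ᴿ k) *ᴿ 1ᴿ)
    ≈⟨ ≋-pointwise (λ m → solve 3 (λ x k l → k :* l :+ x :* k :* con 1ℚ := k :* l :+ x :* k) refl
         (seq x m) (seq k m) (seq l m)) ⟩
  (k *ᴿ l) +ᴿ (x *ᴿ k) ∎
  where open ≲-Reasoning

excess-solves : ∀ n L ll d → 1ᴿ ≲ ll → d ≋ (excess n L ll *ᴿ recip ll) →
  ((1ᴿ +ᴿ d) *ᴿ (fromℕᴿ (suc n) *ᴿ ll)) ≋ L
excess-solves n L ll d 1≲ll d≋ =
  ≋-trans {(1ᴿ +ᴿ d) *ᴿ (fromℕᴿ (suc n) *ᴿ ll)} {(fromℕᴿ (suc n) *ᴿ ll) +ᴿ (excess n L ll *ᴿ fromℕᴿ (suc n))} {L}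
    (*-recip-cancel (excess n L ll) (fromℕᴿ (suc n)) ll d 1≲ll d≋)
    (≋-pointwise {(fromℕᴿ (suc n) *ᴿ ll) +ᴿ (excess n L ll *ᴿ fromℕᴿ (suc n))} {L} λ m → trans
      (solve 4 (λ L i s l → s :* l :+ (L :* i :+ (:- l)) :* s := s :* L :* i) refl
        (seq L m) (1/suc n) (fromℕ (suc n)) (seq ll m))
      (k*/k n (seq L m)))

-ᴿ-inverse : ∀ x → (x +ᴿ (-ᴿ x)) ≋ 0ᴿ
-ᴿ-inverse x = ≋-pointwise {x +ᴿ (-ᴿ x)} {0ᴿ} λ m → solve 1 (λ a → a :+ (:- a) := con 0ℚ) refl (seq x m)

exp*exp-neg : ∀ x → (exp x *ᴿ exp (-ᴿ x)) ≋ 1ᴿ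
exp*exp-neg x = ≋-trans {exp x *ᴿ exp (-ᴿ x)} {exp (x +ᴿ (-ᴿ x))} {1ᴿ}
  (≋-sym {exp (x +ᴿ (-ᴿ x))} {exp x *ᴿ exp (-ᴿ x)} (exp-+ x (-ᴿ x)))
  (≋-trans {exp (x +ᴿ (-ᴿ x))} {exp 0ᴿ} {1ᴿ} (exp-cong {x +ᴿ (-ᴿ x)} {0ᴿ} (-ᴿ-inverse x)) exp-0)

-- Multiply exp (-L) by p * Y = 1, and use exp L * exp (-L) = 1.
exp-neg : ∀ {p Y} L → p * Y ≡ 1ℚ → exp L ≋ fromℚ Y → fromℚ p ≋ exp (-ᴿ L)
exp-neg {p} {Y} L pY≡1 exp-L = ≋-sym {exp (-ᴿ L)} {fromℚ p}
  (≋-trans {exp (-ᴿ L)} {(exp L *ᴿ exp (-ᴿ L)) *ᴿ fromℚ p} {fromℚ p}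
    (≋-trans {exp (-ᴿ L)} {(fromℚ Y *ᴿ exp (-ᴿ L)) *ᴿ fromℚ p} {(exp L *ᴿ exp (-ᴿ L)) *ᴿ fromℚ p}
      (≋-pointwise λ m → trans (sym (*-identityˡ (expSum m (- seq L m))))
        (trans (cong (_* expSum m (- seq L m)) (sym pY≡1))
          (solve 3 (λ p Y e → p :* Y :* e := Y :* e :* p) refl p Y (expSum m (- seq L m)))))
      (*ᴿ-cong {fromℚ Y *ᴿ exp (-ᴿ L)} {exp L *ᴿ exp (-ᴿ L)} {fromℚ p} {fromℚ p}
        (*ᴿ-cong {fromℚ Y} {exp L} {exp (-ᴿ L)} {exp (-ᴿ L)} (≋-sym {exp L} {fromℚ Y} exp-L) (≋-refl {exp (-ᴿ L)}))
        (≋-refl {fromℚ p})))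
    (≋-trans {(exp L *ᴿ exp (-ᴿ L)) *ᴿ fromℚ p} {1ᴿ *ᴿ fromℚ p} {fromℚ p}
      (*ᴿ-cong {exp L *ᴿ exp (-ᴿ L)} {1ᴿ} {fromℚ p} {fromℚ p} (exp*exp-neg L) (≋-refl {fromℚ p}))
      (≋-pointwise λ _ → *-identityˡ p)))

1≲fromℚ-invProb : ∀ n → 1ᴿ ≲ fromℚ (invProb n)
1≲fromℚ-invProb n = ≲-pointwise λ _ → 1≤invProb n

excess-bounds : ∀ n ℓ ll L → NonNegSeq ll → NonNegSeq L → exp ll ≋ ℓ → exp L ≋ fromℚ (invProb n) →
  1ᴿ ≲ ℓ → ℓ ≲ fromℚ (h (suc n)) → fromℚ (h (suc n)) ≲ (ℓ +ᴿ 1ᴿ) →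
  excess n L ll ≲ fromℚ 5ℚ × (-ᴿ excess n L ll) ≲ fromℚ 5ℚ
excess-bounds n ℓ ll L 0≤ll 0≤L exp-ll exp-L 1≲ℓ ℓ≲h h≲ =
  excess-upper n L ll {5ℚ} (logInvProb≲ n ℓ ll L 0≤ll 0≤L exp-ll exp-L 1≲ℓ h≲) ,
  excess-lower n L ll {5ℚ} (k*loglog≲ n ℓ ll L 0≤ll 0≤L exp-ll exp-L ℓ≲h)

≋⇒≈ : ∀ {x y} → x ≋ y → x ≈ y
≋⇒≈ x≋y 0<ε = close x≋y 0<ε

-- `δ` is specified up to `_≋_` and at positive arguments, so that its definition is never unfolded
-- here.
module _ (δ : ℕ → ℝ)
  (δ≋ : ∀ n → δ (suc n) ≋
    (excess n (log (fromℚ (invProb n))) (log (log (fromℕᴿ (suc n)))) *ᴿ recip (log (log (fromℕᴿ (suc n)))))) where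

  ∣δ∣≲ : ∀ n {M ε} → 0ℚ ≤ ε → 1ℚ ≤ M → 5ℚ ≤ ε * M →
    1ᴿ ≲ log (fromℕᴿ (suc n)) × fromℚ M ≲ log (log (fromℕᴿ (suc n))) → ∣ δ (suc n) ∣ᴿ ≲ fromℚ ε
  ∣δ∣≲ n {M} {ε} 0≤ε 1≤M 5≤ (1≲log , M≲loglog) =
    ∣*-recip∣≲ {excess n (log (fromℚ (invProb n))) (log (log (fromℕᴿ (suc n))))} {log (log (fromℕᴿ (suc n)))} {5ℚ} {M} {ε}
      (δ (suc n)) (δ≋ n) 0≤ε (1≤⇒1≲ {M} {log (log (fromℕᴿ (suc n)))} 1≤M M≲loglog) M≲loglog 5≤ (proj₁ bounds) (proj₂ bounds)
    where
    bounds = excess-bounds n (log (fromℕᴿ (suc n))) (log (log (fromℕᴿ (suc n)))) (log (fromℚ (invProb n)))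
      (log-nonNeg (log (fromℕᴿ (suc n)))) (log-nonNeg (fromℚ (invProb n)))
      (exp∘log {log (fromℕᴿ (suc n))} 1≲log) (exp∘log {fromℚ (invProb n)} (1≲fromℚ-invProb n))
      1≲log (log≲h n) (h≲log+1 n)

  δ⟶0 : δ ⟶0
  -- The threshold `suc K` excludes k = 0, of which the specification of `δ` does not speak.
  δ⟶0 {ε} 0<ε = suc K , ℕ-ind (λ k → suc K ℕ.≤ k → ∣ δ k ∣ᴿ ≤ᴿ fromℚ ε)
    (λ ()) (λ n _ K<k → below (∣δ∣≲ n {M} {ε} (<⇒≤ 0<ε) 1≤M 5≤εM (K-bounds n (ℕP.<⇒≤ K<k))))
    where
    -- The aim is 5 ≤ ε * M: choose η with 5 * η ≤ ε and then M = N + 1 with 1 / M ≤ η.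
    shr = shrink 5ℚ 0<ε
    sm  = 1/suc-small (proj₁ (proj₂ shr))
    N   = proj₁ sm
    M   = fromℕ (suc N)
    1≤M : 1ℚ ≤ M
    1≤M = fromℕ-mono {1} {suc N} (s≤s z≤n)
    5≤εM : 5ℚ ≤ ε * M
    5≤εM = ≤-trans (≤-reflexive (sym (k*/k N 5ℚ)))
      (≤-trans (≤-reflexive (solve 3 (λ s f i → s :* f :* i := f :* i :* s) refl M 5ℚ (1/suc N)))
        (*ʳ-≤ M (0≤fromℕ (suc N)) (≤-trans (*ˡ-≤ 5ℚ (0≤fromℕ 5) (proj₂ sm N ℕP.≤-refl)) (proj₂ (proj₂ shr)))))
    lu = loglog-unbounded M 1≤M
    K  = proj₁ lu
    K-bounds = proj₂ lu

  prob-Cat≋ : ∀ n → 1ᴿ ≲ log (log (fromℕᴿ (suc n))) →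
    fromℚ (prob (DTCS (suc n)) (Cat (suc n)))
      ≋ exp (-ᴿ ((1ᴿ +ᴿ δ (suc n)) *ᴿ (fromℕᴿ (suc n) *ᴿ log (log (fromℕᴿ (suc n))))))
  prob-Cat≋ n 1≲loglog = begin-equality
    fromℚ (prob (DTCS (suc n)) (Cat (suc n)))
      ≈⟨ fromℚ-cong (prob-Cat n) ⟩
    fromℚ (fromℕ (suc n) * catWeight n)
      ≈⟨ exp-neg {fromℕ (suc n) * catWeight n} {invProb n} (log (fromℚ (invProb n))) (prob*invProb n)
           (exp∘log {fromℚ (invProb n)} (1≲fromℚ-invProb n)) ⟩
    exp (-ᴿ log (fromℚ (invProb n)))
      ≈⟨ exp-cong { -ᴿ log (fromℚ (invProb n))}
           { -ᴿ ((1ᴿ +ᴿ δ (suc n)) *ᴿ (fromℕᴿ (suc n) *ᴿ log (log (fromℕᴿ (suc n)))))}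
           (-ᴿ-cong {log (fromℚ (invProb n))} {(1ᴿ +ᴿ δ (suc n)) *ᴿ (fromℕᴿ (suc n) *ᴿ log (log (fromℕᴿ (suc n))))}
             (≋-sym {(1ᴿ +ᴿ δ (suc n)) *ᴿ (fromℕᴿ (suc n) *ᴿ log (log (fromℕᴿ (suc n))))} {log (fromℚ (invProb n))}
               (excess-solves n (log (fromℚ (invProb n))) (log (log (fromℕᴿ (suc n)))) (δ (suc n)) 1≲loglog (δ≋ n)))) ⟩
    exp (-ᴿ ((1ᴿ +ᴿ δ (suc n)) *ᴿ (fromℕᴿ (suc n) *ᴿ log (log (fromℕᴿ (suc n)))))) ∎
    where open ≲-Reasoning

  prob-Cat≈ : ∃[ K ] ∀ k .{{_ : NonZero k}} → K ℕ.≤ k →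
    fromℚ (prob (DTCS k) (Cat k)) ≈ exp (-ᴿ ((1ᴿ +ᴿ δ k) *ᴿ (fromℕᴿ k *ᴿ log (log (fromℕᴿ k)))))
  prob-Cat≈ = proj₁ lu , ℕ-ind (λ k → .{{_ : NonZero k}} → proj₁ lu ℕ.≤ k →
      fromℚ (prob (DTCS k) (Cat k)) ≈ exp (-ᴿ ((1ᴿ +ᴿ δ k) *ᴿ (fromℕᴿ k *ᴿ log (log (fromℕᴿ k))))))
    (λ {{0≢0}} _ → contradiction refl (ℕ.≢-nonZero⁻¹ zero {{0≢0}}))
    (λ n _ K≤ → ≋⇒≈ {fromℚ (prob (DTCS (suc n)) (Cat (suc n)))}
      {exp (-ᴿ ((1ᴿ +ᴿ δ (suc n)) *ᴿ (fromℕᴿ (suc n) *ᴿ log (log (fromℕᴿ (suc n))))))}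
      (prob-Cat≋ n (1≲loglog (proj₂ lu n K≤))))
    where
    -- The threshold 1 for log log k is the one at which the clamped reciprocal becomes a true
    -- inverse.
    lu = loglog-unbounded 1ℚ ≤-refl
    1≲loglog : ∀ {x y} → 1ᴿ ≲ x × fromℚ 1ℚ ≲ y → 1ᴿ ≲ y
    1≲loglog = proj₂

-- The quotient x / log log k of the overview. The value at 0 is a default; at small positive k the
-- clamped `log` and `recip` keep the quotient defined.
deviation : ℕ → ℝ
deviation zero    = 0ᴿ
deviation (suc n) = excess n (log (fromℚ (invProb n))) (log (log (fromℕᴿ (suc n)))) *ᴿ recip (log (log (fromℕᴿ (suc n))))

asymptotics : ∃[ δ ] δ ⟶0 × (∃[ K ] ∀ k .{{_ : NonZero k}} → K ℕ.≤ k →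
  fromℚ (prob (DTCS k) (Cat k)) ≈ exp (-ᴿ ((1ᴿ +ᴿ δ k) *ᴿ (fromℕᴿ k *ᴿ log (log (fromℕᴿ k))))))
asymptotics = deviation , δ⟶0 deviation deviation≋ , prob-Cat≈ deviation deviation≋
  where
  deviation≋ : ∀ n → deviation (suc n) ≋
    (excess n (log (fromℚ (invProb n))) (log (log (fromℕᴿ (suc n)))) *ᴿ recip (log (log (fromℕᴿ (suc n)))))
  deviation≋ n = ≋-refl {deviation (suc n)}

lemma2p4 : (∀ k .{{_ : NonZero k}} T → IsMinimiser k T ⇔ T ≅ Cat k)
    × (∀ k .{{_ : NonZero k}} →
    prob (DTCS k) (Cat k) ≡ fromℕ k * ½ ^ (k ℕ.∸ 1) * productℚ (map (λ j → 1/h (suc j)) (upTo (k ℕ.∸ 1))))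
    × (∃[ δ ] δ ⟶0 × (∃[ K ] ∀ k .{{_ : NonZero k}} → K ℕ.≤ k →
    fromℚ (prob (DTCS k) (Cat k))
    ≈ exp (-ᴿ ((1ᴿ +ᴿ δ k) *ᴿ (fromℕᴿ k *ᴿ log (log (fromℕᴿ k)))))))
lemma2p4 = minimisers , probability , asymptotics
  where
  minimisers : ∀ k .{{_ : NonZero k}} T → IsMinimiser k T ⇔ T ≅ Cat k
  minimisers zero {{0≢0}} T = contradiction refl (ℕ.≢-nonZero⁻¹ zero {{0≢0}})
  minimisers (suc n) T = mk⇔ (minimiser⇒≅ n T) (≅⇒minimiser n T)
  probability : ∀ k .{{_ : NonZero k}} →
    prob (DTCS k) (Cat k) ≡ fromℕ k * ½ ^ (k ℕ.∸ 1) * productℚ (map (λ j → 1/h (suc j)) (upTo (k ℕ.∸ 1)))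
  probability zero {{0≢0}} = contradiction refl (ℕ.≢-nonZero⁻¹ zero {{0≢0}})
  probability (suc n) = trans (prob-Cat n) (trans (cong (fromℕ (suc n) *_) (catWeight-product n))
    (sym (*-assoc (fromℕ (suc n)) (½ ^ n) (productℚ (map (λ j → 1/h (suc j)) (upTo n))))))
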